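{- Let $c$ be a standard Coxeter element of $W$. Then $\mathbf M(\underline x,y,z)=\mathbf I(\underline x,y+z,z)$, where $$\mathbf I(\underline x,y,z)=\sum_{\substack{\alpha,\beta\in NC(W,c)\\ \alpha\ll\beta}}\Big(\prod_{s\in S\setminus\mathrm{supp}(\beta)}x_s\Big)y^{\mathrm{rk}(\alpha)}z^{\mathrm{rk}(\beta)-\mathrm{rk}(\alpha)},$$ $$\mathbf M(\underline x,y,z)=\sum_{\substack{\alpha,\beta\in NC(W,c)\\ \alpha\le\beta}}\mu(\alpha,\beta)\Big(\prod_{s\in S\setminus\mathrm{supp}(\beta)}x_s\Big)y^{\mathrm{rk}(\alpha)}(-z)^{\mathrm{rk}(\beta)-\mathrm{rk}(\alpha)},$$ and $\mu$ is the Möbius function of $(NC(W,c),\le)$.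
   Context: Let $W$ be a finite real reflection group with simple system of reflections $S$, set of reflections $T$, Coxeter length $\ell$; $(x_s)_{s\in S}$ are variables. $\mathrm{supp}(w)$ is the set of simple reflections occurring in a reduced expression of $w$. Absolute length $\ell_T(w)$: minimal number of reflections with product $w$; $\mathrm{rk}=\ell_T$; absolute order $v\le w$ iff $\ell_T(w)=\ell_T(v)+\ell_T(v^{ -1}w)$; $v\lessdot w$ means $v\le w$ and $\ell_T(v)=\ell_T(w)-1$; $\ll$ is the reflexive-transitive closure of "$v\lessdot w$ and $\ell(w)<\ell(v)$". A standard Coxeter element is a product of all elements of $S$, each once, in some order; $NC(W,c)=\{w:w\le c\}$. -}

module Defs where

open import Level using (0ℓ)
open import Data.Nat using (ℕ; zero; suc; _∸_; _≤_; _<_)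
open import Data.Nat using () renaming (_+_ to _+ℕ_)
open import Data.Nat.Properties using () renaming (_≟_ to _≟ℕ_)
open import Data.Fin using (Fin)
open import Data.List using (List; []; _∷_; length; foldr; allFin)
open import Data.List.Membership.Propositional using (_∈_)
open import Data.List.Relation.Unary.Unique.Propositional using (Unique)
open import Data.List.Relation.Unary.All using (All)
open import Data.List.Relation.Binary.Permutation.Propositional using (_↭_)
open import Data.Product using (Σ; _×_; ∃; _,_)
open import Data.Product.Properties using () 
open import Relation.Binary.PropositionalEquality using (_≡_; _≢_)
open import Relation.Binary.Definitions using (DecidableEquality)
open import Relation.Nullary using (Dec; yes; no; ¬_)
open import Relation.Nullary.Decidable using (⌊_⌋; _×-dec_)
open import Data.Bool using (Bool; true; false; if_then_else_)
open import Algebra.Bundles using (Group; CommutativeRing)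
open import Relation.Binary.Construct.Closure.ReflexiveTransitive using (Star)

powOp : {A : Set} → (A → A → A) → A → A → ℕ → A
powOp _∙_ u a zero    = u
powOp _∙_ u a (suc k) = a ∙ powOp _∙_ u a k

-- A finite Coxeter system (W,S), S = {gen i | i : Fin rank}, with Coxeter
-- matrix m.  W is a group (propositional equality), finite (enumerated by
-- a duplicate-free complete list), generated by S, the generators satisfy
-- the Coxeter relations, and (W,S) is *presented* by them: the universal
-- property of the group with presentation <S | (st)^{m(s,t)} = 1>.
-- (Finite Coxeter groups = finite real reflection groups, S = simple system.)
record FiniteCoxeterSystem : Set₁ where
  field
    W      : Set
    _·_    : W → W → W
    e      : W
    _⁻¹    : W → W
    assoc  : ∀ a b c → (a · b) · c ≡ a · (b · c)
    idˡ    : ∀ a → e · a ≡ a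
    idʳ    : ∀ a → a · e ≡ a
    invˡ   : ∀ a → (a ⁻¹) · a ≡ e
    invʳ   : ∀ a → a · (a ⁻¹) ≡ e
    _≟_    : DecidableEquality W
    elems  : List W
    elems-complete : ∀ w → w ∈ elems
    elems-unique   : Unique elems
    rank   : ℕ
    gen    : Fin rank → W
    m      : Fin rank → Fin rank → ℕ
    m-diag : ∀ i → m i i ≡ 1
    m-sym  : ∀ i j → m i j ≡ m j i
    m-off  : ∀ i j → i ≢ j → 2 ≤ m i j
    relations : ∀ i j → powOp _·_ e (gen i · gen j) (m i j) ≡ e
    generated : ∀ w → ∃ λ (ws : List (Fin rank)) → foldr (λ i v → gen i · v) e ws ≡ w
    universal : (H : Group 0ℓ 0ℓ) (f : Fin rank → Group.Carrier H) →
      (∀ i j → Group._≈_ H (powOp (Group._∙_ H) (Group.ε H) (Group._∙_ H (f i) (f j)) (m i j)) (Group.ε H)) →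
      Σ (W → Group.Carrier H) λ φ →
        (∀ a b → Group._≈_ H (φ (a · b)) (Group._∙_ H (φ a) (φ b))) ×
        (∀ i → Group._≈_ H (φ (gen i)) (f i))

module Cox (G : FiniteCoxeterSystem) where
  open FiniteCoxeterSystem G public

  word : List (Fin rank) → W
  word = foldr (λ i v → gen i · v) e

  prodW : List W → W
  prodW = foldr _·_ e

  Reduced : List (Fin rank) → Set
  Reduced ws = ∀ vs → word vs ≡ word ws → length ws ≤ length vs

  IsCoxeterLength : (W → ℕ) → Set
  IsCoxeterLength ℓ = ∀ w →
    (∃ λ ws → word ws ≡ w × length ws ≡ ℓ w) ×
    (∀ ws → word ws ≡ w → ℓ w ≤ length ws)

  IsReflection : W → Set
  IsReflection t = ∃ λ w → ∃ λ i → t ≡ (w · gen i) · (w ⁻¹)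

  IsAbsoluteLength : (W → ℕ) → Set
  IsAbsoluteLength ℓT = ∀ w →
    (∃ λ ts → All IsReflection ts × prodW ts ≡ w × length ts ≡ ℓT w) ×
    (∀ ts → All IsReflection ts → prodW ts ≡ w → ℓT w ≤ length ts)

  InSupp : Fin rank → W → Set
  InSupp i w = ∃ λ ws → word ws ≡ w × Reduced ws × i ∈ ws

  IsStandardCoxeter : W → Set
  IsStandardCoxeter c = ∃ λ ws → ws ↭ allFin rank × word ws ≡ c

  module Orders (ℓ ℓT : W → ℕ) where
    _≤A_ : W → W → Set
    v ≤A w = ℓT w ≡ ℓT v +ℕ ℓT ((v ⁻¹) · w)

    _≤A?_ : ∀ v w → Dec (v ≤A w)
    v ≤A? w = ℓT w ≟ℕ (ℓT v +ℕ ℓT ((v ⁻¹) · w))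

    _⋖_ : W → W → Set
    v ⋖ w = v ≤A w × suc (ℓT v) ≡ ℓT w

    Step : W → W → Set
    Step v w = v ⋖ w × ℓ w < ℓ v

    _≪_ : W → W → Set
    _≪_ = Star Step

    module Series (R : CommutativeRing 0ℓ 0ℓ) where
      open CommutativeRing R

      sumL : {A : Set} → List A → (A → Carrier) → Carrier
      sumL xs f = foldr (λ a r → f a + r) 0# xs

      prodL : {A : Set} → List A → (A → Carrier) → Carrier
      prodL xs f = foldr (λ a r → f a * r) 1# xs

      _^_ : Carrier → ℕ → Carrier
      a ^ k = powOp _*_ 1# a k

      [_]?_ : {P : Set} → Dec P → Carrier → Carrier
      [ d ]? a = if ⌊ d ⌋ then a else 0#

      xmon : (∀ i w → Dec (InSupp i w)) → (Fin rank → Carrier) → W → Carrier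
      xmon supp? x β = prodL (allFin rank) (λ i → if ⌊ supp? i β ⌋ then 1# else x i)

      IsMobius : W → (W → W → Carrier) → Set
      IsMobius c μ = ∀ α β → α ≤A c → β ≤A c → α ≤A β →
        sumL elems (λ γ → [ (γ ≤A? c) ×-dec ((α ≤A? γ) ×-dec (γ ≤A? β)) ]? μ α γ)
          ≈ (if ⌊ α ≟ β ⌋ then 1# else 0#)

      Iser : (supp? : ∀ i w → Dec (InSupp i w)) → (≪? : ∀ v w → Dec (v ≪ w)) →
             W → (Fin rank → Carrier) → Carrier → Carrier → Carrier
      Iser supp? ≪? c x y z =
        sumL elems λ α → sumL elems λ β →
          [ (α ≤A? c) ×-dec ((β ≤A? c) ×-dec ≪? α β) ]?
            (xmon supp? x β * (y ^ ℓT α) * (z ^ (ℓT β ∸ ℓT α)))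

      Mser : (supp? : ∀ i w → Dec (InSupp i w)) → (μ : W → W → Carrier) →
             W → (Fin rank → Carrier) → Carrier → Carrier → Carrier
      Mser supp? μ c x y z =
        sumL elems λ α → sumL elems λ β →
          [ (α ≤A? c) ×-dec ((β ≤A? c) ×-dec (α ≤A? β)) ]?
            (μ α β * xmon supp? x β * (y ^ ℓT α) * ((- z) ^ (ℓT β ∸ ℓT α)))

{-# OPTIONS --safe #-}

-- The coefficients of x in both series are compared for each β separately. For F(β) either of the two coefficients,
-- the sums of F(β) (-z)^(rk γ - rk β) over β ≤ γ equal y^(rk γ) for every γ ≤ c, and this determines F. For the
-- Möbius side this is the defining property of μ. For the other side it rests on the structure of noncrossing
-- partitions: γ ≤ c is the product r₁ ⋯ rₖ of the canonical generators of the reflection subgroup generated by the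
-- reflections below γ, and the alternating sum of (-1)^(rk β - rk α) over α ≪ β ≤ γ is 1 if α is a subproduct
-- of r₁ ⋯ rₖ and 0 otherwise, so that the binomial theorem applies. If no rᵢ can be deleted without losing α, then
-- β ↦ β⁻¹ γ identifies {β : α ≪ β ≤ γ} with the subproducts of α⁻¹ γ, because t is an inversion of α exactly when
-- its conjugate is one of α⁻¹ γ; if some rᵢ can be deleted, then every such β lies below the shorter product.
--
-- That γ has this form is clear for c and for its parabolic factors. In general γ lies below c t for a reflection t;
-- conjugating by the letters of c cyclically rotates c, and eventually makes t simple. Otherwise the orbit of the
-- positive root of t under c would consist of positive roots, and its sum would be a nonzero vector fixed by c, hence
-- by all simple reflections, which is impossible in a finite group. This argument needs a geometric representation
-- but no real numbers: 2 cos (π / m) is replaced by the adjacency operator of a path with m - 1 vertices.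
module Submission where

open import Defs
open import Level using (0ℓ)
open import Data.Nat using (ℕ)
open import Data.Fin using (Fin)
open import Relation.Nullary using (Dec)
open import Algebra.Bundles using (CommutativeRing)

open import Algebra.Bundles using (CommutativeMonoid)
open import Data.Bool using (if_then_else_)
open import Data.List using (List; []; _∷_; _++_; length; map; foldr; filter)
open import Data.List.Membership.Propositional using (_∈_; _∉_)
open import Data.List.Membership.Propositional.Properties using (∈-map⁺; ∈-map⁻; ∈-++⁺ˡ; ∈-++⁺ʳ; ∈-++⁻; ∈-∃++)
open import Data.List.Relation.Binary.Permutation.Propositional using (_↭_; ↭-refl; ↭-sym; ↭-trans; prep)
open import Data.List.Relation.Binary.Permutation.Propositional.Properties using (shift)
open import Data.List.Relation.Binary.Sublist.Propositional using (⊆-refl; ⊆-trans)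
open import Data.List.Relation.Binary.Sublist.Propositional.Properties using (length-mono-≤)
open import Data.List.Relation.Unary.All using (All; []; _∷_)
import Data.List.Relation.Unary.All as All
open import Data.List.Relation.Unary.AllPairs using ([]; _∷_)
open import Data.List.Relation.Unary.Any using (here; there)
open import Data.List.Relation.Unary.Unique.Propositional using (Unique)
import Data.List.Relation.Unary.Unique.Propositional.Properties as Unique
open import Data.Nat using (zero; suc; _∸_; _≤_; _<_; z≤n; s≤s)
import Data.Nat.Properties as ℕ
open import Data.Product using (Σ; ∃; ∃₂; _×_; _,_; proj₁; proj₂)
open import Data.Sum using (_⊎_; inj₁; inj₂)
open import Function using (_∘_; id; case_of_)
import Relation.Binary.PropositionalEquality as ≡
open ≡ using (_≡_; _≢_)
import Relation.Binary.Reasoning.Setoid as SetoidReasoning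
open import Relation.Nullary using (yes; no; ¬_; ¬?; contradiction)
open import Relation.Nullary.Decidable using (⌊_⌋; _×-dec_)

-- `W` is given only by its presentation, so exchange arguments have to be built first. A cocycle
-- `η` with values modulo 2 records inversions, and since it is defined on all of `W` at once it
-- restricts to every reflection subgroup: canonical generators, the exchange property and parabolic
-- subgroups are read off from it. Geometry supplies the rest: the absolute length of a product of
-- distinct simple reflections, the parabolic subgroup containing the reflections below it, and the
-- orbit argument. Positivity is meant coordinate by coordinate for integer sequences; it survives
-- the reflections because the Chebyshev polynomials of a path have nonnegative entries up to index
-- m. Finiteness of `W` enters through a vector `ρ` summed over all of `W`, which makes the Cartan
-- operator an M-matrix; this takes over the role of a positive definite form. The operators of all
-- pairs live on the same ℕ, cut off at a common multiple of the path sizes, so that solvability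
-- becomes a count of integer equations and unknowns.

module _ {A : Set} where

  unique-remove-∉ : ∀ (as : List A) {x bs} → Unique (as ++ x ∷ bs) → x ∉ as ++ bs
  unique-remove-∉ [] (p ∷ _) q = All.lookup p q ≡.refl
  unique-remove-∉ (a ∷ as) (p ∷ _) (here ≡.refl) = All.lookup p (∈-++⁺ʳ as (here ≡.refl)) ≡.refl
  unique-remove-∉ (a ∷ as) (_ ∷ u) (there q) = unique-remove-∉ as u q

  remove-mono : ∀ (as : List A) {x bs y} → y ∈ as ++ bs → y ∈ as ++ x ∷ bs
  remove-mono as p with ∈-++⁻ as p
  ... | inj₁ q = ∈-++⁺ˡ q
  ... | inj₂ q = ∈-++⁺ʳ as (there q)

  remove-≢ : ∀ (as : List A) {x bs y} → y ∈ as ++ x ∷ bs → y ≢ x → y ∈ as ++ bs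
  remove-≢ as p ne with ∈-++⁻ as p
  ... | inj₁ q = ∈-++⁺ˡ q
  ... | inj₂ (here q) = contradiction q ne
  ... | inj₂ (there q) = ∈-++⁺ʳ as q

  unique-remove : ∀ (as : List A) {x bs} → Unique (as ++ x ∷ bs) → Unique (as ++ bs)
  unique-remove [] (_ ∷ u) = u
  unique-remove (a ∷ as) (p ∷ u) = All.tabulate (λ q → All.lookup p (remove-mono as q)) ∷ unique-remove as u

  length-remove : ∀ (as : List A) {x bs} → length (as ++ x ∷ bs) ≡ suc (length (as ++ bs))
  length-remove [] = ≡.refl
  length-remove (a ∷ as) = ≡.cong suc (length-remove as)

  -- The length bound stands in for the converse inclusion, so that comparing ranks is enough to
  -- identify two sets of canonical generators.
  unique-⊆-↭ : ∀ {xs ys : List A} → Unique xs → Unique ys → (∀ {x} → x ∈ xs → x ∈ ys) → length ys ≤ length xs → xs ↭ ys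
  unique-⊆-↭ {[]} {[]} _ _ _ _ = ↭-refl
  unique-⊆-↭ {x ∷ xs} (p ∷ u) v f l with ∈-∃++ (f (here ≡.refl))
  ... | as , bs , ≡.refl = ↭-trans
    (prep x (unique-⊆-↭ u (unique-remove as v)
      (λ q → remove-≢ as (f (there q)) (λ e → All.lookup p q (≡.sym e)))
      (ℕ.≤-pred (≡.subst (_≤ _) (length-remove as) l))))
    (↭-sym (shift x as bs))

  unique-↭ : ∀ {xs ys : List A} → Unique xs → Unique ys → (∀ {x} → x ∈ xs → x ∈ ys) → (∀ {x} → x ∈ ys → x ∈ xs) → xs ↭ ys
  unique-↭ {[]} {[]} _ _ _ _ = ↭-refl
  unique-↭ {[]} {y ∷ ys} _ _ _ g = case g (here ≡.refl) of λ ()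
  unique-↭ {x ∷ xs} (p ∷ u) v f g with ∈-∃++ (f (here ≡.refl))
  ... | as , bs , ≡.refl = ↭-trans
    (prep x (unique-↭ u (unique-remove as v)
      (λ q → remove-≢ as (f (there q)) (λ e → All.lookup p q (≡.sym e)))
      (λ q → case g (remove-mono as q) of λ
        { (here e) → contradiction (≡.subst (_∈ as ++ bs) e q) (unique-remove-∉ as v)
        ; (there r) → r })))
    (↭-sym (shift x as bs))

-- Finite sums in a commutative monoid

module FiniteSum (M : CommutativeMonoid 0ℓ 0ℓ) where
  open CommutativeMonoid M

  Σ[_] : {A : Set} → List A → (A → Carrier) → Carrier
  Σ[ xs ] f = foldr (λ a r → f a ∙ r) ε xs

  module _ {A : Set} where
    Σ-cong : ∀ (xs : List A) {f g : A → Carrier} → (∀ x → f x ≈ g x) → Σ[ xs ] f ≈ Σ[ xs ] g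
    Σ-cong [] h = refl
    Σ-cong (x ∷ xs) h = ∙-cong (h x) (Σ-cong xs h)

    Σ-ε : ∀ (xs : List A) {f : A → Carrier} → (∀ x → f x ≈ ε) → Σ[ xs ] f ≈ ε
    Σ-ε [] h = refl
    Σ-ε (x ∷ xs) h = trans (∙-cong (h x) (Σ-ε xs h)) (identityˡ ε)

    medial : ∀ a b c d → (a ∙ b) ∙ (c ∙ d) ≈ (a ∙ c) ∙ (b ∙ d)
    medial a b c d = begin
      (a ∙ b) ∙ (c ∙ d)  ≈⟨ assoc a b (c ∙ d) ⟩
      a ∙ (b ∙ (c ∙ d))  ≈⟨ ∙-congˡ (assoc b c d) ⟨
      a ∙ ((b ∙ c) ∙ d)  ≈⟨ ∙-congˡ (∙-congʳ (comm b c)) ⟩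
      a ∙ ((c ∙ b) ∙ d)  ≈⟨ ∙-congˡ (assoc c b d) ⟩
      a ∙ (c ∙ (b ∙ d))  ≈⟨ assoc a c (b ∙ d) ⟨
      (a ∙ c) ∙ (b ∙ d)  ∎
      where open SetoidReasoning setoid

    Σ-∙ : ∀ (xs : List A) (f g : A → Carrier) → Σ[ xs ] (λ x → f x ∙ g x) ≈ Σ[ xs ] f ∙ Σ[ xs ] g
    Σ-∙ [] f g = sym (identityˡ ε)
    Σ-∙ (x ∷ xs) f g = trans (∙-congˡ (Σ-∙ xs f g)) (medial (f x) (g x) _ _)

    Σ-↭ : ∀ {xs ys : List A} (f : A → Carrier) → xs ↭ ys → Σ[ xs ] f ≈ Σ[ ys ] f
    Σ-↭ f _↭_.refl = CommutativeMonoid.refl M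
    Σ-↭ f (_↭_.prep x p) = ∙-congˡ (Σ-↭ f p)
    Σ-↭ f (_↭_.swap x y p) = trans (sym (assoc (f x) (f y) _)) (trans (∙-cong (comm (f x) (f y)) (Σ-↭ f p)) (assoc (f y) (f x) _))
    Σ-↭ f (_↭_.trans p q) = CommutativeMonoid.trans M (Σ-↭ f p) (Σ-↭ f q)

    Σ-++ : ∀ (xs ys : List A) (f : A → Carrier) → Σ[ xs ++ ys ] f ≈ Σ[ xs ] f ∙ Σ[ ys ] f
    Σ-++ [] ys f = sym (identityˡ _)
    Σ-++ (x ∷ xs) ys f = trans (∙-congˡ (Σ-++ xs ys f)) (sym (assoc _ _ _))

  Σ-map : ∀ {A B : Set} (g : A → B) (xs : List A) (f : B → Carrier) → Σ[ map g xs ] f ≡ Σ[ xs ] (f ∘ g)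
  Σ-map g [] f = ≡.refl
  Σ-map g (x ∷ xs) f = ≡.cong (f (g x) ∙_) (Σ-map g xs f)

  Σ-swap : ∀ {A B : Set} (xs : List A) (ys : List B) (f : A → B → Carrier) →
    Σ[ xs ] (λ x → Σ[ ys ] (f x)) ≈ Σ[ ys ] (λ y → Σ[ xs ] (λ x → f x y))
  Σ-swap [] ys f = sym (Σ-ε ys (λ _ → refl))
  Σ-swap (x ∷ xs) ys f = trans (∙-congˡ (Σ-swap xs ys f)) (sym (Σ-∙ ys (f x) _))

module Coxeter where
  open import Algebra.Bundles using (Group)
  open import Data.Bool using (Bool; true; false; not; _xor_)
  import Data.Bool.Properties as Bool
  open import Data.Fin using (zero; suc; toℕ; remQuot; combine)
  import Data.Fin as Fin
  import Data.Fin.Properties as Fin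
  open import Data.Integer using (ℤ; 0ℤ; 1ℤ; nonNegative; positive) renaming (_+_ to _⊕_; _*_ to _⊛_; -_ to ⊖_; _-_ to _⊝_; _≤_ to _≤ℤ_; _<_ to _<ℤ_)
  import Data.Integer as ℤ
  import Data.Integer.Properties as ℤ
  open import Data.Integer.Tactic.RingSolver using (solve-∀)
  open import Data.List using (allFin; _∷ʳ_; initLast; _∷ʳ′_; cartesianProduct; cartesianProductWith; upTo)
  import Data.List as List
  import Data.List.Properties as List
  open import Data.List.Membership.Propositional using (lose; find)
  open import Data.List.Membership.Propositional.Properties using (∈-allFin; ∈-lookup; ∈-upTo⁺; ∈-upTo⁻; ∈-cartesianProduct⁺; ∈-cartesianProduct⁻; ∈-cartesianProductWith⁺)
  open import Data.List.Relation.Binary.Permutation.Propositional.Properties using (∈-resp-↭; All-resp-↭)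
  open import Data.List.Relation.Binary.Sublist.Propositional using (_⊆_; minimum) renaming (lookup to ⊆-lookup; [] to done; _∷_ to keep; _∷ʳ_ to skip)
  import Data.List.Relation.Unary.All.Properties as All
  open import Data.List.Relation.Unary.Any using (index; any?)
  import Data.List.Relation.Unary.Any.Properties as Any
  open import Data.List.Reverse using (Reverse; reverseView; []; _∶_∶ʳ_)
  open import Data.Nat using (_+_; _*_; NonZero)
  import Data.Nat as ℕ
  open import Data.Nat.Divisibility using (_∣_; n∣m⇒m%n≡0)
  open import Data.Nat.DivMod using (_%_; _/_; m≡m%n+[m/n]*n; m%n<n; [m+kn]%n≡m%n; m<n⇒m%n≡m; n%n≡0)
  open import Data.Nat.ListAction using (product)
  open import Data.Nat.ListAction.Properties using (∈⇒∣product; product≢0)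
  import Data.Vec as Vec
  open import Relation.Binary.Construct.Closure.ReflexiveTransitive using (ε; _◅_)
  open import Relation.Binary.Definitions using (Tri; tri<; tri≈; tri>)
  open ≡ using (refl; sym; trans; cong; cong₂; subst; subst₂; setoid; module ≡-Reasoning)
  import Relation.Binary.Reflection as Reflection

  -- Reflections and the inversion cocycle

  module GroupSolver (G : FiniteCoxeterSystem) where
    open FiniteCoxeterSystem G

    infixr 6 _⊙_
    data Expr (n : ℕ) : Set where
      var : Fin n → Expr n
      _⊙_ : Expr n → Expr n → Expr n
      inv : Expr n → Expr n
      one : Expr n

    Word : ℕ → Set
    Word n = List (Fin n × Bool)

    cons : ∀ {n} → Fin n → Bool → Word n → Word n
    cons i b [] = (i , b) ∷ []
    cons i b ((j , b′) ∷ w) with i Fin.≟ j | b Bool.≟ not b′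
    ... | yes _ | yes _ = w
    ... | _     | _     = (i , b) ∷ (j , b′) ∷ w

    -- Inverses are pushed to the variables and words are reduced freely in an accumulator, so both
    -- sides of an identity valid in every group get the same normal form and `refl` proves it.
    -- Relations such as `gen²` are outside its reach and are inserted by hand between two calls.
    normal normalInv : ∀ {n} → Expr n → Word n → Word n
    normal (var i) w = cons i true w
    normal (a ⊙ b) w = normal a (normal b w)
    normal (inv a) w = normalInv a w
    normal one     w = w
    normalInv (var i) w = cons i false w
    normalInv (a ⊙ b) w = normalInv b (normalInv a w)
    normalInv (inv a) w = normal a w
    normalInv one     w = w

    ⟦_⟧ : ∀ {n} → Expr n → Vec.Vec W n → W
    ⟦ var i ⟧ ρ = Vec.lookup ρ i
    ⟦ a ⊙ b ⟧ ρ = ⟦ a ⟧ ρ · ⟦ b ⟧ ρ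
    ⟦ inv a ⟧ ρ = (⟦ a ⟧ ρ) ⁻¹
    ⟦ one   ⟧ ρ = e

    atom : ∀ {n} → Vec.Vec W n → Fin n → Bool → W
    atom ρ i true  = Vec.lookup ρ i
    atom ρ i false = (Vec.lookup ρ i) ⁻¹

    eval : ∀ {n} → Word n → Vec.Vec W n → W
    eval []            ρ = e
    eval ((i , b) ∷ w) ρ = atom ρ i b · eval w ρ

    inv-unique : ∀ {a b} → a · b ≡ e → b ≡ (a ⁻¹)
    inv-unique {a} {b} p = begin
      b               ≡⟨ sym (idˡ b) ⟩
      e · b           ≡⟨ cong (_· b) (sym (invˡ a)) ⟩
      ((a ⁻¹) · a) · b  ≡⟨ assoc _ _ _ ⟩
      (a ⁻¹) · (a · b)  ≡⟨ cong ((a ⁻¹) ·_) p ⟩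
      (a ⁻¹) · e        ≡⟨ idʳ _ ⟩
      (a ⁻¹)            ∎
      where open ≡-Reasoning

    inv-inv : ∀ a → (a ⁻¹) ⁻¹ ≡ a
    inv-inv a = sym (inv-unique (invˡ a))

    inv-e : e ⁻¹ ≡ e
    inv-e = sym (inv-unique (idˡ e))

    inv-· : ∀ a b → (a · b) ⁻¹ ≡ (b ⁻¹) · (a ⁻¹)
    inv-· a b = sym (inv-unique (begin
      (a · b) · ((b ⁻¹) · (a ⁻¹))   ≡⟨ assoc _ _ _ ⟩
      a · (b · ((b ⁻¹) · (a ⁻¹)))   ≡⟨ cong (a ·_) (sym (assoc _ _ _)) ⟩
      a · ((b · (b ⁻¹)) · (a ⁻¹))   ≡⟨ cong (λ u → a · (u · (a ⁻¹))) (invʳ b) ⟩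
      a · (e · (a ⁻¹))            ≡⟨ cong (a ·_) (idˡ _) ⟩
      a · (a ⁻¹)                  ≡⟨ invʳ a ⟩
      e                         ∎))
      where open ≡-Reasoning

    atom-not : ∀ {n} (ρ : Vec.Vec W n) i b u → atom ρ i (not b) · (atom ρ i b · u) ≡ u
    atom-not ρ i true u = trans (sym (assoc _ _ _)) (trans (cong (_· u) (invˡ _)) (idˡ u))
    atom-not ρ i false u = trans (sym (assoc _ _ _)) (trans (cong (_· u) (invʳ _)) (idˡ u))

    cons-sound : ∀ {n} (ρ : Vec.Vec W n) i b w → eval (cons i b w) ρ ≡ atom ρ i b · eval w ρ
    cons-sound ρ i b [] = refl
    cons-sound ρ i b ((j , b′) ∷ w) with i Fin.≟ j | b Bool.≟ not b′
    ... | yes refl | yes refl = sym (atom-not ρ i b′ _)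
    ... | yes _    | no _     = refl
    ... | no _     | yes _    = refl
    ... | no _     | no _     = refl

    normal-sound : ∀ {n} (a : Expr n) w ρ → eval (normal a w) ρ ≡ ⟦ a ⟧ ρ · eval w ρ
    normalInv-sound : ∀ {n} (a : Expr n) w ρ → eval (normalInv a w) ρ ≡ ((⟦ a ⟧ ρ) ⁻¹) · eval w ρ
    normal-sound (var i) w ρ = cons-sound ρ i true w
    normal-sound (a ⊙ b) w ρ = trans (normal-sound a _ ρ)
      (trans (cong (⟦ a ⟧ ρ ·_) (normal-sound b w ρ)) (sym (assoc _ _ _)))
    normal-sound (inv a) w ρ = normalInv-sound a w ρ
    normal-sound one w ρ = sym (idˡ _)
    normalInv-sound (var i) w ρ = cons-sound ρ i false w
    normalInv-sound (a ⊙ b) w ρ = trans (normalInv-sound b _ ρ)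
      (trans (cong (((⟦ b ⟧ ρ) ⁻¹) ·_) (normalInv-sound a w ρ))
        (trans (sym (assoc _ _ _)) (cong (_· eval w ρ) (sym (inv-· _ _)))))
    normalInv-sound (inv a) w ρ = trans (normal-sound a w ρ) (cong (_· eval w ρ) (sym (inv-inv _)))
    normalInv-sound one w ρ = sym (trans (cong (_· eval w ρ) inv-e) (idˡ _))

    ⟦_⇓⟧ : ∀ {n} → Expr n → Vec.Vec W n → W
    ⟦ a ⇓⟧ ρ = eval (normal a []) ρ

    open Reflection (setoid W) var ⟦_⟧ ⟦_⇓⟧ (λ a ρ → trans (normal-sound a [] ρ) (idʳ _)) public
      using () renaming (solve to group; _⊜_ to _≐_)

  module Reflections (G : FiniteCoxeterSystem) where
    open Cox G
    open GroupSolver G public using (group; _⊙_; inv; one; _≐_; inv-unique; inv-inv; inv-e; inv-·)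

    infix 8 _^^_
    _^^_ : W → W → W
    t ^^ w = w · (t · (w ⁻¹))

    ^^-· : ∀ t u v → t ^^ (u · v) ≡ (t ^^ v) ^^ u
    ^^-· = group 3 (λ t u v → (u ⊙ v) ⊙ (t ⊙ inv (u ⊙ v)) ≐ u ⊙ ((v ⊙ (t ⊙ inv v)) ⊙ inv u)) refl

    ^^-e : ∀ t → t ^^ e ≡ t
    ^^-e = group 1 (λ t → one ⊙ (t ⊙ inv one) ≐ t) refl

    ^^-inv : ∀ t w → (t ^^ w) ^^ (w ⁻¹) ≡ t
    ^^-inv = group 2 (λ t w → inv w ⊙ ((w ⊙ (t ⊙ inv w)) ⊙ inv (inv w)) ≐ t) refl

    ^^-inv′ : ∀ t w → (t ^^ (w ⁻¹)) ^^ w ≡ t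
    ^^-inv′ = group 2 (λ t w → w ⊙ ((inv w ⊙ (t ⊙ inv (inv w))) ⊙ inv w) ≐ t) refl

    gen² : ∀ i → gen i · gen i ≡ e
    gen² i = trans (sym (idʳ _)) (subst (λ k → powOp _·_ e (gen i · gen i) k ≡ e) (m-diag i) (relations i i))

    pow : W → ℕ → W
    pow = powOp _·_ e

    pow-comm : ∀ g k → g · pow g k ≡ pow g k · g
    pow-comm g zero = trans (idʳ g) (sym (idˡ g))
    pow-comm g (suc k) = trans (cong (g ·_) (pow-comm g k)) (sym (assoc _ _ _))

    pow-+ : ∀ g k l → pow g (k + l) ≡ pow g k · pow g l
    pow-+ g zero l = sym (idˡ _)
    pow-+ g (suc k) l = trans (cong (g ·_) (pow-+ g k l)) (sym (assoc _ _ _))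

    -- The inversion cocycle is obtained from the universal property with values in (W → Bool) ⋊ W.
    twisted : Group 0ℓ 0ℓ
    twisted = record
      { Carrier = (W → Bool) × W
      ; _≈_ = λ (f , u) (g , v) → (∀ t → f t ≡ g t) × u ≡ v
      ; _∙_ = λ (f , u) (g , v) → (λ t → g t xor f (t ^^ v)) , u · v
      ; ε = (λ _ → false) , e
      ; _⁻¹ = λ (f , u) → (λ t → f (t ^^ (u ⁻¹))) , (u ⁻¹)
      ; isGroup = record
        { isMonoid = record
          { isSemigroup = record
            { isMagma = record
              { isEquivalence = record
                { refl = (λ _ → refl) , refl
                ; sym = λ (p , q) → (λ t → sym (p t)) , sym q
                ; trans = λ (p , q) (p′ , q′) → (λ t → trans (p t) (p′ t)) , trans q q′
                }
              ; ∙-cong = λ { {_ , _} {_ , _} {_ , v} {_ , _} (p , q) (p′ , refl) →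
                  (λ t → cong₂ _xor_ (p′ t) (p (t ^^ v))) , cong (_· v) q }
              }
            ; assoc = λ (f , u) (g , v) (h , w) →
                (λ t → trans (sym (Bool.xor-assoc (h t) (g (t ^^ w)) (f ((t ^^ w) ^^ v))))
                             (cong (λ z → (h t xor g (t ^^ w)) xor f z) (sym (^^-· t v w))))
                , assoc u v w
            }
          ; identity = (λ (f , u) → (λ t → Bool.xor-identityʳ (f t)) , idˡ u)
                     , (λ (f , u) → (λ t → cong f (^^-e t)) , idʳ u)
          }
        ; inverse = (λ (f , u) → (λ t → trans (cong (λ z → f t xor f z) (^^-inv t u)) (Bool.xor-same (f t))) , invˡ u)
                  , (λ (f , u) → (λ t → Bool.xor-same (f (t ^^ (u ⁻¹)))) , invʳ u)
        ; ⁻¹-cong = λ { (p , refl) → (λ t → p _) , refl }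
        }
      }

    ⌊⌋-cong : ∀ {P Q : Set} (p : Dec P) (q : Dec Q) → (P → Q) → (Q → P) → ⌊ p ⌋ ≡ ⌊ q ⌋
    ⌊⌋-cong (yes _)  (yes _)  _ _ = refl
    ⌊⌋-cong (no _)   (no _)   _ _ = refl
    ⌊⌋-cong (yes p)  (no ¬q)  f _ = contradiction (f p) ¬q
    ⌊⌋-cong (no ¬p)  (yes q)  _ g = contradiction (g q) ¬p

    twistedGen : Fin rank → Group.Carrier twisted
    twistedGen i = (λ t → ⌊ t ≟ gen i ⌋) , gen i

    module TwistedRelation (i j : Fin rank) where
      private
        g = gen i · gen j
        open Group twisted using () renaming (_∙_ to _∙ᵗ_; ε to εᵗ)

      -- The elements s_j g^r are the reflections of the dihedral subgroup, and `X r t` counts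
      -- modulo 2 how often t occurs among the first r of them. This list has period `m i j`, so
      -- along two periods every reflection is counted an even number of times; that is the Coxeter
      -- relation in `twisted`.
      B : ℕ → W → Bool
      B r t = ⌊ t ≟ (gen j · pow g r) ⌋

      X : ℕ → W → Bool
      X zero    t = false
      X (suc r) t = X r t xor B r t

      -- Conjugation by `gen j` inverts g, since both letters of g are involutions. This is what
      -- lets `double` and `double-suc` recognise s_j g^r as a conjugate of s_j or of s_j s_i s_j.
      sandwich : ∀ k → pow g k · (gen j · pow g k) ≡ gen j
      sandwich zero = trans (idˡ _) (idʳ _)
      sandwich (suc k) = begin
        (g · p) · (gen j · (g · p))     ≡⟨ cong (_· (gen j · (g · p))) (pow-comm g k) ⟩
        (p · g) · (gen j · (g · p))     ≡⟨ group 4 (λ p si sj sj′ →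
                                              (p ⊙ (si ⊙ sj)) ⊙ (sj′ ⊙ ((si ⊙ sj) ⊙ p))
                                              ≐ p ⊙ ((si ⊙ ((sj ⊙ sj′) ⊙ si)) ⊙ (sj ⊙ p))) refl
                                              p (gen i) (gen j) (gen j) ⟩
        p · ((gen i · ((gen j · gen j) · gen i)) · (gen j · p))
          ≡⟨ cong (λ u → p · ((gen i · (u · gen i)) · (gen j · p))) (gen² j) ⟩
        p · ((gen i · (e · gen i)) · (gen j · p))
          ≡⟨ cong (λ u → p · ((gen i · u) · (gen j · p))) (idˡ _) ⟩
        p · ((gen i · gen i) · (gen j · p))
          ≡⟨ cong (λ u → p · (u · (gen j · p))) (gen² i) ⟩
        p · (e · (gen j · p))           ≡⟨ cong (p ·_) (idˡ _) ⟩
        p · (gen j · p)                 ≡⟨ sandwich k ⟩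
        gen j                           ∎
        where
          open ≡-Reasoning
          p = pow g k

      double : ∀ k → gen j · pow g (k + k) ≡ gen j ^^ (pow g k ⁻¹)
      double k = begin
        gen j · pow g (k + k)       ≡⟨ cong (gen j ·_) (pow-+ g k k) ⟩
        gen j · (p · p)             ≡⟨ group 2 (λ s p → s ⊙ (p ⊙ p) ≐ inv p ⊙ ((p ⊙ (s ⊙ p)) ⊙ p)) refl (gen j) p ⟩
        (p ⁻¹) · ((p · (gen j · p)) · p)  ≡⟨ cong (λ u → (p ⁻¹) · (u · p)) (sandwich k) ⟩
        (p ⁻¹) · (gen j · p)        ≡⟨ cong (λ u → (p ⁻¹) · (gen j · u)) (sym (inv-inv p)) ⟩
        gen j ^^ (p ⁻¹)             ∎
        where
          open ≡-Reasoning
          p = pow g k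

      double-suc : ∀ k → gen j · pow g (suc (k + k)) ≡ (gen i ^^ gen j) ^^ (pow g k ⁻¹)
      double-suc k = begin
        gen j · (g · pow g (k + k))   ≡⟨ cong (λ u → gen j · (g · u)) (pow-+ g k k) ⟩
        gen j · (g · (p · p))         ≡⟨ cong (gen j ·_) (sym (assoc _ _ _)) ⟩
        gen j · ((g · p) · p)         ≡⟨ cong (λ u → gen j · (u · p)) (pow-comm g k) ⟩
        gen j · ((p · g) · p)         ≡⟨ group 3 (λ s p g → s ⊙ ((p ⊙ g) ⊙ p) ≐ inv p ⊙ ((p ⊙ (s ⊙ p)) ⊙ (g ⊙ p))) refl (gen j) p g ⟩
        (p ⁻¹) · ((p · (gen j · p)) · (g · p))  ≡⟨ cong (λ u → (p ⁻¹) · (u · (g · p))) (sandwich k) ⟩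
        (p ⁻¹) · (gen j · (g · p))    ≡⟨ group 3 (λ p si sj → inv p ⊙ (sj ⊙ ((si ⊙ sj) ⊙ p)) ≐ inv p ⊙ ((sj ⊙ (si ⊙ sj)) ⊙ inv (inv p))) refl p (gen i) (gen j) ⟩
        (gen j · (gen i · gen j)) ^^ (p ⁻¹)  ≡⟨ cong (λ u → (gen j · (gen i · u)) ^^ (p ⁻¹)) (inv-unique (gen² j)) ⟩
        (gen i ^^ gen j) ^^ (p ⁻¹)    ∎
        where
          open ≡-Reasoning
          p = pow g k

      power : ℕ → Group.Carrier twisted
      power = powOp _∙ᵗ_ εᵗ (twistedGen i ∙ᵗ twistedGen j)

      power₂ : ∀ k → proj₂ (power k) ≡ pow g k
      power₂ zero    = refl
      power₂ (suc k) = cong (g ·_) (power₂ k)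

      move : ∀ {t u w} → t ^^ w ≡ u → t ≡ u ^^ (w ⁻¹)
      move {t} {_} {w} refl = sym (^^-inv t w)

      -- Each factor of the twisted power has two letters and contributes one reflection for each;
      -- hence the index k + k.
      power₁ : ∀ k t → proj₁ (power k) t ≡ X (k + k) t
      power₁ zero t = refl
      power₁ (suc k) t rewrite ℕ.+-suc k k | power₂ k | power₁ k t =
        trans (cong (X (k + k) t xor_) (cong₂ _xor_ even odd)) (sym (Bool.xor-assoc (X (k + k) t) _ _))
        where
          u = t ^^ pow g k
          even : ⌊ u ≟ gen j ⌋ ≡ B (k + k) t
          even = ⌊⌋-cong (u ≟ gen j) (t ≟ (gen j · pow g (k + k)))
            (λ p → trans (move p) (sym (double k)))
            (λ p → trans (cong (_^^ pow g k) (trans p (double k))) (^^-inv′ _ _))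
          odd : ⌊ (u ^^ gen j) ≟ gen i ⌋ ≡ B (suc (k + k)) t
          odd = ⌊⌋-cong ((u ^^ gen j) ≟ gen i) (t ≟ (gen j · pow g (suc (k + k))))
            (λ p → trans (move (trans (move p) (cong (gen i ^^_) (sym (inv-unique (gen² j)))))) (sym (double-suc k)))
            (λ p → trans (cong (λ z → (z ^^ pow g k) ^^ gen j) (trans p (double-suc k)))
                     (trans (cong (_^^ gen j) (^^-inv′ _ _))
                       (trans (cong (λ z → (gen i ^^ z) ^^ gen j) (inv-unique (gen² j))) (^^-inv′ _ _))))

      X-+ : ∀ {k} → pow g k ≡ e → ∀ r t → X (r + k) t ≡ X r t xor X k t
      X-+ p zero t = refl
      X-+ {k} p (suc r) t = begin
        X (r + k) t xor B (r + k) t       ≡⟨ cong₂ _xor_ (X-+ p r t) (cong (λ z → ⌊ t ≟ (gen j · z) ⌋)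
                                                (trans (pow-+ g r k) (trans (cong (pow g r ·_) p) (idʳ _)))) ⟩
        (X r t xor X k t) xor B r t       ≡⟨ Bool.xor-assoc (X r t) _ _ ⟩
        X r t xor (X k t xor B r t)       ≡⟨ cong (X r t xor_) (Bool.xor-comm (X k t) _) ⟩
        X r t xor (B r t xor X k t)       ≡⟨ sym (Bool.xor-assoc (X r t) _ _) ⟩
        (X r t xor B r t) xor X k t       ∎
        where open ≡-Reasoning

      relation : Group._≈_ twisted (power (m i j)) εᵗ
      relation = (λ t → trans (power₁ (m i j) t) (trans (X-+ (relations i j) (m i j) t) (Bool.xor-same (X (m i j) t))))
               , trans (power₂ (m i j)) (relations i j)

    private
      lift : Σ (W → Group.Carrier twisted) _
      lift = universal twisted twistedGen TwistedRelation.relation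
      open Group twisted using () renaming (_≈_ to _≈ᵗ_; _∙_ to _∙ᵗ_)
      lift-· : ∀ u v → proj₁ lift (u · v) ≈ᵗ (proj₁ lift u ∙ᵗ proj₁ lift v)
      lift-· = proj₁ (proj₂ lift)
      lift-gen : ∀ i → proj₁ lift (gen i) ≈ᵗ twistedGen i
      lift-gen = proj₂ (proj₂ lift)

    -- For a reflection t this says that t is a right inversion of w: `ℓ-descent` and `ℓ-descent⁻¹`
    -- identify it with ℓ (w · t) < ℓ w. As a cocycle it can be computed from any word for w,
    -- reduced or not.
    η : W → W → Bool
    η w t = proj₁ (proj₁ lift w) t

    cancelˡ : ∀ {u v w} → u · v ≡ u · w → v ≡ w
    cancelˡ {u} {v} {w} p = trans (group 2 (λ u v → v ≐ inv u ⊙ (u ⊙ v)) refl u v)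
      (trans (cong ((u ⁻¹) ·_) p) (group 2 (λ u v → inv u ⊙ (u ⊙ v) ≐ v) refl u w))

    private
      -- The universal property only fixes the homomorphism on generators and does not mention `e`;
      -- multiplicativity gives the value at `e` by cancellation, and generation gives the rest.
      lift₂ : ∀ w → proj₂ (proj₁ lift w) ≡ w
      lift₂ w with generated w
      ... | ws , refl = go ws
        where
          π : W → W
          π w = proj₂ (proj₁ lift w)
          π-e : π e ≡ e
          π-e = cancelˡ (trans (sym (proj₂ (lift-· e e))) (trans (cong π (idˡ e)) (sym (idʳ _))))
          go : ∀ ws → π (word ws) ≡ word ws
          go [] = π-e
          go (i ∷ ws) = trans (proj₂ (lift-· _ _)) (cong₂ _·_ (proj₂ (lift-gen i)) (go ws))

    η-· : ∀ u v t → η (u · v) t ≡ η v t xor η u (t ^^ v)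
    η-· u v t = trans (proj₁ (lift-· u v) t) (cong (λ z → η v t xor η u (t ^^ z)) (lift₂ v))

    η-gen : ∀ i t → η (gen i) t ≡ ⌊ t ≟ gen i ⌋
    η-gen i t = proj₁ (lift-gen i) t

    η-e : ∀ t → η e t ≡ false
    η-e t = trans (cong (λ z → η z t) (sym (idˡ e)))
      (trans (η-· e e t) (trans (cong (λ z → η e t xor η e z) (^^-e t)) (Bool.xor-same (η e t))))

    true≢false : true ≢ false
    true≢false ()

    η-gen-true : ∀ {i t} → η (gen i) t ≡ true → t ≡ gen i
    η-gen-true {i} {t} p with t ≟ gen i | η-gen i t
    ... | yes q | _ = q
    ... | no _  | q = contradiction (trans (sym p) q) true≢false

    η-gen-self : ∀ i → η (gen i) (gen i) ≡ true
    η-gen-self i = trans (η-gen i (gen i)) (dec-true′ (gen i ≟ gen i) refl)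
      where
        dec-true′ : ∀ {P : Set} (p : Dec P) → P → ⌊ p ⌋ ≡ true
        dec-true′ (yes _) _ = refl
        dec-true′ (no ¬p) p = contradiction p ¬p

    xor-false : ∀ {a b} → a xor b ≡ false → a ≡ b
    xor-false {false} {false} _ = refl
    xor-false {true}  {true}  _ = refl

    η-conj : ∀ w t → η (w ⁻¹) (t ^^ w) ≡ η w t
    η-conj w t = sym (xor-false (trans (sym (η-· (w ⁻¹) w t)) (trans (cong (λ z → η z t) (invˡ w)) (η-e t))))

    refl-gen : ∀ i → IsReflection (gen i)
    refl-gen i = e , i , group 1 (λ s → s ≐ (one ⊙ s) ⊙ inv one) refl (gen i)

    refl-form : ∀ {t} → ((w , i , _) : IsReflection t) → t ≡ gen i ^^ w
    refl-form (w , i , p) = trans p (assoc _ _ _)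

    refl-^^ : ∀ {t} w → IsReflection t → IsReflection (t ^^ w)
    refl-^^ w (u , i , refl) = w · u , i ,
      group 3 (λ s w u → w ⊙ (((u ⊙ s) ⊙ inv u) ⊙ inv w) ≐ ((w ⊙ u) ⊙ s) ⊙ inv (w ⊙ u)) refl (gen i) w u

    refl² : ∀ {t} → IsReflection t → t · t ≡ e
    refl² (u , i , refl) = begin
      ((u · gen i) · (u ⁻¹)) · ((u · gen i) · (u ⁻¹))
        ≡⟨ group 2 (λ u s → ((u ⊙ s) ⊙ inv u) ⊙ ((u ⊙ s) ⊙ inv u) ≐ (u ⊙ (s ⊙ s)) ⊙ inv u) refl u (gen i) ⟩
      (u · (gen i · gen i)) · (u ⁻¹)   ≡⟨ cong (λ z → (u · z) · (u ⁻¹)) (gen² i) ⟩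
      (u · e) · (u ⁻¹)                 ≡⟨ group 1 (λ u → (u ⊙ one) ⊙ inv u ≐ one) refl u ⟩
      e                                ∎
      where open ≡-Reasoning

    refl-inv : ∀ {t} → IsReflection t → t ⁻¹ ≡ t
    refl-inv r = sym (inv-unique (refl² r))

    gen⁻¹ : ∀ i → gen i ⁻¹ ≡ gen i
    gen⁻¹ i = refl-inv (refl-gen i)

    refl-^^-self : ∀ {t} → IsReflection t → t ^^ t ≡ t
    refl-^^-self {t} r = trans (group 1 (λ t → t ⊙ (t ⊙ inv t) ≐ t) refl t) refl

    -- Write t = w s w⁻¹. The contributions of w and of w⁻¹ are both `η w s` and cancel modulo 2, so
    -- that only `η s s` remains.
    η-self : ∀ {t} → IsReflection t → η t t ≡ true
    η-self {t} r@(w , i , _) = begin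
      η t t                                            ≡⟨ cong (λ z → η z t) (refl-form r) ⟩
      η (w · (s · (w ⁻¹))) t                           ≡⟨ η-· w (s · (w ⁻¹)) t ⟩
      η (s · (w ⁻¹)) t xor η w (t ^^ (s · (w ⁻¹)))     ≡⟨ cong₂ _xor_ (η-· s (w ⁻¹) t) (cong (η w) (^^-· t s (w ⁻¹))) ⟩
      (η (w ⁻¹) t xor η s (t ^^ (w ⁻¹))) xor η w ((t ^^ (w ⁻¹)) ^^ s)
        ≡⟨ cong (λ z → (η (w ⁻¹) t xor η s z) xor η w (z ^^ s)) back ⟩
      (η (w ⁻¹) t xor η s s) xor η w (s ^^ s)
        ≡⟨ cong₂ (λ a b → (a xor η s s) xor η w b) (trans (cong (η (w ⁻¹)) (refl-form r)) (η-conj w s)) (refl-^^-self (refl-gen i)) ⟩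
      (η w s xor η s s) xor η w s                      ≡⟨ cong (λ z → (η w s xor z) xor η w s) (η-gen-self i) ⟩
      (η w s xor true) xor η w s                       ≡⟨ xor-cancel (η w s) ⟩
      true                                             ∎
      where
        open ≡-Reasoning
        s = gen i
        back : t ^^ (w ⁻¹) ≡ s
        back = trans (cong (_^^ (w ⁻¹)) (refl-form r)) (^^-inv s w)
        xor-cancel : ∀ b → (b xor true) xor b ≡ true
        xor-cancel false = refl
        xor-cancel true  = refl

    η-flip : ∀ {t} → IsReflection t → ∀ w → η (w · t) t ≡ not (η w t)
    η-flip {t} r w = begin
      η (w · t) t              ≡⟨ η-· w t t ⟩
      η t t xor η w (t ^^ t)   ≡⟨ cong₂ (λ a b → a xor η w b) (η-self r) (refl-^^-self r) ⟩
      not (η w t)              ∎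
      where open ≡-Reasoning

  -- Simple systems of reflection subgroups

  module SimpleSystems (G : FiniteCoxeterSystem) where
    open Cox G
    open Reflections G public

    prodW-++ : ∀ us vs → prodW (us ++ vs) ≡ prodW us · prodW vs
    prodW-++ [] vs = sym (idˡ _)
    prodW-++ (u ∷ us) vs = trans (cong (u ·_) (prodW-++ us vs)) (sym (assoc _ _ _))

    prodW-∷ʳ : ∀ us u → prodW (us ∷ʳ u) ≡ prodW us · u
    prodW-∷ʳ us u = trans (prodW-++ us (u ∷ [])) (cong (prodW us ·_) (idʳ u))

    prodW-gen : ∀ ws → prodW (map gen ws) ≡ word ws
    prodW-gen [] = refl
    prodW-gen (i ∷ ws) = cong (gen i ·_) (prodW-gen ws)

    prodW-map-^^ : ∀ x us → prodW (map (_^^ x) us) ≡ prodW us ^^ x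
    prodW-map-^^ x [] = group 1 (λ x → one ≐ x ⊙ (one ⊙ inv x)) refl x
    prodW-map-^^ x (u ∷ us) = trans (cong ((u ^^ x) ·_) (prodW-map-^^ x us))
      (group 3 (λ x u v → (x ⊙ (u ⊙ inv x)) ⊙ (x ⊙ (v ⊙ inv x)) ≐ x ⊙ ((u ⊙ v) ⊙ inv x)) refl x u (prodW us))

    ⟨_⟩ : List W → W → Set
    ⟨ rs ⟩ w = ∃ λ us → All (_∈ rs) us × prodW us ≡ w

    ⟨⟩-e : ∀ {rs} → ⟨ rs ⟩ e
    ⟨⟩-e = [] , [] , refl

    ⟨⟩-∈ : ∀ {rs r} → r ∈ rs → ⟨ rs ⟩ r
    ⟨⟩-∈ {r = r} p = r ∷ [] , p ∷ [] , idʳ r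

    ⟨⟩-· : ∀ {rs u v} → ⟨ rs ⟩ u → ⟨ rs ⟩ v → ⟨ rs ⟩ (u · v)
    ⟨⟩-· (us , p , refl) (vs , q , refl) = us ++ vs , All.++⁺ p q , prodW-++ us vs

    ⟨⟩-prod : ∀ {rs us} → All ⟨ rs ⟩ us → ⟨ rs ⟩ (prodW us)
    ⟨⟩-prod [] = ⟨⟩-e
    ⟨⟩-prod (p ∷ ps) = ⟨⟩-· p (⟨⟩-prod ps)

    ⟨⟩-least : ∀ {rs ss w} → (∀ {r} → r ∈ rs → ⟨ ss ⟩ r) → ⟨ rs ⟩ w → ⟨ ss ⟩ w
    ⟨⟩-least f (us , p , refl) = ⟨⟩-prod (All.map f p)

    ⟨⟩-mono : ∀ {rs ss w} → (∀ {r} → r ∈ rs → r ∈ ss) → ⟨ rs ⟩ w → ⟨ ss ⟩ w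
    ⟨⟩-mono f = ⟨⟩-least (⟨⟩-∈ ∘ f)

    ⟨⟩-inv : ∀ {rs w} → All IsReflection rs → ⟨ rs ⟩ w → ⟨ rs ⟩ (w ⁻¹)
    ⟨⟩-inv {rs} R (us , p , refl) = go us p
      where
        go : ∀ us → All (_∈ rs) us → ⟨ rs ⟩ (prodW us ⁻¹)
        go [] [] = subst ⟨ rs ⟩ (sym inv-e) ⟨⟩-e
        go (u ∷ us) (q ∷ qs) = subst ⟨ rs ⟩ (sym (inv-· _ _))
          (⟨⟩-· (go us qs) (subst ⟨ rs ⟩ (sym (refl-inv (All.lookup R q))) (⟨⟩-∈ q)))

    ⟨⟩-^^ : ∀ {rs t w} → All IsReflection rs → ⟨ rs ⟩ t → ⟨ rs ⟩ w → ⟨ rs ⟩ (t ^^ w)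
    ⟨⟩-^^ R p q = ⟨⟩-· q (⟨⟩-· p (⟨⟩-inv R q))

    ⟨⟩-map-^^ : ∀ {rs w} x → ⟨ rs ⟩ w → ⟨ map (_^^ x) rs ⟩ (w ^^ x)
    ⟨⟩-map-^^ x (us , p , refl) = map (_^^ x) us , All.map⁺ (All.map (∈-map⁺ (_^^ x)) p) , prodW-map-^^ x us

    -- In Dyer's description, the canonical generators of a reflection subgroup are those of its
    -- reflections whose only inversion inside the subgroup is themselves. The condition says this
    -- of every member of rs; `canonical` shows that no generator of this kind is missing.
    Simple : List W → Set
    Simple rs = All IsReflection rs ×
      (∀ {r t} → r ∈ rs → IsReflection t → ⟨ rs ⟩ t → η r t ≡ true → t ≡ r)

    simple-⊆ : ∀ {rs ss} → (∀ {r} → r ∈ rs → r ∈ ss) → Simple ss → Simple rs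
    simple-⊆ f (R , S) = All.tabulate (All.lookup R ∘ f) , λ p rt q → S (f p) rt (⟨⟩-mono f q)

    simple-gen : ∀ L → Simple (map gen L)
    simple-gen L = All.map⁺ (All.tabulate (λ {i} _ → refl-gen i)) , λ p _ _ h →
      case ∈-map⁻ gen p of λ { (i , _ , refl) → η-gen-true h }

    removed : ∀ as r bs → IsReflection r → prodW (as ++ r ∷ bs) · (r ^^ (prodW bs ⁻¹)) ≡ prodW (as ++ bs)
    removed as r bs R = begin
      prodW (as ++ r ∷ bs) · (r ^^ (B ⁻¹))   ≡⟨ cong (_· (r ^^ (B ⁻¹))) (prodW-++ as (r ∷ bs)) ⟩
      (A · (r · B)) · (r ^^ (B ⁻¹))          ≡⟨ group 3 (λ A r B → (A ⊙ (r ⊙ B)) ⊙ (inv B ⊙ (r ⊙ inv (inv B))) ≐ A ⊙ ((r ⊙ r) ⊙ B)) refl A r B ⟩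
      A · ((r · r) · B)                      ≡⟨ cong (λ z → A · (z · B)) (refl² R) ⟩
      A · (e · B)                            ≡⟨ cong (A ·_) (idˡ B) ⟩
      A · B                                  ≡⟨ sym (prodW-++ as bs) ⟩
      prodW (as ++ bs)                       ∎
      where
        open ≡-Reasoning
        A = prodW as
        B = prodW bs

    Deletion : List W → W → Set
    Deletion us t = ∃ λ as → ∃ λ r → ∃ λ bs → us ≡ as ++ r ∷ bs × t ≡ r ^^ (prodW bs ⁻¹)

    -- Strong exchange inside the subgroup generated by rs. As the suffix of the word grows, `η` at
    -- t passes from false to true at some letter u; there the conjugate of t by the suffix is an
    -- inversion of u in the subgroup, hence u itself.
    deletion : ∀ {rs} → Simple rs → ∀ us {t} → All (_∈ rs) us → IsReflection t → ⟨ rs ⟩ t →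
      η (prodW us) t ≡ true → Deletion us t
    deletion S [] {t} p R q h = contradiction (trans (sym h) (η-e t)) true≢false
    deletion S (u ∷ us) {t} (p ∷ ps) R q h with η (prodW us) t in eq
    ... | true = case deletion S us ps R q eq of λ { (as , r , bs , refl , y) → u ∷ as , r , bs , refl , y }
    ... | false = [] , u , us , refl , trans (sym (^^-inv t (prodW us))) (cong (_^^ (prodW us ⁻¹)) conj≡u)
      where
        conj≡u : t ^^ prodW us ≡ u
        conj≡u = proj₂ S p (refl-^^ (prodW us) R) (⟨⟩-^^ (proj₁ S) q (us , ps , refl))
          (trans (sym (trans (η-· u (prodW us) t) (cong (_xor η u (t ^^ prodW us)) eq))) h)

    -- Deletion expresses t through the letters of a word for w, and these all lie in ss.
    deletion-⟨⟩ : ∀ {rs ss w t} → Simple rs → (∀ {r} → r ∈ ss → r ∈ rs) → ⟨ ss ⟩ w → IsReflection t → ⟨ rs ⟩ t →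
      η w t ≡ true → ⟨ ss ⟩ t
    deletion-⟨⟩ {rs} {ss} S f (us , p , refl) R q h with deletion S us (All.map f p) R q h
    ... | as , r , bs , refl , refl with All.++⁻ʳ as p
    ...   | pr ∷ pbs = ⟨⟩-^^ (proj₁ (simple-⊆ f S)) (⟨⟩-∈ pr) (⟨⟩-inv (proj₁ (simple-⊆ f S)) (bs , pbs , refl))

    Indecomposable : List W → W → Set
    Indecomposable rs s = ∀ {t} → IsReflection t → ⟨ rs ⟩ t → η s t ≡ true → t ≡ s

    -- The last letter r of a shortest word for s satisfies η s r, hence equals s.
    canonical : ∀ {rs s} → Simple rs → IsReflection s → Indecomposable rs s →
      ∀ us → All (_∈ rs) us → prodW us ≡ s → s ∈ us
    canonical {rs} {s} S R I us = go (length us) us ℕ.≤-refl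
      where
        go : ∀ n us → length us ≤ n → All (_∈ rs) us → prodW us ≡ s → s ∈ us
        go n us len p q with initLast us
        ... | [] = contradiction (trans (sym (η-self R)) (trans (cong (λ z → η z s) (sym q)) (η-e s))) true≢false
        ... | vs ∷ʳ′ r with All.++⁻ vs p
        ...   | pvs , pr ∷ [] with η s r in eq
        ...     | true = subst (_∈ vs ∷ʳ r) (I (All.lookup (proj₁ S) pr) (⟨⟩-∈ pr) eq) (∈-++⁺ʳ vs (here refl))
        ...     | false = shorten n len (deletion S vs pvs Rr (⟨⟩-∈ pr) descent)
          where
            Rr : IsReflection r
            Rr = All.lookup (proj₁ S) pr
            vs≡ : prodW vs ≡ s · r
            vs≡ = begin
              prodW vs             ≡⟨ sym (idʳ _) ⟩
              prodW vs · e         ≡⟨ cong (prodW vs ·_) (sym (refl² Rr)) ⟩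
              prodW vs · (r · r)   ≡⟨ sym (assoc _ _ _) ⟩
              (prodW vs · r) · r   ≡⟨ cong (_· r) (trans (sym (prodW-∷ʳ vs r)) q) ⟩
              s · r                ∎
              where open ≡-Reasoning
            descent : η (prodW vs) r ≡ true
            descent = trans (cong (λ z → η z r) vs≡) (trans (η-flip Rr s) (cong not eq))
            shorten : ∀ n → length (vs ∷ʳ r) ≤ n → Deletion vs r → s ∈ vs ∷ʳ r
            shorten zero l _ = contradiction (subst (_≤ 0) (trans (List.length-++ vs) (ℕ.+-comm (length vs) 1)) l) λ ()
            shorten (suc n) l (as , r′ , bs , refl , y) = back
              (go n (as ++ bs) len′ (All.++⁺ (All.++⁻ˡ as pvs) (case All.++⁻ʳ as pvs of λ { (_ ∷ z) → z })) prod≡)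
              where
                len′ : length (as ++ bs) ≤ n
                len′ = ℕ.≤-trans (ℕ.≤-trans (ℕ.≤-reflexive (List.length-++ as)) (ℕ.+-monoʳ-≤ (length as) (ℕ.n≤1+n _)))
                  (ℕ.≤-trans (ℕ.≤-reflexive (sym (List.length-++ as {r′ ∷ bs})))
                    (ℕ.≤-pred (subst (_≤ suc n) (trans (List.length-++ vs) (ℕ.+-comm (length vs) 1)) l)))
                Rr′ : IsReflection r′
                Rr′ = All.lookup (proj₁ S) (case All.++⁻ʳ as pvs of λ { (z ∷ _) → z })
                prod≡ : prodW (as ++ bs) ≡ s
                prod≡ = begin
                  prodW (as ++ bs)                            ≡⟨ sym (removed as r′ bs Rr′) ⟩
                  prodW (as ++ r′ ∷ bs) · (r′ ^^ (prodW bs ⁻¹)) ≡⟨ cong₂ _·_ vs≡ (sym y) ⟩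
                  (s · r) · r                                 ≡⟨ assoc _ _ _ ⟩
                  s · (r · r)                                 ≡⟨ cong (s ·_) (refl² Rr) ⟩
                  s · e                                       ≡⟨ idʳ s ⟩
                  s                                           ∎
                  where open ≡-Reasoning
                back : s ∈ as ++ bs → s ∈ (as ++ r′ ∷ bs) ∷ʳ r
                back z with ∈-++⁻ as z
                ... | inj₁ z₁ = ∈-++⁺ˡ (∈-++⁺ˡ z₁)
                ... | inj₂ z₂ = ∈-++⁺ˡ (∈-++⁺ʳ as (there z₂))

    -- A canonical generator of the larger subgroup stays indecomposable in the smaller one, so
    -- `canonical` finds it among the letters of any word that represents it.
    simple-∈ : ∀ {rs ss s} → Simple ss → (∀ {r} → r ∈ rs → r ∈ ss) → s ∈ ss → ⟨ rs ⟩ s → s ∈ rs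
    simple-∈ {rs} {ss} S f p (us , q , x) = All.lookup q
      (canonical (simple-⊆ f S) (All.lookup (proj₁ S) p) (λ R t h → proj₂ S p R (⟨⟩-mono f t) h) us q x)

    independent : ∀ as {r bs} → Simple (as ++ r ∷ bs) → Unique (as ++ r ∷ bs) → ¬ ⟨ as ++ bs ⟩ r
    independent as {r} S U p = unique-remove-∉ as U (simple-∈ S (remove-mono as) (∈-++⁺ʳ as (here refl)) p)

  -- Coxeter length and absolute order

  module CoxeterLength (G : FiniteCoxeterSystem)
    (ℓ : Cox.W G → ℕ) (isℓ : Cox.IsCoxeterLength G ℓ) where
    open Cox G
    open SimpleSystems G

    letters : ∀ L {us} → All (_∈ map gen L) us → ∃ λ ws → us ≡ map gen ws × All (_∈ L) ws
    letters L [] = [] , refl , []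
    letters L (p ∷ ps) with ∈-map⁻ gen p | letters L ps
    ... | i , q , refl | ws , refl , qs = i ∷ ws , refl , q ∷ qs

    ∈gens : ∀ ws → All (_∈ map gen (allFin rank)) (map gen ws)
    ∈gens ws = All.map⁺ (All.tabulate (λ {i} _ → ∈-map⁺ gen (∈-allFin i)))

    ⟨gens⟩ : ∀ w → ⟨ map gen (allFin rank) ⟩ w
    ⟨gens⟩ w with generated w
    ... | ws , refl = map gen ws , ∈gens ws , prodW-gen ws

    -- Exchange in a reduced word for w yields a word for w · t with one letter less.
    ℓ-descent : ∀ {w t} → IsReflection t → η w t ≡ true → ℓ (w · t) < ℓ w
    ℓ-descent {w} {t} R h with proj₁ (isℓ w)
    ... | ws , refl , len with deletion (simple-gen (allFin rank)) (map gen ws) (∈gens ws) R (⟨gens⟩ t)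
                                (subst (λ z → η z t ≡ true) (sym (prodW-gen ws)) h)
    ...   | as , r , bs , eq , y with subst (All (_∈ map gen (allFin rank))) eq (∈gens ws)
    ...     | A with All.++⁻ as A
    ...       | pas , pr ∷ pbs with letters (allFin rank) (All.++⁺ pas pbs)
    ...         | vs , vs≡ , _ = subst (ℓ (word ws · t) <_) len (ℕ.≤-<-trans (proj₂ (isℓ (word ws · t)) vs prod≡) short)
      where
        prod≡ : word vs ≡ word ws · t
        prod≡ = begin
          word vs            ≡⟨ sym (prodW-gen vs) ⟩
          prodW (map gen vs) ≡⟨ cong prodW (sym vs≡) ⟩
          prodW (as ++ bs)   ≡⟨ sym (removed as r bs (All.lookup (proj₁ (simple-gen (allFin rank))) pr)) ⟩
          prodW (as ++ r ∷ bs) · (r ^^ (prodW bs ⁻¹))  ≡⟨ cong₂ _·_ (trans (cong prodW (sym eq)) (prodW-gen ws)) (sym y) ⟩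
          word ws · t        ∎
          where open ≡-Reasoning
        short : length vs < length ws
        short = ℕ.≤-reflexive (begin
          suc (length vs)              ≡⟨ cong suc (trans (sym (List.length-map gen vs)) (cong length (sym vs≡))) ⟩
          suc (length (as ++ bs))      ≡⟨ cong suc (List.length-++ as) ⟩
          suc (length as + length bs)  ≡⟨ sym (ℕ.+-suc (length as) (length bs)) ⟩
          length as + suc (length bs)  ≡⟨ sym (List.length-++ as) ⟩
          length (as ++ r ∷ bs)        ≡⟨ cong length (sym eq) ⟩
          length (map gen ws)          ≡⟨ List.length-map gen ws ⟩
          length ws                    ∎)
          where open ≡-Reasoning

    ·-refl² : ∀ {t} → IsReflection t → ∀ w → (w · t) · t ≡ w
    ·-refl² {t} R w = trans (assoc _ _ _) (trans (cong (w ·_) (refl² R)) (idʳ w))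

    ℓ-ascent : ∀ {w t} → IsReflection t → η w t ≡ false → ℓ w < ℓ (w · t)
    ℓ-ascent {w} {t} R h = subst (λ z → ℓ z < ℓ (w · t)) (·-refl² R w)
      (ℓ-descent R (trans (η-flip R w) (cong not h)))

    ℓ-descent⁻¹ : ∀ {w t} → IsReflection t → ℓ (w · t) < ℓ w → η w t ≡ true
    ℓ-descent⁻¹ {w} {t} R h with η w t in eq
    ... | true  = refl
    ... | false = contradiction (ℓ-ascent R eq) (ℕ.<-asym h)

    descent : ∀ w → w ≢ e → ∃ λ i → η w (gen i) ≡ true
    descent w w≢e with proj₁ (isℓ w)
    ... | ws , eq , len with initLast ws
    ...   | [] = contradiction (sym eq) w≢e
    ...   | vs ∷ʳ′ i = i , ℓ-descent⁻¹ (refl-gen i) (ℕ.<-≤-trans (s≤s (proj₂ (isℓ (w · gen i)) vs vs≡))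
        (ℕ.≤-reflexive (trans (trans (ℕ.+-comm 1 (length vs)) (sym (List.length-++ vs))) len)))
      where
        vs≡ : word vs ≡ w · gen i
        vs≡ = begin
          word vs                        ≡⟨ sym (·-refl² (refl-gen i) _) ⟩
          (word vs · gen i) · gen i      ≡⟨ cong (λ z → (z · gen i) · gen i) (sym (prodW-gen vs)) ⟩
          (prodW (map gen vs) · gen i) · gen i  ≡⟨ cong (_· gen i) (sym (prodW-∷ʳ (map gen vs) (gen i))) ⟩
          prodW (map gen vs ∷ʳ gen i) · gen i   ≡⟨ cong (λ z → prodW z · gen i) (sym (List.map-++ gen vs (i ∷ []))) ⟩
          prodW (map gen (vs ∷ʳ i)) · gen i     ≡⟨ cong (_· gen i) (trans (prodW-gen (vs ∷ʳ i)) eq) ⟩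
          w · gen i                      ∎
          where open ≡-Reasoning

  module AbsoluteOrder (G : FiniteCoxeterSystem)
    (ℓ ℓT : Cox.W G → ℕ) (isℓT : Cox.IsAbsoluteLength G ℓT) where
    open Cox G
    open SimpleSystems G
    open Orders ℓ ℓT

    ℓT-min : ∀ ts → All IsReflection ts → ℓT (prodW ts) ≤ length ts
    ℓT-min ts R = proj₂ (isℓT (prodW ts)) ts R refl

    ℓT-e : ℓT e ≡ 0
    ℓT-e = ℕ.n≤0⇒n≡0 (ℓT-min [] [])

    ℓT-0 : ∀ {w} → ℓT w ≡ 0 → w ≡ e
    ℓT-0 {w} p with proj₁ (isℓT w)
    ... | [] , _ , q , _ = sym q
    ... | _ ∷ _ , _ , _ , q = case trans q p of λ ()

    ℓT-1 : ∀ {w} → ℓT w ≡ 1 → IsReflection w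
    ℓT-1 {w} p with proj₁ (isℓT w)
    ... | [] , _ , _ , q = case trans q p of λ ()
    ... | t ∷ [] , R ∷ _ , q , _ = subst IsReflection (trans (sym (idʳ t)) q) R
    ... | _ ∷ _ ∷ _ , _ , _ , q = case trans q p of λ ()

    ℓT-refl : ∀ {t} → IsReflection t → ℓT t ≡ 1
    ℓT-refl {t} R = ℕ.≤-antisym (subst (λ z → ℓT z ≤ 1) (idʳ t) (ℓT-min (t ∷ []) (R ∷ [])))
      (ℕ.n≢0⇒n>0 λ z → true≢false (trans (sym (η-self R)) (trans (cong (λ u → η u t) (ℓT-0 z)) (η-e t))))

    ℓT-· : ∀ u v → ℓT (u · v) ≤ ℓT u + ℓT v
    ℓT-· u v with proj₁ (isℓT u) | proj₁ (isℓT v)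
    ... | ts , R , refl , p | ts′ , R′ , refl , p′ = begin
      ℓT (prodW ts · prodW ts′)  ≡⟨ cong ℓT (sym (prodW-++ ts ts′)) ⟩
      ℓT (prodW (ts ++ ts′))     ≤⟨ ℓT-min (ts ++ ts′) (All.++⁺ R R′) ⟩
      length (ts ++ ts′)         ≡⟨ List.length-++ ts ⟩
      length ts + length ts′     ≡⟨ cong₂ _+_ p p′ ⟩
      _                          ∎
      where open ℕ.≤-Reasoning

    ℓT-^^-≤ : ∀ w x → ℓT (w ^^ x) ≤ ℓT w
    ℓT-^^-≤ w x with proj₁ (isℓT w)
    ... | ts , R , refl , p = begin
      ℓT (prodW ts ^^ x)              ≡⟨ cong ℓT (sym (prodW-map-^^ x ts)) ⟩
      ℓT (prodW (map (_^^ x) ts))     ≤⟨ ℓT-min (map (_^^ x) ts) (All.map⁺ (All.map (refl-^^ x) R)) ⟩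
      length (map (_^^ x) ts)         ≡⟨ List.length-map (_^^ x) ts ⟩
      length ts                       ≡⟨ p ⟩
      ℓT (prodW ts)                   ∎
      where open ℕ.≤-Reasoning

    ℓT-^^ : ∀ w x → ℓT (w ^^ x) ≡ ℓT w
    ℓT-^^ w x = ℕ.≤-antisym (ℓT-^^-≤ w x)
      (subst (λ z → ℓT z ≤ ℓT (w ^^ x)) (^^-inv w x) (ℓT-^^-≤ (w ^^ x) (x ⁻¹)))

    -- Subadditivity of `ℓT` always gives the other inequality.
    ≤A-intro : ∀ {u v} → ℓT u + ℓT ((u ⁻¹) · v) ≤ ℓT v → u ≤A v
    ≤A-intro {u} {v} p = ℕ.≤-antisym
      (subst (λ z → ℓT z ≤ ℓT u + ℓT ((u ⁻¹) · v)) (group 2 (λ u v → u ⊙ (inv u ⊙ v) ≐ v) refl u v) (ℓT-· u _)) p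

    ≤A-refl : ∀ {u} → u ≤A u
    ≤A-refl {u} = ≤A-intro (ℕ.≤-reflexive (trans (cong (λ z → ℓT u + ℓT z) (invˡ u)) (trans (cong (ℓT u +_) ℓT-e) (ℕ.+-identityʳ _))))

    ≤A⇒≤ : ∀ {u v} → u ≤A v → ℓT u ≤ ℓT v
    ≤A⇒≤ {u} {v} p = subst (ℓT u ≤_) (sym p) (ℕ.m≤m+n _ _)

    e≤A : ∀ {u} → e ≤A u
    e≤A {u} = ≤A-intro (ℕ.≤-reflexive (cong₂ _+_ ℓT-e (cong ℓT (group 1 (λ u → inv one ⊙ u ≐ u) refl u))))

    split : ∀ u v w → (u ⁻¹) · w ≡ ((u ⁻¹) · v) · ((v ⁻¹) · w)
    split = group 3 (λ u v w → inv u ⊙ w ≐ (inv u ⊙ v) ⊙ (inv v ⊙ w)) refl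

    ≤A-trans : ∀ {u v w} → u ≤A v → v ≤A w → u ≤A w
    ≤A-trans {u} {v} {w} p q = ≤A-intro (begin
      ℓT u + ℓT ((u ⁻¹) · w)     ≡⟨ cong (λ z → ℓT u + ℓT z) (split u v w) ⟩
      ℓT u + ℓT (((u ⁻¹) · v) · ((v ⁻¹) · w))  ≤⟨ ℕ.+-monoʳ-≤ (ℓT u) (ℓT-· _ _) ⟩
      ℓT u + (ℓT ((u ⁻¹) · v) + ℓT ((v ⁻¹) · w))  ≡⟨ sym (ℕ.+-assoc (ℓT u) _ _) ⟩
      (ℓT u + ℓT ((u ⁻¹) · v)) + ℓT ((v ⁻¹) · w)  ≡⟨ cong (_+ ℓT ((v ⁻¹) · w)) (sym p) ⟩
      ℓT v + ℓT ((v ⁻¹) · w)     ≡⟨ sym q ⟩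
      ℓT w                       ∎)
      where open ℕ.≤-Reasoning

    ≤A-≡ : ∀ {u v} → u ≤A v → ℓT v ≤ ℓT u → u ≡ v
    ≤A-≡ {u} {v} p q = trans (sym (idʳ u)) (trans (cong (u ·_) (sym (ℓT-0 z))) (group 2 (λ u v → u ⊙ (inv u ⊙ v) ≐ v) refl u v))
      where
        z : ℓT ((u ⁻¹) · v) ≡ 0
        z = ℕ.n≤0⇒n≡0 (ℕ.+-cancelˡ-≤ (ℓT u) _ _
          (subst (ℓT u + ℓT ((u ⁻¹) · v) ≤_) (sym (ℕ.+-identityʳ _)) (subst (_≤ ℓT u) p q)))

    ≤A-gap : ∀ {u v w} → u ≤A v → v ≤A w → ℓT ((u ⁻¹) · w) ≡ ℓT ((u ⁻¹) · v) + ℓT ((v ⁻¹) · w)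
    ≤A-gap {u} {v} {w} p q = ℕ.+-cancelˡ-≡ (ℓT u) _ _ (begin
      ℓT u + ℓT ((u ⁻¹) · w)                       ≡⟨ sym (≤A-trans p q) ⟩
      ℓT w                                         ≡⟨ q ⟩
      ℓT v + ℓT ((v ⁻¹) · w)                       ≡⟨ cong (_+ ℓT ((v ⁻¹) · w)) p ⟩
      (ℓT u + ℓT ((u ⁻¹) · v)) + ℓT ((v ⁻¹) · w)   ≡⟨ ℕ.+-assoc (ℓT u) _ _ ⟩
      ℓT u + (ℓT ((u ⁻¹) · v) + ℓT ((v ⁻¹) · w))   ∎)
      where open ≡-Reasoning

    -- Here v⁻¹ w is a right factor of u⁻¹ w while `_≤A_` speaks of left factors; conjugation
    -- invariance of `ℓT` moves it to the front. The same happens in `left-complement`.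
    ≤A-gapʳ : ∀ {u v w} → u ≤A v → v ≤A w → ((v ⁻¹) · w) ≤A ((u ⁻¹) · w)
    ≤A-gapʳ {u} {v} {w} p q = trans (≤A-gap p q) (trans (ℕ.+-comm (ℓT ((u ⁻¹) · v)) _) (cong (ℓT ((v ⁻¹) · w) +_)
      (trans (sym (ℓT-^^ ((u ⁻¹) · v) (x ⁻¹))) (cong ℓT
        (group 3 (λ u v w → inv (inv v ⊙ w) ⊙ ((inv u ⊙ v) ⊙ inv (inv (inv v ⊙ w))) ≐ inv (inv v ⊙ w) ⊙ (inv u ⊙ w)) refl u v w)))))
      where x = (v ⁻¹) · w

    ≤A-gapˡ : ∀ {u v w} → u ≤A v → v ≤A w → ((u ⁻¹) · v) ≤A ((u ⁻¹) · w)
    ≤A-gapˡ {u} {v} {w} p q = trans (≤A-gap p q) (cong (λ z → ℓT ((u ⁻¹) · v) + ℓT z)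
      (group 3 (λ u v w → inv v ⊙ w ≐ inv (inv u ⊙ v) ⊙ (inv u ⊙ w)) refl u v w))

    complement : ∀ {u w} → u ≤A w → ((u ⁻¹) · w) ≤A w
    complement {u} {w} p = subst (((u ⁻¹) · w) ≤A_) (group 1 (λ w → inv one ⊙ w ≐ w) refl w) (≤A-gapʳ e≤A p)

    ≤A-^^ : ∀ {u v} x → u ≤A v → (u ^^ x) ≤A (v ^^ x)
    ≤A-^^ {u} {v} x p = trans (ℓT-^^ v x) (trans p (cong₂ _+_ (sym (ℓT-^^ u x)) (trans (sym (ℓT-^^ _ x)) (cong ℓT
      (group 3 (λ u v x → x ⊙ ((inv u ⊙ v) ⊙ inv x) ≐ inv (x ⊙ (u ⊙ inv x)) ⊙ (x ⊙ (v ⊙ inv x))) refl u v x)))))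

    -- Both inequalities come from ℓT w ≤ ℓT (u v) + ℓT (v⁻¹ u⁻¹ w) for v ≤ u⁻¹ w.
    module _ {u v w : W} (p : u ≤A w) (q : v ≤A ((u ⁻¹) · w)) where
      private
        g = ℓT ((v ⁻¹) · ((u ⁻¹) · w))
        total : ℓT w ≡ (ℓT u + ℓT v) + g
        total = trans p (trans (cong (ℓT u +_) q) (sym (ℕ.+-assoc (ℓT u) _ _)))
        gap≡ : ℓT (((u · v) ⁻¹) · w) ≡ g
        gap≡ = cong ℓT (group 3 (λ u v w → inv (u ⊙ v) ⊙ w ≐ inv v ⊙ (inv u ⊙ w)) refl u v w)

      extendʳ : (u · v) ≤A w
      extendʳ = ≤A-intro (subst (_≤ ℓT w) (cong (ℓT (u · v) +_) (sym gap≡))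
        (ℕ.≤-trans (ℕ.+-monoˡ-≤ g (ℓT-· u v)) (ℕ.≤-reflexive (sym total))))

      extend-length : ℓT (u · v) ≡ ℓT u + ℓT v
      extend-length = ℕ.+-cancelʳ-≡ g _ _ (trans (sym (trans extendʳ (cong (ℓT (u · v) +_) gap≡))) total)

      extendˡ : u ≤A (u · v)
      extendˡ = trans extend-length (cong (λ z → ℓT u + ℓT z) (group 2 (λ u v → v ≐ inv u ⊙ (u ⊙ v)) refl u v))

    left-complement : ∀ {v w} → v ≤A w → (w · (v ⁻¹)) ≤A w
    left-complement {v} {w} p = ≤A-intro (ℕ.≤-reflexive (begin
          ℓT (w · (v ⁻¹)) + ℓT (((w · (v ⁻¹)) ⁻¹) · w)
            ≡⟨ cong₂ _+_ (trans (cong ℓT (group 2 (λ v w → w ⊙ inv v ≐ v ⊙ ((inv v ⊙ w) ⊙ inv v)) refl v w)) (ℓT-^^ _ v))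
                         (cong ℓT (group 2 (λ v w → inv (w ⊙ inv v) ⊙ w ≐ v) refl v w)) ⟩
          ℓT ((v ⁻¹) · w) + ℓT v     ≡⟨ ℕ.+-comm _ (ℓT v) ⟩
          ℓT v + ℓT ((v ⁻¹) · w)     ≡⟨ sym p ⟩
          ℓT w                       ∎))
      where open ≡-Reasoning

  -- Integer sequences as coefficients, and the Chebyshev polynomials of a path

  Seq : Set
  Seq = ℕ → ℤ

  Cong : (Seq → Seq) → Set
  Cong f = ∀ {a b} → (∀ p → a p ≡ b p) → ∀ p → f a p ≡ f b p

  Linear : (Seq → Seq) → Set
  Linear f = ∀ c d a b p → f (λ q → c ⊛ a q ⊕ d ⊛ b q) p ≡ c ⊛ f a p ⊕ d ⊛ f b p

  module ℤ-Identities where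
    lin-0 : ∀ c d → 0ℤ ≡ c ⊛ 0ℤ ⊕ d ⊛ 0ℤ
    lin-0 = solve-∀
    lin-⊝ : ∀ c d x y x′ y′ → (c ⊛ x ⊕ d ⊛ y) ⊝ (c ⊛ x′ ⊕ d ⊛ y′) ≡ c ⊛ (x ⊝ x′) ⊕ d ⊛ (y ⊝ y′)
    lin-⊝ = solve-∀
    as-⊝ : ∀ x y → 1ℤ ⊛ x ⊕ (⊖ 1ℤ) ⊛ y ≡ x ⊝ y
    as-⊝ = solve-∀
    as-⊕ : ∀ x y → 1ℤ ⊛ x ⊕ 1ℤ ⊛ y ≡ x ⊕ y
    as-⊕ = solve-∀
    0-⊕ : ∀ x → x ≡ 0ℤ ⊕ x
    0-⊕ = solve-∀
    ⊕-⊝ : ∀ x y → x ≡ (x ⊕ y) ⊝ y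
    ⊕-⊝ = solve-∀
    ⊝-⊝ : ∀ x y z → x ⊝ (y ⊝ z) ≡ (x ⊝ y) ⊕ z
    ⊝-⊝ = solve-∀
    S-base : ∀ x y → x ⊕ ((y ⊝ x) ⊕ 0ℤ) ≡ y ⊝ 0ℤ
    S-base = solve-∀
    ⊝-⊕ : ∀ x y → x ≡ (x ⊝ y) ⊕ y
    ⊝-⊕ = solve-∀
    S-step : ∀ x y z → (x ⊕ (y ⊕ z)) ⊝ z ≡ y ⊕ x
    S-step = solve-∀
    lin-⊛ : ∀ c d x y z → z ⊛ (c ⊛ x ⊕ d ⊛ y) ≡ c ⊛ (z ⊛ x) ⊕ d ⊛ (z ⊛ y)
    lin-⊛ = solve-∀
    lin-Q : ∀ c d l l′ x y z → (c ⊛ l ⊕ d ⊛ l′) ⊕ z ⊛ (c ⊛ x ⊕ d ⊛ y) ≡ c ⊛ (l ⊕ z ⊛ x) ⊕ d ⊛ (l′ ⊕ z ⊛ y)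
    lin-Q = solve-∀
    Q-1 : ∀ x → (0ℤ ⊕ 1ℤ ⊛ x) ⊝ 0ℤ ≡ x
    Q-1 = solve-∀
    Q-0 : ∀ x → (0ℤ ⊕ 0ℤ ⊛ x) ⊝ 0ℤ ≡ 0ℤ
    Q-0 = solve-∀
    Q-step : ∀ x y → (x ⊕ 1ℤ ⊛ y) ⊝ x ≡ y
    Q-step = solve-∀
    Q-end : ∀ x y → (x ⊕ 0ℤ ⊛ y) ⊝ x ≡ 0ℤ
    Q-end = solve-∀

  open ℤ-Identities

  ⊝-linear : ∀ {f} → Cong f → Linear f → ∀ a b p → f (λ q → a q ⊝ b q) p ≡ f a p ⊝ f b p
  ⊝-linear {f} f-cong f-linear a b p = trans (f-cong (λ q → sym (as-⊝ (a q) (b q))) p)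
    (trans (f-linear 1ℤ (⊖ 1ℤ) a b p) (as-⊝ (f a p) (f b p)))

  ⊕-linear : ∀ {f} → Cong f → Linear f → ∀ a b p → f (λ q → a q ⊕ b q) p ≡ f a p ⊕ f b p
  ⊕-linear {f} f-cong f-linear a b p = trans (f-cong (λ q → sym (as-⊕ (a q) (b q))) p)
    (trans (f-linear 1ℤ 1ℤ a b p) (as-⊕ (f a p) (f b p)))

  0-linear : ∀ {f} → Cong f → Linear f → ∀ p → f (λ _ → 0ℤ) p ≡ 0ℤ
  0-linear f-cong f-linear p = f-linear 0ℤ 0ℤ (λ _ → 0ℤ) (λ _ → 0ℤ) p

  ×-nonneg : ∀ {x y} → 0ℤ ≤ℤ x → 0ℤ ≤ℤ y → 0ℤ ≤ℤ x ⊛ y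
  ×-nonneg {x} {y} hx hy = subst (_≤ℤ x ⊛ y) (ℤ.*-zeroʳ x) (ℤ.*-monoˡ-≤-nonNeg x {{nonNegative hx}} hy)

  ⊕-nonneg : ∀ {x y} → 0ℤ ≤ℤ x → 0ℤ ≤ℤ y → 0ℤ ≤ℤ x ⊕ y
  ⊕-nonneg = ℤ.+-mono-≤ {0ℤ} {_} {0ℤ}

  -- The index advances by two because along a dihedral orbit each of the two moving coordinates
  -- changes only at every second reflection.
  partialSum : (ℕ → Seq) → ℕ → ℕ → Seq
  partialSum d zero j p = 0ℤ
  partialSum d (suc n) j p = d j p ⊕ partialSum d n (suc (suc j)) p

  -- The adjacency operator Q of a disjoint union of paths with k + 1 vertices stands in for 2 cos (π / m), m = k + 2.
  -- With U j = U_{j-1}(Q/2) for the Chebyshev polynomials of the second kind, U m = 0 and U j ≥ 0 for j ≤ m.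
  module Path (k : ℕ) where
    K : ℕ
    K = suc k

    opaque
      -- The edge between p and p + 1; it is missing exactly when p + 1 is a multiple of K and so
      -- begins the next path.
      bond : ℕ → ℤ
      bond p with suc p % K
      ... | zero  = 0ℤ
      ... | suc _ = 1ℤ

      bond-0 : ∀ p → suc p % K ≡ 0 → bond p ≡ 0ℤ
      bond-0 p h with suc p % K
      bond-0 p refl | zero = refl

      bond-1 : ∀ p → suc p % K ≢ 0 → bond p ≡ 1ℤ
      bond-1 p h with suc p % K
      ... | zero  = contradiction refl h
      ... | suc _ = refl

      bond-≥0 : ∀ p → 0ℤ ≤ℤ bond p
      bond-≥0 p with suc p % K
      ... | zero  = ℤ.≤-refl
      ... | suc _ = ℤ.+≤+ z≤n

    opaque
      left : Seq → Seq
      left a zero    = 0ℤ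
      left a (suc p) = bond p ⊛ a p

      Q : Seq → Seq
      Q a p = left a p ⊕ bond p ⊛ a (suc p)

      left-cong : Cong left
      left-cong h zero    = refl
      left-cong h (suc p) = cong (bond p ⊛_) (h p)

      Q-cong : Cong Q
      Q-cong h p = cong₂ _⊕_ (left-cong h p) (cong (bond p ⊛_) (h (suc p)))

      left-linear : Linear left
      left-linear c d a b zero = lin-0 c d
      left-linear c d a b (suc p) = lin-⊛ c d (a p) (b p) (bond p)

      Q-linear : Linear Q
      Q-linear c d a b p = trans (cong (_⊕ bond p ⊛ (c ⊛ a (suc p) ⊕ d ⊛ b (suc p))) (left-linear c d a b p))
        (lin-Q c d (left a p) (left b p) (a (suc p)) (b (suc p)) (bond p))

      Q-nonneg : ∀ {a} → (∀ p → 0ℤ ≤ℤ a p) → ∀ p → 0ℤ ≤ℤ Q a p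
      Q-nonneg {a} a≥0 p = ⊕-nonneg (l p) (×-nonneg (bond-≥0 p) (a≥0 (suc p)))
        where
          l : ∀ p → 0ℤ ≤ℤ left a p
          l zero = ℤ.≤-refl
          l (suc p) = ×-nonneg (bond-≥0 p) (a≥0 p)

      -- A multiple of K begins a path, so no edge crosses the cut at N.
      Q-support : ∀ {N} → K ∣ N → ∀ {a} → (∀ p → N ≤ p → a p ≡ 0ℤ) → ∀ p → N ≤ p → Q a p ≡ 0ℤ
      Q-support {N} K∣N {a} h p N≤p = cong₂ _⊕_ (l p N≤p)
          (trans (cong (bond p ⊛_) (h (suc p) (ℕ.≤-trans N≤p (ℕ.n≤1+n p)))) (ℤ.*-zeroʳ (bond p)))
        where
          l : ∀ p → N ≤ p → left a p ≡ 0ℤ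
          l zero _ = refl
          l (suc p) N≤ with ℕ.m≤n⇒m<n∨m≡n N≤
          ... | inj₁ (s≤s N≤p) = trans (cong (bond p ⊛_) (h p N≤p)) (ℤ.*-zeroʳ (bond p))
          ... | inj₂ refl = trans (cong (_⊛ a p) (bond-0 p (n∣m⇒m%n≡0 (suc p) K K∣N))) (ℤ.*-zeroˡ (a p))

      Q-suc : ∀ a p → Q a (suc p) ≡ bond p ⊛ a p ⊕ bond (suc p) ⊛ a (suc (suc p))
      Q-suc a p = refl

      Q-base : ∀ a b → b % K ≡ 0 → Q a b ≡ 0ℤ ⊕ bond b ⊛ a (suc b)
      Q-base a zero    _ = refl
      Q-base a (suc c) h = cong (_⊕ bond (suc c) ⊛ a (suc (suc c))) (trans (cong (_⊛ a c) (bond-0 c h)) (ℤ.*-zeroˡ (a c)))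

    opaque
      U : ℕ → Seq → Seq
      U zero a p = 0ℤ
      U (suc zero) a p = a p
      U (suc (suc j)) a p = Q (U (suc j) a) p ⊝ U j a p

      U-zero : ∀ a p → U zero a p ≡ 0ℤ
      U-zero a p = refl

      U-one : ∀ a p → U 1 a p ≡ a p
      U-one a p = refl

      U-step : ∀ j a p → U (suc (suc j)) a p ≡ Q (U (suc j) a) p ⊝ U j a p
      U-step j a p = refl

    U-cong : ∀ j → Cong (U j)
    U-cong zero {a} {b} h p = trans (U-zero a p) (sym (U-zero b p))
    U-cong (suc zero) {a} {b} h p = trans (U-one a p) (trans (h p) (sym (U-one b p)))
    U-cong (suc (suc j)) {a} {b} h p = trans (U-step j a p)
      (trans (cong₂ _⊝_ (Q-cong (U-cong (suc j) h) p) (U-cong j h p)) (sym (U-step j b p)))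

    opaque
      unfolding U
      U-linear : ∀ j → Linear (U j)
      U-linear zero c d a b p = lin-0 c d
      U-linear (suc zero) c d a b p = refl
      U-linear (suc (suc j)) c d a b p = trans
        (cong₂ _⊝_ (trans (Q-cong (U-linear (suc j) c d a b) p) (Q-linear c d (U (suc j) a) (U (suc j) b) p)) (U-linear j c d a b p))
        (lin-⊝ c d (Q (U (suc j) a) p) (Q (U (suc j) b) p) (U j a p) (U j b p))

      U-Q : ∀ j a p → U j (Q a) p ≡ Q (U j a) p
      U-Q zero a p = sym (0-linear Q-cong Q-linear p)
      U-Q (suc zero) a p = refl
      U-Q (suc (suc j)) a p = trans
        (cong₂ _⊝_ (Q-cong (U-Q (suc j) a) p) (U-Q j a p))
        (sym (⊝-linear Q-cong Q-linear (Q (U (suc j) a)) (U j a) p))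

      U-comm : ∀ i j a p → U i (U j a) p ≡ U j (U i a) p
      U-comm zero j a p = sym (0-linear (U-cong j) (U-linear j) p)
      U-comm (suc zero) j a p = refl
      U-comm (suc (suc i)) j a p = trans
        (cong₂ _⊝_ (trans (Q-cong (U-comm (suc i) j a) p) (sym (U-Q j (U (suc i) a) p))) (U-comm i j a p))
        (sym (⊝-linear (U-cong j) (U-linear j) (Q (U (suc i) a)) (U i a) p))

      -- The product rule for Chebyshev polynomials. Applied repeatedly it expands a product of two
      -- of them into a sum of single ones, the Clebsch-Gordan rule on which `UU-nonneg` rests.
      U-U : ∀ j d a p → U (j + d) (U (suc j) a) p ≡ U (suc (j + d)) (U j a) p ⊕ U d a p
      U-U zero d a p = trans (0-⊕ (U d a p)) (cong (_⊕ U d a p) (sym (0-linear (U-cong (suc d)) (U-linear (suc d)) p)))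
      U-U (suc j) d a p = begin
        U (suc (j + d)) (U (suc (suc j)) a) p
          ≡⟨ ⊝-linear (U-cong (suc (j + d))) (U-linear (suc (j + d))) (Q (U (suc j) a)) (U j a) p ⟩
        U (suc (j + d)) (Q (U (suc j) a)) p ⊝ U (suc (j + d)) (U j a) p
          ≡⟨ cong₂ _⊝_ (U-Q (suc (j + d)) (U (suc j) a) p) (⊕-⊝ (U (suc (j + d)) (U j a) p) (U d a p)) ⟩
        Q (U (suc (j + d)) (U (suc j) a)) p ⊝ ((U (suc (j + d)) (U j a) p ⊕ U d a p) ⊝ U d a p)
          ≡⟨ cong (λ z → Q (U (suc (j + d)) (U (suc j) a)) p ⊝ (z ⊝ U d a p)) (sym (U-U j d a p)) ⟩
        Q (U (suc (j + d)) (U (suc j) a)) p ⊝ (U (j + d) (U (suc j) a) p ⊝ U d a p)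
          ≡⟨ ⊝-⊝ (Q (U (suc (j + d)) (U (suc j) a)) p) (U (j + d) (U (suc j) a) p) (U d a p) ⟩
        U (suc (suc (j + d))) (U (suc j) a) p ⊕ U d a p
          ∎
        where open ≡-Reasoning

    -- The recurrence says that `Q` applied to a term is the sum of its two neighbours. A sum over
    -- every second index is therefore a polynomial in `Q` applied to its middle term, as with sums
    -- of cosines in arithmetic progression.
    S≡U : (d : ℕ → Seq) → (∀ j p → d (suc (suc j)) p ≡ Q (d (suc j)) p ⊝ d j p) →
      ∀ n j p → partialSum d (suc n) j p ≡ U (suc n) (d (n + j)) p
    S≡U d rec zero j p = trans (ℤ.+-identityʳ _) (sym (U-one (d j) p))
    S≡U d rec (suc zero) j p = trans (cong (λ z → d j p ⊕ (z ⊕ 0ℤ)) (rec j p))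
      (trans (S-base (d j p) (Q (d (suc j)) p)) (sym (trans (U-step 0 (d (suc j)) p)
        (cong₂ _⊝_ (Q-cong (U-one (d (suc j))) p) (U-zero (d (suc j)) p)))))
    S≡U d rec (suc (suc n)) j p = sym (begin
      U (suc (suc (suc n))) (d N) p
        ≡⟨ U-step (suc n) (d N) p ⟩
      Q (U (suc (suc n)) (d N)) p ⊝ U (suc n) (d N) p
        ≡⟨ cong₂ _⊝_ (sym (U-Q (suc (suc n)) (d N) p)) (cong (λ z → U (suc n) (d z) p) (sym offset)) ⟩
      U (suc (suc n)) (Q (d N)) p ⊝ U (suc n) (d (n + suc (suc j))) p
        ≡⟨ cong₂ _⊝_ (trans (U-cong (suc (suc n)) expand p)
                       (⊕-linear (U-cong (suc (suc n))) (U-linear (suc (suc n))) (d (suc N)) (d (suc n + j)) p))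
                     (sym (S≡U d rec n (suc (suc j)) p)) ⟩
      (U (suc (suc n)) (d (suc N)) p ⊕ U (suc (suc n)) (d (suc n + j)) p) ⊝ S (suc n) (suc (suc j)) p
        ≡⟨ cong₂ (λ x y → (x ⊕ y) ⊝ S (suc n) (suc (suc j)) p)
             (trans (cong (λ z → U (suc (suc n)) (d (suc z)) p) (sym offset)) (sym (S≡U d rec (suc n) (suc (suc j)) p)))
             (sym (S≡U d rec (suc n) j p)) ⟩
      (S (suc (suc n)) (suc (suc j)) p ⊕ (d j p ⊕ S (suc n) (suc (suc j)) p)) ⊝ S (suc n) (suc (suc j)) p
        ≡⟨ S-step (S (suc (suc n)) (suc (suc j)) p) (d j p) (S (suc n) (suc (suc j)) p) ⟩
      d j p ⊕ S (suc (suc n)) (suc (suc j)) p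
        ∎)
      where
        open ≡-Reasoning
        S = partialSum d
        N : ℕ
        N = suc (suc (n + j))
        offset : n + suc (suc j) ≡ N
        offset = trans (ℕ.+-suc n (suc j)) (cong suc (ℕ.+-suc n j))
        expand : ∀ q → Q (d N) q ≡ d (suc N) q ⊕ d (suc n + j) q
        expand q = trans (⊝-⊕ (Q (d N) q) (d (suc n + j) q)) (cong (_⊕ d (suc n + j) q) (sym (rec (suc n + j) q)))

    opaque
      base : ℕ → ℕ
      base β = β * K

      base-mod : ∀ q β → (q + base β) % K ≡ q % K
      base-mod q β = [m+kn]%n≡m%n q β K

      decompose : ∀ p → ∃₂ λ q β → q < K × p ≡ q + base β
      decompose p = p % K , p / K , m%n<n p K , m≡m%n+[m/n]*n p K

    bond-in : ∀ q β → suc q < K → bond (q + base β) ≡ 1ℤ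
    bond-in q β h = bond-1 (q + base β) λ z → case trans (sym (m<n⇒m%n≡m h)) (trans (sym (base-mod (suc q) β)) z) of λ ()

    bond-end : ∀ β → bond (k + base β) ≡ 0ℤ
    bond-end β = bond-0 (k + base β) (trans (base-mod K β) (n%n≡0 K))

    Q-in : ∀ q β → suc q < K → ∀ a → Q a (suc q + base β) ≡ a (q + base β) ⊕ bond (suc q + base β) ⊛ a (suc (suc q) + base β)
    Q-in q β h a = trans (Q-suc a (q + base β)) (cong (_⊕ bond (suc q + base β) ⊛ a (suc (suc q) + base β))
      (trans (cong (_⊛ a (q + base β)) (bond-in q β h)) (ℤ.*-identityˡ _)))

    U-two : ∀ a p → U 2 a p ≡ Q a p ⊝ 0ℤ
    U-two a p = trans (U-step 0 a p) (cong₂ _⊝_ (Q-cong (U-one a) p) (U-zero a p))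

    -- The recurrence of `U` is the walk along a path away from its first vertex, so at that vertex
    -- `U (suc q)` reads off the entry at vertex q. `boundary` is the same walk taken one step
    -- beyond the last vertex.
    value : ∀ q β → q < K → ∀ a → U (suc q) a (base β) ≡ a (q + base β)
    value zero β _ a = U-one a (base β)
    value (suc zero) β h a = trans (U-two a (base β)) (trans (cong (_⊝ 0ℤ) (trans (Q-base a (base β) (base-mod 0 β))
      (cong (λ y → 0ℤ ⊕ y ⊛ a (suc (base β))) (bond-in 0 β h)))) (Q-1 (a (suc (base β)))))
    value (suc (suc q)) β h a = begin
      U (suc (suc (suc q))) a b
        ≡⟨ U-step (suc q) a b ⟩
      Q (U (suc (suc q)) a) b ⊝ U (suc q) a b
        ≡⟨ cong₂ _⊝_ (sym (U-Q (suc (suc q)) a b)) (value q β (ℕ.<-trans (ℕ.n<1+n q) h′) a) ⟩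
      U (suc (suc q)) (Q a) b ⊝ a (q + b)
        ≡⟨ cong (_⊝ a (q + b)) (trans (value (suc q) β h′ (Q a)) (Q-in q β h′ a)) ⟩
      (a (q + b) ⊕ bond (suc q + b) ⊛ a (suc (suc q) + b)) ⊝ a (q + b)
        ≡⟨ cong (λ z → (a (q + b) ⊕ z ⊛ a (suc (suc q) + b)) ⊝ a (q + b)) (bond-in (suc q) β h) ⟩
      (a (q + b) ⊕ 1ℤ ⊛ a (suc (suc q) + b)) ⊝ a (q + b)
        ≡⟨ Q-step (a (q + b)) (a (suc (suc q) + b)) ⟩
      a (suc (suc q) + b)
        ∎
      where
        open ≡-Reasoning
        b = base β
        h′ : suc q < K
        h′ = ℕ.<-trans (ℕ.n<1+n (suc q)) h

    boundary : ∀ β a → U (suc K) a (base β) ≡ 0ℤ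
    boundary β a = go k refl
      where
        open ≡-Reasoning
        b = base β
        go : ∀ j → k ≡ j → U (suc (suc j)) a b ≡ 0ℤ
        go zero refl = trans (U-two a b) (trans (cong (_⊝ 0ℤ) (trans (Q-base a b (base-mod 0 β))
          (cong (λ y → 0ℤ ⊕ y ⊛ a (suc b)) (bond-end β)))) (Q-0 (a (suc b))))
        go (suc j) refl = begin
          U (suc (suc (suc j))) a b
            ≡⟨ U-step (suc j) a b ⟩
          Q (U (suc (suc j)) a) b ⊝ U (suc j) a b
            ≡⟨ cong₂ _⊝_ (sym (U-Q (suc (suc j)) a b)) (value j β (ℕ.<-trans (ℕ.n<1+n j) (ℕ.n<1+n (suc j))) a) ⟩
          U (suc (suc j)) (Q a) b ⊝ a (j + b)
            ≡⟨ cong (_⊝ a (j + b)) (trans (value (suc j) β (ℕ.n<1+n _) (Q a)) (Q-in j β (ℕ.n<1+n _) a)) ⟩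
          (a (j + b) ⊕ bond (suc j + b) ⊛ a (suc (suc j) + b)) ⊝ a (j + b)
            ≡⟨ cong (λ z → (a (j + b) ⊕ z ⊛ a (suc (suc j) + b)) ⊝ a (j + b)) (bond-end β) ⟩
          (a (j + b) ⊕ 0ℤ ⊛ a (suc (suc j) + b)) ⊝ a (j + b)
            ≡⟨ Q-end (a (j + b)) (a (suc (suc j) + b)) ⟩
          0ℤ
            ∎

    -- `boundary` treats the first vertex of each path. The entry at vertex q is `U (suc q)`
    -- evaluated at the first vertex, and the polynomials commute.
    U-vanish : ∀ a p → U (suc K) a p ≡ 0ℤ
    U-vanish a p with decompose p
    ... | q , β , h , refl = trans (sym (value q β h (U (suc K) a)))
          (trans (U-comm (suc q) (suc K) a (base β)) (boundary β (U (suc q) a)))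

    module _ {a : Seq} (a≥0 : ∀ p → 0ℤ ≤ℤ a p) where

      U-base-nonneg : ∀ β j → j ≤ suc K → 0ℤ ≤ℤ U j a (base β)
      U-base-nonneg β zero _ = ℤ.≤-reflexive (sym (U-zero a (base β)))
      U-base-nonneg β (suc q) (s≤s h) with ℕ.m≤n⇒m<n∨m≡n h
      ... | inj₁ q<K  = subst (0ℤ ≤ℤ_) (sym (value q β q<K a)) (a≥0 _)
      ... | inj₂ refl = ℤ.≤-reflexive (sym (boundary β a))

      -- The product rule trades l for a larger x. Once x reaches `suc K` the value at the first
      -- vertex is zero, so only single polynomials of index at most `suc K` are ever added up.
      UU-nonneg : ∀ β l d x → x ≡ l + d → x ≤ suc K → 0ℤ ≤ℤ U x (U (suc l) a) (base β)
      UU-nonneg β zero d x refl h = subst (0ℤ ≤ℤ_) (sym (U-cong d (U-one a) (base β))) (U-base-nonneg β d h)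
      UU-nonneg β (suc l) d x refl h with ℕ.m≤n⇒m<n∨m≡n h
      ... | inj₂ eq = ℤ.≤-reflexive (trans (sym (boundary β (U (suc (suc l)) a)))
            (cong (λ z → U z (U (suc (suc l)) a) (base β)) (sym eq)))
      ... | inj₁ lt = subst (0ℤ ≤ℤ_) (sym (U-U (suc l) d a (base β))) (⊕-nonneg
          (UU-nonneg β l (suc (suc d)) (suc (suc l + d)) (sym (trans (ℕ.+-suc l (suc d)) (cong suc (ℕ.+-suc l d)))) lt)
          (U-base-nonneg β d (ℕ.≤-trans (ℕ.m≤n+m d (suc l)) h)))

      U-nonneg : ∀ j → j ≤ suc K → ∀ p → 0ℤ ≤ℤ U j a p
      U-nonneg zero _ p = ℤ.≤-reflexive (sym (U-zero a p))
      U-nonneg (suc j) h p with decompose p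
      ... | q , β , q<K , refl with ℕ.≤-total q (suc j)
      ...   | inj₁ q≤j = subst (0ℤ ≤ℤ_) (trans (U-comm (suc j) (suc q) a (base β)) (value q β q<K (U (suc j) a)))
                (UU-nonneg β q (suc j ∸ q) (suc j) (sym (ℕ.m+[n∸m]≡n q≤j)) h)
      ...   | inj₂ j≤q = subst (0ℤ ≤ℤ_) (value q β q<K (U (suc j) a))
                (UU-nonneg β j (suc q ∸ j) (suc q) (sym (ℕ.m+[n∸m]≡n j≤q′)) (s≤s (ℕ.<⇒≤ q<K)))
        where
          j≤q′ : j ≤ suc q
          j≤q′ = ℕ.≤-trans (ℕ.n≤1+n j) (ℕ.≤-trans j≤q (ℕ.n≤1+n q))

  sumF : ∀ {n} → (Fin n → ℤ) → ℤ
  sumF {zero}  f = 0ℤ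
  sumF {suc n} f = f zero ⊕ sumF (f ∘ suc)

  sumF-cong : ∀ {n} {f g : Fin n → ℤ} → (∀ i → f i ≡ g i) → sumF f ≡ sumF g
  sumF-cong {zero}  h = refl
  sumF-cong {suc n} h = cong₂ _⊕_ (h zero) (sumF-cong (h ∘ suc))

  module ℤ-Identities₂ where
    lin-⊕ : ∀ c d x y X Y → (c ⊛ x ⊕ d ⊛ y) ⊕ (c ⊛ X ⊕ d ⊛ Y) ≡ c ⊛ (x ⊕ X) ⊕ d ⊛ (y ⊕ Y)
    lin-⊕ = solve-∀
    as-neg : ∀ x → (⊖ 1ℤ) ⊛ x ⊕ 0ℤ ⊛ x ≡ ⊖ x
    as-neg = solve-∀
    lin-⊖ : ∀ c d x y → ⊖ (c ⊛ x ⊕ d ⊛ y) ≡ c ⊛ (⊖ x) ⊕ d ⊛ (⊖ y)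
    lin-⊖ = solve-∀
    reflect : ∀ v C q → v ⊝ C ≡ (q ⊝ v) ⊕ ((v ⊕ v ⊝ q) ⊝ C)
    reflect = solve-∀
    const-self : ∀ v x q C → ((v ⊝ x) ⊕ (v ⊝ x) ⊝ q) ⊝ (C ⊝ (x ⊕ x)) ≡ (v ⊕ v ⊝ q) ⊝ C
    const-self = solve-∀
    const-other : ∀ v q y C → (v ⊕ v ⊝ (q ⊝ y)) ⊝ (C ⊝ (⊖ y)) ≡ (v ⊕ v ⊝ q) ⊝ C
    const-other = solve-∀
    rec-diff : ∀ q₃ z₂ q₁ z₀ c → ((q₃ ⊝ z₂) ⊕ c) ⊝ ((q₁ ⊝ z₀) ⊕ c) ≡ (q₃ ⊝ q₁) ⊝ (z₂ ⊝ z₀)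
    rec-diff = solve-∀
    telescope : ∀ x y z → (y ⊝ x) ⊕ (z ⊝ y) ≡ z ⊝ x
    telescope = solve-∀
    involution : ∀ v C → (v ⊝ C) ⊝ (C ⊝ (C ⊕ C)) ≡ v
    involution = solve-∀
    ⊝-0 : ∀ x → x ⊝ 0ℤ ≡ x
    ⊝-0 = solve-∀
    ⊝-cancel : ∀ x y → x ⊝ y ≡ 0ℤ → x ≡ y
    ⊝-cancel x y h = trans (lem x y) (trans (cong (_⊕ y) h) (ℤ.+-identityˡ y))
      where
        lem : ∀ x y → x ≡ (x ⊝ y) ⊕ y
        lem = solve-∀
    comb-⊝ : ∀ c d x y X Y → (c ⊛ x ⊕ d ⊛ y) ⊝ (c ⊛ X ⊕ d ⊛ Y) ≡ c ⊛ (x ⊝ X) ⊕ d ⊛ (y ⊝ Y)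
    comb-⊝ = solve-∀
    negate : ∀ x → x ⊝ (x ⊕ x) ≡ ⊖ x
    negate = solve-∀
    ⊝-⊖ : ∀ y → 0ℤ ⊝ (⊖ y) ≡ y
    ⊝-⊖ = solve-∀

  open ℤ-Identities₂

  sumF-linear : ∀ {n} c d (f g : Fin n → ℤ) → sumF (λ i → c ⊛ f i ⊕ d ⊛ g i) ≡ c ⊛ sumF f ⊕ d ⊛ sumF g
  sumF-linear {zero}  c d f g = ℤ-Identities.lin-0 c d
  sumF-linear {suc n} c d f g = trans (cong ((c ⊛ f zero ⊕ d ⊛ g zero) ⊕_) (sumF-linear c d (f ∘ suc) (g ∘ suc)))
    (lin-⊕ c d (f zero) (g zero) _ _)

  sumF-zero : ∀ {n} (f : Fin n → ℤ) → (∀ i → f i ≡ 0ℤ) → sumF f ≡ 0ℤ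
  sumF-zero {zero}  f h = refl
  sumF-zero {suc n} f h = cong₂ _⊕_ (h zero) (sumF-zero (f ∘ suc) (h ∘ suc))

  sumF-single : ∀ {n} (f : Fin n → ℤ) j → (∀ i → i ≢ j → f i ≡ 0ℤ) → sumF f ≡ f j
  sumF-single f zero h = trans (cong (f zero ⊕_) (sumF-zero (f ∘ suc) (λ i → h (suc i) λ ()))) (ℤ.+-identityʳ _)
  sumF-single f (suc j) h = trans (cong₂ _⊕_ (h zero λ ()) (sumF-single (f ∘ suc) j λ i ne → h (suc i) λ { refl → ne refl }))
    (ℤ.+-identityˡ _)

  sumF-nonneg : ∀ {n} (f : Fin n → ℤ) → (∀ i → 0ℤ ≤ℤ f i) → 0ℤ ≤ℤ sumF f
  sumF-nonneg {zero}  f h = ℤ.≤-refl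
  sumF-nonneg {suc n} f h = ⊕-nonneg (h zero) (sumF-nonneg (f ∘ suc) (h ∘ suc))

  -- The geometric representation

  module Geometric (G : FiniteCoxeterSystem) where
    open Cox G

    V : Set
    V = Fin rank → Seq

    infix 4 _≈_
    _≈_ : V → V → Set
    v ≈ w = ∀ k p → v k p ≡ w k p

    comb : ℤ → ℤ → V → V → V
    comb c d v w k p = c ⊛ v k p ⊕ d ⊛ w k p

    CongV LinearV : (V → V) → Set
    CongV f = ∀ {v w} → v ≈ w → f v ≈ f w
    LinearV f = ∀ c d v w → f (comb c d v w) ≈ comb c d (f v) (f w)

    -- `Path k` has k + 1 vertices on each path, hence the subtraction of 2 to get m - 1. Operators
    -- of different pairs need not commute; each Coxeter relation involves only the one of its own
    -- pair.
    Q : Fin rank → Fin rank → Seq → Seq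
    Q i j = Path.Q (m i j ∸ 2)

    Q-sym : ∀ i j a p → Q j i a p ≡ Q i j a p
    Q-sym i j a p = cong (λ z → Path.Q (z ∸ 2) a p) (m-sym j i)

    opaque
      cartan : Fin rank → Fin rank → Seq → Seq
      cartan i j a p with i Fin.≟ j
      ... | yes _ = a p ⊕ a p
      ... | no _  = ⊖ Q i j a p

      cartan-self : ∀ i a p → cartan i i a p ≡ a p ⊕ a p
      cartan-self i a p with i Fin.≟ i
      ... | yes _ = refl
      ... | no ne = contradiction refl ne

      cartan-off : ∀ {i j} → i ≢ j → ∀ a p → cartan i j a p ≡ ⊖ Q i j a p
      cartan-off {i} {j} ne a p with i Fin.≟ j
      ... | yes q = contradiction q ne
      ... | no _  = refl

      cartan-cong : ∀ i j → Cong (cartan i j)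
      cartan-cong i j h p with i Fin.≟ j
      ... | yes _ = cong₂ _⊕_ (h p) (h p)
      ... | no _  = cong ⊖_ (Path.Q-cong (m i j ∸ 2) h p)

      cartan-linear : ∀ i j → Linear (cartan i j)
      cartan-linear i j c d a b p with i Fin.≟ j
      ... | yes _ = lin-⊕ c d (a p) (b p) (a p) (b p)
      ... | no _  = trans (cong ⊖_ (Path.Q-linear (m i j ∸ 2) c d a b p)) (lin-⊖ c d (Q i j a p) (Q i j b p))

      E : Fin rank → Seq → V
      E i a k p with k Fin.≟ i
      ... | yes _ = a p
      ... | no _  = 0ℤ

      E-self : ∀ i a p → E i a i p ≡ a p
      E-self i a p with i Fin.≟ i
      ... | yes _ = refl
      ... | no ne = contradiction refl ne

      E-other : ∀ {i k} → k ≢ i → ∀ a p → E i a k p ≡ 0ℤ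
      E-other {i} {k} ne a p with k Fin.≟ i
      ... | yes q = contradiction q ne
      ... | no _  = refl

    E-elim : ∀ (R : ℤ → Set) i a k p → (k ≡ i → R (a p)) → (k ≢ i → R 0ℤ) → R (E i a k p)
    E-elim R i a k p f g with k Fin.≟ i
    ... | yes refl = subst R (sym (E-self i a p)) (f refl)
    ... | no ne    = subst R (sym (E-other ne a p)) (g ne)

    E-cong : ∀ i {a b} → (∀ p → a p ≡ b p) → E i a ≈ E i b
    E-cong i {a} {b} h k p with k Fin.≟ i
    ... | yes refl = trans (E-self i a p) (trans (h p) (sym (E-self i b p)))
    ... | no ne    = trans (E-other ne a p) (sym (E-other ne b p))

    E-linear : ∀ i c d a b → E i (λ p → c ⊛ a p ⊕ d ⊛ b p) ≈ comb c d (E i a) (E i b)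
    E-linear i c d a b k p with k Fin.≟ i
    ... | yes refl = trans (E-self i _ p) (sym (cong₂ (λ x y → c ⊛ x ⊕ d ⊛ y) (E-self i a p) (E-self i b p)))
    ... | no ne    = trans (E-other ne _ p) (trans (ℤ-Identities.lin-0 c d)
                       (sym (cong₂ (λ x y → c ⊛ x ⊕ d ⊛ y) (E-other ne a p) (E-other ne b p))))

    opaque
      C : Fin rank → V → Seq
      C i v p = sumF (λ j → cartan i j (v j) p)

      C≡ : ∀ i v p → C i v p ≡ sumF (λ j → cartan i j (v j) p)
      C≡ i v p = refl

      C-cong : ∀ i {v w} → v ≈ w → ∀ p → C i v p ≡ C i w p
      C-cong i h p = sumF-cong (λ j → cartan-cong i j (h j) p)

      C-linear : ∀ i c d v w p → C i (comb c d v w) p ≡ c ⊛ C i v p ⊕ d ⊛ C i w p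
      C-linear i c d v w p = trans (sumF-cong (λ j → cartan-linear i j c d (v j) (w j) p)) (sumF-linear c d (λ j → cartan i j (v j) p) (λ j → cartan i j (w j) p))

      C-E : ∀ i j a p → C i (E j a) p ≡ cartan i j a p
      C-E i j a p = trans (sumF-single _ j (λ k ne → trans (cartan-cong i k (E-other ne a) p) (cartan-linear i k 0ℤ 0ℤ a a p)))
        (cartan-cong i j (E-self j a) p)

    sub : V → V → V
    sub v w k p = v k p ⊝ w k p

    C-sub : ∀ i v w p → C i (sub v w) p ≡ C i v p ⊝ C i w p
    C-sub i v w p = trans (C-cong i (λ k q → sym (ℤ-Identities.as-⊝ (v k q) (w k q))) p)
      (trans (C-linear i 1ℤ (⊖ 1ℤ) v w p) (ℤ-Identities.as-⊝ (C i v p) (C i w p)))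

    s : Fin rank → V → V
    s i v = sub v (E i (C i v))

    s-self : ∀ i v p → s i v i p ≡ v i p ⊝ C i v p
    s-self i v p = cong (v i p ⊝_) (E-self i (C i v) p)

    s-other : ∀ {i k} → k ≢ i → ∀ v p → s i v k p ≡ v k p
    s-other {i} {k} ne v p = trans (cong (v k p ⊝_) (E-other ne (C i v) p)) (⊝-0 _)

    s-cong : ∀ i → CongV (s i)
    s-cong i h k p = cong₂ _⊝_ (h k p) (E-cong i (C-cong i h) k p)

    s-linear : ∀ i → LinearV (s i)
    s-linear i c d v w k p = trans
      (cong ((c ⊛ v k p ⊕ d ⊛ w k p) ⊝_) (trans (E-cong i (C-linear i c d v w) k p) (E-linear i c d (C i v) (C i w) k p)))
      (comb-⊝ c d (v k p) (w k p) (E i (C i v) k p) (E i (C i w) k p))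

    s-s : ∀ i v → s i (s i v) ≈ v
    s-s i v k p with k Fin.≟ i
    ... | no ne = trans (s-other ne (s i v) p) (s-other ne v p)
    ... | yes refl = trans (s-self i (s i v) p) (trans (cong₂ _⊝_ (s-self i v p)
          (trans (C-sub i v (E i (C i v)) p) (cong (C i v p ⊝_) (trans (C-E i i (C i v) p) (cartan-self i (C i v) p)))))
          (involution (v i p) (C i v p)))

    record Automorphism : Set where
      field
        to from : V → V
        to-from : ∀ v → to (from v) ≈ v
        from-to : ∀ v → from (to v) ≈ v
        to-cong : CongV to
        from-cong : CongV from
        to-linear : LinearV to
        from-linear : LinearV from
    open Automorphism

    ≈-trans : ∀ {u v w} → u ≈ v → v ≈ w → u ≈ w
    ≈-trans h g k p = trans (h k p) (g k p)

    ≈-sym : ∀ {u v} → u ≈ v → v ≈ u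
    ≈-sym h k p = sym (h k p)

    automorphisms : Group 0ℓ 0ℓ
    automorphisms = record
      { Carrier = Automorphism
      ; _≈_ = λ f g → ∀ v → to f v ≈ to g v
      ; _∙_ = λ f g → record
        { to = to f ∘ to g
        ; from = from g ∘ from f
        ; to-from = λ v → ≈-trans (to-cong f (to-from g (from f v))) (to-from f v)
        ; from-to = λ v → ≈-trans (from-cong g (from-to f (to g v))) (from-to g v)
        ; to-cong = to-cong f ∘ to-cong g
        ; from-cong = from-cong g ∘ from-cong f
        ; to-linear = λ c d v w → ≈-trans (to-cong f (to-linear g c d v w)) (to-linear f c d _ _)
        ; from-linear = λ c d v w → ≈-trans (from-cong g (from-linear f c d v w)) (from-linear g c d _ _)
        }
      ; ε = record
        { to = id ; from = id ; to-from = λ _ _ _ → refl ; from-to = λ _ _ _ → refl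
        ; to-cong = id ; from-cong = id ; to-linear = λ _ _ _ _ _ _ → refl ; from-linear = λ _ _ _ _ _ _ → refl }
      ; _⁻¹ = λ f → record
        { to = from f ; from = to f ; to-from = from-to f ; from-to = to-from f
        ; to-cong = from-cong f ; from-cong = to-cong f ; to-linear = from-linear f ; from-linear = to-linear f }
      ; isGroup = record
        { isMonoid = record
          { isSemigroup = record
            { isMagma = record
              { isEquivalence = record
                { refl = λ _ _ _ → refl ; sym = λ h v → ≈-sym (h v) ; trans = λ h g v → ≈-trans (h v) (g v) }
              ; ∙-cong = λ {f} {g} {f′} {g′} h h′ v → ≈-trans (to-cong f (h′ v)) (h (to g′ v))
              }
            ; assoc = λ _ _ _ _ _ _ → refl
            }
          ; identity = (λ _ _ _ _ → refl) , (λ _ _ _ _ → refl)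
          }
        ; inverse = (λ f v → from-to f v) , (λ f v → to-from f v)
        ; ⁻¹-cong = λ {f} {g} h v → ≈-trans (from-cong f (≈-trans (≈-sym (to-from g v)) (≈-sym (h (from g v))))) (from-to f (from g v))
        }
      }

    simple : Fin rank → Automorphism
    simple i = record
      { to = s i ; from = s i ; to-from = s-s i ; from-to = s-s i
      ; to-cong = s-cong i ; from-cong = s-cong i ; to-linear = s-linear i ; from-linear = s-linear i }

    module Dihedral {i j : Fin rank} (i≢j : i ≢ j) (v : V) where
      open Group automorphisms using () renaming (_∙_ to _∙ᵃ_; ε to εᵃ)

      q : Seq → Seq
      q = Q i j

      -- The part of the x-coordinate of s x w that depends on neither the x- nor the y-coordinate of w.
      rest : Fin rank → Fin rank → V → Seq
      rest x y w p = (w x p ⊕ w x p ⊝ q (w y) p) ⊝ C x w p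

      Z : ℕ → V
      Z l = to (powOp _∙ᵃ_ εᵃ (simple i ∙ᵃ simple j) l) v

      module _ {x y : Fin rank} (x≢y : x ≢ y) (Qxy : ∀ a p → Q x y a p ≡ q a p) where
        reflection : ∀ w p → s x w x p ≡ (q (w y) p ⊝ w x p) ⊕ rest x y w p
        reflection w p = trans (s-self x w p) (reflect (w x p) (C x w p) (q (w y) p))

        rest-self : ∀ w p → rest x y (s x w) p ≡ rest x y w p
        rest-self w p = trans (cong₂ _⊝_
            (cong₂ (λ a b → a ⊕ a ⊝ b) (s-self x w p) (Path.Q-cong _ (s-other (x≢y ∘ sym) w) p))
            (trans (C-sub x w _ p) (cong (C x w p ⊝_) (trans (C-E x x (C x w) p) (cartan-self x (C x w) p)))))
          (const-self (w x p) (C x w p) (q (w y) p) (C x w p))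

        rest-other : ∀ w p → rest x y (s y w) p ≡ rest x y w p
        rest-other w p = trans (cong₂ _⊝_
            (cong₂ (λ a b → a ⊕ a ⊝ b) (s-other x≢y w p)
              (trans (Path.Q-cong _ (s-self y w) p) (⊝-linear (Path.Q-cong _) (Path.Q-linear _) (w y) (C y w) p)))
            (trans (C-sub x w _ p) (cong (C x w p ⊝_) (trans (C-E x y (C y w) p)
              (trans (cartan-off x≢y (C y w) p) (cong ⊖_ (Qxy (C y w) p)))))))
          (const-other (w x p) (q (w y) p) (q (C y w) p) (C x w p))

      j≢i : j ≢ i
      j≢i = i≢j ∘ sym

      Qij : ∀ a p → Q i j a p ≡ q a p
      Qij a p = refl
      Qji : ∀ a p → Q j i a p ≡ q a p
      Qji = Q-sym i j

      rest-i : ∀ l p → rest i j (Z l) p ≡ rest i j v p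
      rest-i zero p = refl
      rest-i (suc l) p = trans (rest-self i≢j Qij (s j (Z l)) p) (trans (rest-other i≢j Qij (Z l) p) (rest-i l p))

      rest-j : ∀ l p → rest j i (Z l) p ≡ rest j i v p
      rest-j zero p = refl
      rest-j (suc l) p = trans (rest-other j≢i Qji (s j (Z l)) p) (trans (rest-self j≢i Qji (Z l) p) (rest-j l p))

      const : ℕ → Seq
      const zero = rest j i v
      const (suc zero) = rest i j v
      const (suc (suc k)) = const k

      -- The orbit under alternating reflections, interleaved: even entries are j-coordinates and
      -- odd entries i-coordinates. The inhomogeneous terms `const` have period two, so they drop
      -- out of the differences `d`, which satisfy the recurrence of `U`.
      z : ℕ → Seq
      z zero = v j
      z (suc zero) = v i
      z (suc (suc k)) p = (q (z (suc k)) p ⊝ z k p) ⊕ const k p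

      dbl : ℕ → ℕ
      dbl zero = zero
      dbl (suc l) = suc (suc (dbl l))

      const-even : ∀ l → const (dbl l) ≡ rest j i v
      const-even zero = refl
      const-even (suc l) = const-even l

      const-odd : ∀ l → const (suc (dbl l)) ≡ rest i j v
      const-odd zero = refl
      const-odd (suc l) = const-odd l

      Z-j : ∀ l p → Z l j p ≡ z (dbl l) p
      Z-i : ∀ l p → Z l i p ≡ z (suc (dbl l)) p
      half : ∀ l p → s j (Z l) j p ≡ z (suc (suc (dbl l))) p
      half l p = trans (reflection j≢i Qji (Z l) p)
        (cong₂ _⊕_ (cong₂ _⊝_ (Path.Q-cong _ (Z-i l) p) (Z-j l p)) (trans (rest-j l p) (cong (λ f → f p) (sym (const-even l)))))
      Z-j zero p = refl
      Z-j (suc l) p = trans (s-other j≢i (s j (Z l)) p) (half l p)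
      Z-i zero p = refl
      Z-i (suc l) p = trans (reflection i≢j Qij (s j (Z l)) p)
        (cong₂ _⊕_ (cong₂ _⊝_ (Path.Q-cong _ (half l) p) (trans (s-other i≢j (Z l) p) (Z-i l p)))
          (trans (rest-other i≢j Qij (Z l) p) (trans (rest-i l p) (cong (λ f → f p) (sym (const-odd l))))))

      Z-other : ∀ l k → k ≢ i → k ≢ j → ∀ p → Z l k p ≡ v k p
      Z-other zero k _ _ p = refl
      Z-other (suc l) k ki kj p = trans (s-other ki (s j (Z l)) p) (trans (s-other kj (Z l) p) (Z-other l k ki kj p))

      d : ℕ → Seq
      d k p = z (suc (suc k)) p ⊝ z k p

      d-rec : ∀ k p → d (suc (suc k)) p ≡ q (d (suc k)) p ⊝ d k p
      d-rec k p = trans (rec-diff (q (z (suc (suc (suc k)))) p) (z (suc (suc k)) p) (q (z (suc k)) p) (z k p) (const k p))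
        (cong (_⊝ d k p) (sym (⊝-linear (Path.Q-cong _) (Path.Q-linear _) (z (suc (suc (suc k)))) (z (suc k)) p)))

      telescoped : ∀ n k p → partialSum d n k p ≡ z (dbl n + k) p ⊝ z k p
      telescoped zero k p = sym (ℤ.+-inverseʳ (z k p))
      telescoped (suc n) k p = trans (cong (d k p ⊕_) (trans (telescoped n (suc (suc k)) p)
          (cong (λ y → z y p ⊝ z (suc (suc k)) p) (trans (ℕ.+-suc (dbl n) (suc k)) (cong suc (ℕ.+-suc (dbl n) k))))))
        (telescope (z k p) (z (suc (suc k)) p) (z (dbl (suc n) + k) p))

      m≡ : m i j ≡ suc (suc (m i j ∸ 2))
      m≡ = sym (ℕ.m+[n∸m]≡n (m-off i j i≢j))

      -- The m differences telescope to the left side minus the right side, and by `S≡U` they add up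
      -- to the m-th Chebyshev polynomial of the middle one, which vanishes.
      z-periodic : ∀ k p → z (dbl (m i j) + k) p ≡ z k p
      z-periodic k p = ⊝-cancel (z (dbl (m i j) + k) p) (z k p) (trans (sym (telescoped (m i j) k p))
        (trans (cong (λ n → partialSum d n k p) m≡)
          (trans (Path.S≡U (m i j ∸ 2) d d-rec (suc (m i j ∸ 2)) k p) (Path.U-vanish (m i j ∸ 2) (d (suc (m i j ∸ 2) + k)) p))))

      Z-period : Z (m i j) ≈ v
      Z-period k p = cases (k Fin.≟ i) (k Fin.≟ j)
        where
          cases : Dec (k ≡ i) → Dec (k ≡ j) → Z (m i j) k p ≡ v k p
          cases (yes refl) _ = trans (Z-i (m i j) p)
            (trans (cong (λ y → z y p) (ℕ.+-comm 1 (dbl (m i j)))) (z-periodic 1 p))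
          cases (no _) (yes refl) = trans (Z-j (m i j) p)
            (trans (cong (λ y → z y p) (sym (ℕ.+-identityʳ (dbl (m i j))))) (z-periodic 0 p))
          cases (no ki) (no kj) = Z-other (m i j) k ki kj p

    relation : ∀ i j → Group._≈_ automorphisms
      (powOp (Group._∙_ automorphisms) (Group.ε automorphisms) (Group._∙_ automorphisms (simple i) (simple j)) (m i j))
      (Group.ε automorphisms)
    relation i j v = cases (i Fin.≟ j)
      where
        open Group automorphisms using () renaming (_∙_ to _∙ᵃ_; ε to εᵃ)
        cases : Dec (i ≡ j) → to (powOp _∙ᵃ_ εᵃ (simple i ∙ᵃ simple j) (m i j)) v ≈ v
        cases (no ne) = Dihedral.Z-period ne v
        cases (yes refl) = subst (λ n → to (powOp _∙ᵃ_ εᵃ (simple i ∙ᵃ simple i) n) v ≈ v) (sym (m-diag i)) (s-s i v)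

    private
      lift : Σ (W → Automorphism) _
      lift = universal automorphisms simple relation

    act : W → V → V
    act w = to (proj₁ lift w)

    act-cong : ∀ w → CongV (act w)
    act-cong w = to-cong (proj₁ lift w)

    act-linear : ∀ w → LinearV (act w)
    act-linear w = to-linear (proj₁ lift w)

    act-· : ∀ u w v → act (u · w) v ≈ act u (act w v)
    act-· u w v = proj₁ (proj₂ lift) u w v

    act-gen : ∀ i v → act (gen i) v ≈ s i v
    act-gen i v = proj₂ (proj₂ lift) i v

    -- `universal` only promises multiplicativity, so `act e` is known to be idempotent; being
    -- invertible, it is the identity.
    act-e : ∀ v → act e v ≈ v
    act-e v = ≈-trans (≈-sym (from-to φ (act e v))) (≈-trans (from-cong φ fixed) (from-to φ v))
      where
        φ = proj₁ lift e
        fixed : act e (act e v) ≈ act e v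
        fixed k p = trans (sym (act-· e e v k p)) (cong (λ w → act w v k p) (idˡ e))

  open FiniteSum ℤ.+-0-commutativeMonoid

  Σ-nonneg : ∀ {A : Set} (xs : List A) (f : A → ℤ) → (∀ x → 0ℤ ≤ℤ f x) → 0ℤ ≤ℤ Σ[ xs ] f
  Σ-nonneg [] f h = ℤ.≤-refl
  Σ-nonneg (x ∷ xs) f h = ⊕-nonneg (h x) (Σ-nonneg xs f h)

  Σ-term : ∀ {A : Set} {xs : List A} (f : A → ℤ) → (∀ x → 0ℤ ≤ℤ f x) → ∀ {x} → x ∈ xs → f x ≤ℤ Σ[ xs ] f
  Σ-term {xs = x ∷ xs} f h (here refl) = subst (_≤ℤ f x ⊕ Σ[ xs ] f) (ℤ.+-identityʳ (f x))
    (ℤ.+-monoʳ-≤ (f x) (Σ-nonneg xs f h))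
  Σ-term {xs = y ∷ xs} f h {x} (there p) = subst (_≤ℤ f y ⊕ Σ[ xs ] f) (ℤ.+-identityˡ (f x))
    (ℤ.+-mono-≤ (h y) (Σ-term f h p))

  module Representation (G : FiniteCoxeterSystem) where
    open Cox G
    open SimpleSystems G
    open Geometric G public

    Nonneg : V → Set
    Nonneg v = ∀ k p → 0ℤ ≤ℤ v k p

    infixl 6 _⊞_
    _⊞_ : V → V → V
    (v ⊞ w) k p = v k p ⊕ w k p

    neg : V → V
    neg v k p = ⊖ v k p

    ΣV : {A : Set} → List A → (A → V) → V
    ΣV xs f k p = Σ[ xs ] (λ x → f x k p)

    act-⊞ : ∀ u v w → act u (v ⊞ w) ≈ act u v ⊞ act u w
    act-⊞ u v w k p = trans (act-cong u (λ k q → sym (ℤ-Identities.as-⊕ (v k q) (w k q))) k p)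
      (trans (act-linear u 1ℤ 1ℤ v w k p) (ℤ-Identities.as-⊕ (act u v k p) (act u w k p)))

    act-sub : ∀ u v w → act u (sub v w) ≈ sub (act u v) (act u w)
    act-sub u v w k p = trans (act-cong u (λ k q → sym (ℤ-Identities.as-⊝ (v k q) (w k q))) k p)
      (trans (act-linear u 1ℤ (⊖ 1ℤ) v w k p) (ℤ-Identities.as-⊝ (act u v k p) (act u w k p)))

    act-neg : ∀ u v → act u (neg v) ≈ neg (act u v)
    act-neg u v k p = trans (act-cong u (λ k q → sym (ℤ-Identities₂.as-neg (v k q))) k p)
      (trans (act-linear u (⊖ 1ℤ) 0ℤ v v k p) (ℤ-Identities₂.as-neg (act u v k p)))

    0V : V
    0V k p = 0ℤ

    act-0 : ∀ u → act u 0V ≈ 0V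
    act-0 u = act-linear u 0ℤ 0ℤ 0V 0V

    act-Σ : ∀ {A : Set} u (xs : List A) f → act u (ΣV xs f) ≈ ΣV xs (act u ∘ f)
    act-Σ u [] f = act-0 u
    act-Σ u (x ∷ xs) f k p = trans (act-⊞ u (f x) (ΣV xs f) k p) (cong (act u (f x) k p ⊕_) (act-Σ u xs f k p))

    act-inv : ∀ u v → act (u ⁻¹) (act u v) ≈ v
    act-inv u v k p = trans (sym (act-· (u ⁻¹) u v k p)) (trans (cong (λ z → act z v k p) (invˡ u)) (act-e v k p))

    act-·gen : ∀ u i v → act (u · gen i) v ≈ act u (s i v)
    act-·gen u i v k p = trans (act-· u (gen i) v k p) (act-cong u (act-gen i v) k p)

    act-gen-flip : ∀ u i v → act u v ≈ act (u · gen i) (s i v)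
    act-gen-flip u i v k p = trans (act-cong u (≈-sym (s-s i v)) k p) (≈-sym (act-·gen u i (s i v)) k p)

    act-word-other : ∀ {i} ws → i ∉ ws → ∀ v p → act (word ws) v i p ≡ v i p
    act-word-other [] h v p = act-e v _ p
    act-word-other {i} (j ∷ ws) h v p = trans (act-· (gen j) (word ws) v i p)
      (trans (act-gen j (act (word ws) v) i p) (trans (s-other (h ∘ here) (act (word ws) v) p) (act-word-other ws (h ∘ there) v p)))

    s-E-self : ∀ i a → s i (E i a) ≈ neg (E i a)
    s-E-self i a k p = cases (k Fin.≟ i)
      where
        cases : Dec (k ≡ i) → s i (E i a) k p ≡ neg (E i a) k p
        cases (yes refl) = trans (s-self i (E i a) p) (trans (cong (E i a i p ⊝_) (trans (C-E i i a p)
          (trans (cartan-self i a p) (cong₂ _⊕_ (sym (E-self i a p)) (sym (E-self i a p)))))) (ℤ-Identities₂.negate (E i a i p)))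
        cases (no ne) = trans (s-other ne (E i a) p) (trans (E-other ne a p) (cong ⊖_ (sym (E-other ne a p))))

    private
      s-pair-lem : ∀ q b → (0ℤ ⊕ b) ⊝ ((⊖ q) ⊕ (b ⊕ b)) ≡ 0ℤ ⊕ (q ⊝ b)
      s-pair-lem = solve-∀

    s-pair : ∀ {x y} → x ≢ y → ∀ a b → s y (E x a ⊞ E y b) ≈ E x a ⊞ E y (λ p → Q y x a p ⊝ b p)
    s-pair {x} {y} x≢y a b k p = cases (k Fin.≟ y)
      where
        open ≡-Reasoning
        y≢x : y ≢ x
        y≢x = x≢y ∘ sym
        C-⊞ : C y (E x a ⊞ E y b) p ≡ (⊖ Q y x a p) ⊕ (b p ⊕ b p)
        C-⊞ = begin
          C y (E x a ⊞ E y b) p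
            ≡⟨ C-cong y (λ k q → sym (ℤ-Identities.as-⊕ (E x a k q) (E y b k q))) p ⟩
          C y (comb 1ℤ 1ℤ (E x a) (E y b)) p
            ≡⟨ C-linear y 1ℤ 1ℤ (E x a) (E y b) p ⟩
          1ℤ ⊛ C y (E x a) p ⊕ 1ℤ ⊛ C y (E y b) p
            ≡⟨ ℤ-Identities.as-⊕ (C y (E x a) p) (C y (E y b) p) ⟩
          C y (E x a) p ⊕ C y (E y b) p
            ≡⟨ cong₂ _⊕_ (trans (C-E y x a p) (cartan-off y≢x a p)) (trans (C-E y y b p) (cartan-self y b p)) ⟩
          (⊖ Q y x a p) ⊕ (b p ⊕ b p)
            ∎
        cases : Dec (k ≡ y) → s y (E x a ⊞ E y b) k p ≡ (E x a ⊞ E y (λ p → Q y x a p ⊝ b p)) k p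
        cases (no ne) = trans (s-other ne (E x a ⊞ E y b) p) (cong (E x a k p ⊕_) (trans (E-other ne b p) (sym (E-other ne _ p))))
        cases (yes refl) = begin
          s y (E x a ⊞ E y b) y p
            ≡⟨ s-self y (E x a ⊞ E y b) p ⟩
          (E x a y p ⊕ E y b y p) ⊝ C y (E x a ⊞ E y b) p
            ≡⟨ cong₂ _⊝_ (cong₂ _⊕_ (E-other y≢x a p) (E-self y b p)) C-⊞ ⟩
          (0ℤ ⊕ b p) ⊝ ((⊖ Q y x a p) ⊕ (b p ⊕ b p))
            ≡⟨ s-pair-lem (Q y x a p) (b p) ⟩
          0ℤ ⊕ (Q y x a p ⊝ b p)
            ≡⟨ sym (cong₂ _⊕_ (E-other y≢x a p) (E-self y _ p)) ⟩
          E x a y p ⊕ E y (λ p → Q y x a p ⊝ b p) y p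
            ∎

    𝟏 : Seq
    𝟏 _ = 1ℤ

    -- The presentation does not show at once that its generators stay distinct in `W`. In the
    -- representation, s_i negates the i-th coordinate of `E i 𝟏` while s_j with j different from i
    -- leaves it alone.
    gen-injective : ∀ {i j} → gen i ≡ gen j → i ≡ j
    gen-injective {i} {j} h = cases (i Fin.≟ j)
      where
        cases : Dec (i ≡ j) → i ≡ j
        cases (yes p) = p
        cases (no ne) = contradiction -1≡1 λ ()
          where
            -1≡1 : ⊖ 1ℤ ≡ 1ℤ
            -1≡1 = begin
              ⊖ 1ℤ                        ≡⟨ cong ⊖_ (sym (E-self i 𝟏 0)) ⟩
              ⊖ E i 𝟏 i 0               ≡⟨ sym (s-E-self i 𝟏 i 0) ⟩
              s i (E i 𝟏) i 0           ≡⟨ sym (act-gen i (E i 𝟏) i 0) ⟩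
              act (gen i) (E i 𝟏) i 0   ≡⟨ cong (λ z → act z (E i 𝟏) i 0) h ⟩
              act (gen j) (E i 𝟏) i 0   ≡⟨ act-gen j (E i 𝟏) i 0 ⟩
              s j (E i 𝟏) i 0           ≡⟨ s-other ne (E i 𝟏) 0 ⟩
              E i 𝟏 i 0                 ≡⟨ E-self i 𝟏 0 ⟩
              1ℤ                          ∎
              where open ≡-Reasoning

  -- Every root is positive or negative

  module Positivity (G : FiniteCoxeterSystem)
    (ℓ : Cox.W G → ℕ) (isℓ : Cox.IsCoxeterLength G ℓ) where
    open Cox G
    open SimpleSystems G
    open CoxeterLength G ℓ isℓ
    open Representation G

    -- The alternating words of odd length, which are reflections of the dihedral subgroup. `τ n` is
    -- what the initial reflection `gen i` has become after n descents (`τ-suc`), and it must never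
    -- be an inversion.
    τ : ℕ → Fin rank → Fin rank → W
    τ n x y = pow (gen x · gen y) n · gen x

    pow-swap : ∀ x y n → gen x · pow (gen y · gen x) n ≡ pow (gen x · gen y) n · gen x
    pow-swap x y zero = trans (idʳ _) (sym (idˡ _))
    pow-swap x y (suc n) = begin
      gen x · ((gen y · gen x) · P)   ≡⟨ group 3 (λ a b p → a ⊙ ((b ⊙ a) ⊙ p) ≐ (a ⊙ b) ⊙ (a ⊙ p)) refl (gen x) (gen y) P ⟩
      (gen x · gen y) · (gen x · P)   ≡⟨ cong ((gen x · gen y) ·_) (pow-swap x y n) ⟩
      (gen x · gen y) · (pow (gen x · gen y) n · gen x)  ≡⟨ sym (assoc _ _ _) ⟩
      τ (suc n) x y                   ∎
      where
        open ≡-Reasoning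
        P = pow (gen y · gen x) n

    τ-suc : ∀ n x y → τ n x y ^^ gen y ≡ τ (suc n) y x
    τ-suc n x y = begin
      gen y · ((pow (gen x · gen y) n · gen x) · (gen y ⁻¹))
        ≡⟨ cong₂ (λ a b → gen y · (a · b)) (sym (pow-swap x y n)) (gen⁻¹ y) ⟩
      gen y · ((gen x · pow (gen y · gen x) n) · gen y)
        ≡⟨ group 3 (λ y x p → y ⊙ ((x ⊙ p) ⊙ y) ≐ ((y ⊙ x) ⊙ p) ⊙ y) refl (gen y) (gen x) (pow (gen y · gen x) n) ⟩
      τ (suc n) y x ∎
      where open ≡-Reasoning

    τ-last : ∀ n x y → pow (gen x · gen y) (suc n) ≡ e → τ n x y ≡ gen y
    τ-last n x y h = trans (inv-unique′ (begin
      τ n x y · gen y                                  ≡⟨ assoc _ _ _ ⟩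
      pow (gen x · gen y) n · (gen x · gen y)          ≡⟨ sym (pow-comm (gen x · gen y) n) ⟩
      pow (gen x · gen y) (suc n)                      ≡⟨ h ⟩
      e                                                ∎)) (gen⁻¹ y)
      where
        open ≡-Reasoning
        inv-unique′ : ∀ {u v} → u · v ≡ e → u ≡ v ⁻¹
        inv-unique′ {u} {v} p = trans (group 2 (λ u v → u ≐ (u ⊙ v) ⊙ inv v) refl u v) (trans (cong (_· (v ⁻¹)) p) (idˡ _))

    module Rank2 (i j : Fin rank) (i≢j : i ≢ j) where
      κ : ℕ
      κ = m i j ∸ 2

      U : ℕ → Seq → Seq
      U = Path.U κ

      -- The two generators exchange roles at every descent while `κ` remains that of the original
      -- pair; this collects the facts that survive the exchange.
      record Ordered (x y : Fin rank) : Set where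
        field
          distinct : x ≢ y
          sameQ : ∀ a p → Q y x a p ≡ Path.Q κ a p
          order : pow (gen x · gen y) (suc (suc κ)) ≡ e
      open Ordered

      m≡ : m i j ≡ suc (suc κ)
      m≡ = sym (ℕ.m+[n∸m]≡n (m-off i j i≢j))

      orderedˡ : Ordered i j
      orderedˡ = record { distinct = i≢j ; sameQ = Q-sym i j ; order = subst (λ n → pow (gen i · gen j) n ≡ e) m≡ (relations i j) }

      flip : ∀ {x y} → Ordered x y → Ordered y x
      flip {x} {y} o = record
        { distinct = distinct o ∘ sym
        ; sameQ = λ a p → trans (Q-sym y x a p) (sameQ o a p)
        ; order = cancelˡ {gen x} (trans (pow-swap x y (suc (suc κ))) (trans (cong (_· gen x) (order o)) (trans (idˡ _) (sym (idʳ _))))) }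

      pair : ℕ → Seq → Fin rank → Fin rank → V
      pair n a x y = E x (U (suc n) a) ⊞ E y (U n a)

      -- On such a pair of coefficients the reflection s_y acts by the Chebyshev recurrence itself.
      s-Upair : ∀ {x y} → Ordered x y → ∀ n a → s y (pair n a x y) ≈ pair (suc n) a y x
      s-Upair {x} {y} o n a k p = trans (s-pair (distinct o) (U (suc n) a) (U n a) k p)
        (trans (ℤ.+-comm (E x (U (suc n) a) k p) _)
          (cong (_⊕ E x (U (suc n) a) k p) (E-cong y (λ q → trans (cong (_⊝ U n a q) (sameQ o (U (suc n) a) q))
            (sym (Path.U-step κ n a q))) k p)))

    -- After n descents alternating between two generators the coefficients are U_{n+1} a and U_n a; a full run of
    -- m descents would make the initial reflection τ 0 an inversion as well.
    positiveBelow : ∀ f v i {a} → (∀ p → 0ℤ ≤ℤ a p) → ℓ v ≤ f → η v (gen i) ≡ false → Nonneg (act v (E i a))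

    module _ {i j : Fin rank} (i≢j : i ≢ j) where
      open Rank2 i j i≢j

      climb : ∀ f v n x y {a} → Ordered x y → (∀ p → 0ℤ ≤ℤ a p) → n ≤ suc κ → ℓ v ≤ f →
        η v (gen x) ≡ false → η v (τ n x y) ≡ false → Nonneg (act v (pair n a x y))
      step : ∀ f v n x y {a} → Ordered x y → (∀ p → 0ℤ ≤ℤ a p) → n ≤ suc κ → ℓ v ≤ f →
        η v (gen y) ≡ true → η v (τ n x y) ≡ false → Nonneg (act v (pair n a x y))

      climb f v n x y {a} o a≥0 n≤ l hx hτ = cases (η v (gen y)) refl
        where
          cases : ∀ b → η v (gen y) ≡ b → Nonneg (act v (pair n a x y))
          cases true  hy = step f v n x y o a≥0 n≤ l hy hτ
          -- Neither generator is a descent of v, so the two terms are nonnegative separately; n ≤ m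
          -- - 1 keeps both coefficients in the range of `U-nonneg`.
          cases false hy k p = subst (0ℤ ≤ℤ_) (sym (act-⊞ v (E x (U (suc n) a)) (E y (U n a)) k p))
            (⊕-nonneg (positiveBelow f v x (Path.U-nonneg κ a≥0 (suc n) (s≤s n≤)) l hx k p)
                      (positiveBelow f v y (Path.U-nonneg κ a≥0 n (ℕ.≤-trans n≤ (ℕ.n≤1+n _))) l hy k p))

      step zero v n x y o a≥0 n≤ l hy hτ = contradiction (ℕ.<-≤-trans (ℓ-descent (refl-gen y) hy) l) λ ()
      step (suc f) v n x y {a} o a≥0 n≤ l hy hτ = cases (ℕ.m≤n⇒m<n∨m≡n n≤)
        where
          v′ : W
          v′ = v · gen y
          v≡ : v ≡ v′ · gen y
          v≡ = sym (·-refl² (refl-gen y) v)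
          not-gen : η (gen y) (τ n x y) ≡ false
          not-gen with η (gen y) (τ n x y) in eq
          ... | false = refl
          ... | true  = contradiction (trans (sym hy) (trans (cong (η v) (sym (η-gen-true eq))) hτ)) true≢false
          τ-false : η v′ (τ (suc n) y x) ≡ false
          τ-false = begin
            η v′ (τ (suc n) y x)                             ≡⟨ cong (η v′) (sym (τ-suc n x y)) ⟩
            false xor η v′ (τ n x y ^^ gen y)                ≡⟨ cong (_xor η v′ (τ n x y ^^ gen y)) (sym not-gen) ⟩
            η (gen y) (τ n x y) xor η v′ (τ n x y ^^ gen y)  ≡⟨ sym (η-· v′ (gen y) (τ n x y)) ⟩
            η (v′ · gen y) (τ n x y)                         ≡⟨ cong (λ z → η z (τ n x y)) (sym v≡) ⟩
            η v (τ n x y)                                    ≡⟨ hτ ⟩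
            false                                            ∎
            where open ≡-Reasoning
          cases : n < suc κ ⊎ n ≡ suc κ → Nonneg (act v (pair n a x y))
          -- Here n = m - 1 and `τ n x y` equals `gen y`, which would be an inversion of v by `hy`
          -- and none by `hτ`.
          cases (inj₂ refl) = contradiction (trans (sym hy) (trans (cong (η v) (sym (τ-last n x y (order o)))) hτ)) true≢false
            where open Ordered
          cases (inj₁ n<) k p = subst (0ℤ ≤ℤ_)
            (sym (trans (act-gen-flip v y (pair n a x y) k p) (act-cong v′ (s-Upair o n a) k p)))
            (climb f v′ (suc n) y x (flip o) a≥0 n< (ℕ.≤-pred (ℕ.≤-trans (ℓ-descent (refl-gen y) hy) l))
              (trans (η-flip (refl-gen y) v) (cong not hy)) τ-false k p)

    positiveBelow f v i {a} a≥0 l h k p = cases (v ≟ e)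
      where
        cases : Dec (v ≡ e) → 0ℤ ≤ℤ act v (E i a) k p
        cases (yes refl) = subst (0ℤ ≤ℤ_) (sym (act-e (E i a) k p))
          (E-elim (0ℤ ≤ℤ_) i a k p (λ _ → a≥0 p) (λ _ → ℤ.≤-refl))
        cases (no v≢e) with descent v v≢e
        ... | j , hj = subst (0ℤ ≤ℤ_) (act-cong v pair≈ k p)
                (step i≢j f v 0 i j orderedˡ a≥0 z≤n l hj (trans (cong (η v) (idˡ (gen i))) h) k p)
          where
            i≢j : i ≢ j
            i≢j refl = true≢false (trans (sym hj) h)
            open Rank2 i j i≢j
            pair≈ : pair 0 a i j ≈ E i a
            pair≈ k q = trans (cong₂ _⊕_ (E-cong i (Path.U-one κ a) k q) (trans (E-cong j (Path.U-zero κ a) k q) (E-elim (_≡ 0ℤ) j _ k q (λ _ → refl) (λ _ → refl))))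
              (ℤ.+-identityʳ _)

    act-E-nonneg : ∀ v i {a} → (∀ p → 0ℤ ≤ℤ a p) → η v (gen i) ≡ false → Nonneg (act v (E i a))
    act-E-nonneg v i a≥0 h = positiveBelow (ℓ v) v i a≥0 ℕ.≤-refl h

    act-E-flip : ∀ v i a → act v (E i a) ≈ neg (act (v · gen i) (E i a))
    act-E-flip v i a k p = trans (act-gen-flip v i (E i a) k p)
      (trans (act-cong (v · gen i) (s-E-self i a) k p) (act-neg (v · gen i) (E i a) k p))

  module ℤ-Ratios where
    private
      lem₁ : ∀ a b c → (a ⊛ b) ⊛ c ≡ (a ⊛ c) ⊛ b
      lem₁ = solve-∀

    cross-trans : ∀ a b c a′ b′ c′ → 0ℤ ≤ℤ a′ → 0ℤ <ℤ b′ → 0ℤ ≤ℤ c′ →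
      a ⊛ b′ ≤ℤ b ⊛ a′ → b ⊛ c′ ≤ℤ c ⊛ b′ → a ⊛ c′ ≤ℤ c ⊛ a′
    cross-trans a b c a′ b′ c′ a≥0 b>0 c≥0 h₁ h₂ =
      ℤ.*-cancelʳ-≤-pos (a ⊛ c′) (c ⊛ a′) b′ {{positive b>0}} (begin
        (a ⊛ c′) ⊛ b′   ≡⟨ lem₁ a c′ b′ ⟩
        (a ⊛ b′) ⊛ c′   ≤⟨ ℤ.*-monoʳ-≤-nonNeg c′ {{nonNegative c≥0}} h₁ ⟩
        (b ⊛ a′) ⊛ c′   ≡⟨ lem₁ b a′ c′ ⟩
        (b ⊛ c′) ⊛ a′   ≤⟨ ℤ.*-monoʳ-≤-nonNeg a′ {{nonNegative a≥0}} h₂ ⟩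
        (c ⊛ b′) ⊛ a′   ≡⟨ lem₁ c b′ a′ ⟩
        (c ⊛ a′) ⊛ b′   ∎)
      where open ℤ.≤-Reasoning

    -- Ratios f / g with positive denominators are compared by cross multiplication, so the minimum
    -- is found without leaving the integers.
    minRatio : {A : Set} (f g : A → ℤ) (x : A) (xs : List A) → (∀ {y} → y ∈ x ∷ xs → 0ℤ <ℤ g y) →
      ∃ λ z → z ∈ x ∷ xs × (∀ {y} → y ∈ x ∷ xs → f z ⊛ g y ≤ℤ f y ⊛ g z)
    minRatio f g x [] h = x , here refl , λ { (here refl) → ℤ.≤-refl }
    minRatio f g x (y ∷ ys) h with minRatio f g y ys (h ∘ there)
    ... | z , z∈ , min with ℤ.≤-total (f x ⊛ g z) (f z ⊛ g x)
    ...   | inj₂ z≤x = z , there z∈ , λ { (here refl) → z≤x ; (there w∈) → min w∈ }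
    ...   | inj₁ x≤z = x , here refl , least
      where
        least : ∀ {w} → w ∈ x ∷ y ∷ ys → f x ⊛ g w ≤ℤ f w ⊛ g x
        least (here refl) = ℤ.≤-refl
        least {w} (there w∈) = cross-trans (f x) (f z) (f w) (g x) (g z) (g w)
          (ℤ.<⇒≤ (h (here refl))) (h (there z∈)) (ℤ.<⇒≤ (h (there w∈))) x≤z (min w∈)

  open ℤ-Ratios

  ≤-neg : ∀ {x} → x ≤ℤ 0ℤ → 0ℤ ≤ℤ ⊖ x
  ≤-neg = ℤ.neg-mono-≤

  sum-zero : ∀ {x y} → 0ℤ ≤ℤ x → 0ℤ ≤ℤ y → x ⊕ y ≡ 0ℤ → x ≡ 0ℤ
  sum-zero {x} {y} hx hy h = ℤ.≤-antisym (subst (x ≤ℤ_) h (subst (_≤ℤ x ⊕ y) (ℤ.+-identityʳ x) (ℤ.+-monoʳ-≤ x hy))) hx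

  -- A strictly dominant positive vector and monotonicity of the Cartan operator

  module Cone (G : FiniteCoxeterSystem)
    (ℓ : Cox.W G → ℕ) (isℓ : Cox.IsCoxeterLength G ℓ) where
    open Cox G
    open SimpleSystems G
    open CoxeterLength G ℓ isℓ
    open Representation G
    open Positivity G ℓ isℓ
    open import Data.List.Membership.DecPropositional (Fin._≟_ {rank}) using (_∈?_)

    pathSize : Fin rank × Fin rank → ℕ
    pathSize (i , j) = suc (m i j ∸ 2)

    opaque
      -- A common multiple of all path sizes: cutting every coordinate at position N splits no path,
      -- so the cut is stable under `W` and leaves finitely many integers per vector.
      N : ℕ
      N = product (map pathSize (cartesianProduct (allFin rank) (allFin rank)))

      N-nonZero : NonZero N
      N-nonZero = product≢0 {ns = map pathSize (cartesianProduct (allFin rank) (allFin rank))}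
        (All.map⁺ {f = pathSize} (All.universal (λ _ → _) (cartesianProduct (allFin rank) (allFin rank))))

      K∣N : ∀ i j → suc (m i j ∸ 2) ∣ N
      K∣N i j = ∈⇒∣product (∈-map⁺ pathSize (∈-cartesianProduct⁺ (∈-allFin i) (∈-allFin j)))

    Supported : V → Set
    Supported v = ∀ k p → N ≤ p → v k p ≡ 0ℤ

    cartan-support : ∀ i j {a} → (∀ p → N ≤ p → a p ≡ 0ℤ) → ∀ p → N ≤ p → cartan i j a p ≡ 0ℤ
    cartan-support i j {a} h p N≤p = cases (i Fin.≟ j)
      where
        cases : Dec (i ≡ j) → cartan i j a p ≡ 0ℤ
        cases (yes refl) = trans (cartan-self i a p) (cong₂ _⊕_ (h p N≤p) (h p N≤p))
        cases (no ne) = trans (cartan-off ne a p) (cong ⊖_ (Path.Q-support (m i j ∸ 2) (K∣N i j) h p N≤p))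

    C-support : ∀ i {v} → Supported v → ∀ p → N ≤ p → C i v p ≡ 0ℤ
    C-support i {v} h p N≤p = trans (C≡ i v p) (sumF-zero _ (λ j → cartan-support i j (h j) p N≤p))

    s-support : ∀ i {v} → Supported v → Supported (s i v)
    s-support i {v} h k p N≤p = cong₂ _⊝_ (h k p N≤p)
      (E-elim (_≡ 0ℤ) i (C i v) k p (λ _ → C-support i h p N≤p) (λ _ → refl))

    act-support : ∀ w {v} → Supported v → Supported (act w v)
    act-support w {v} h with generated w
    ... | ws , refl = go ws
      where
        go : ∀ ws → Supported (act (word ws) v)
        go [] k p N≤p = trans (act-e v k p) (h k p N≤p)
        go (i ∷ ws) k p N≤p = trans (act-· (gen i) (word ws) v k p)
          (trans (act-gen i (act (word ws) v) k p) (s-support i (go ws) k p N≤p))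

    opaque
      -- Strictly positive at each of the N positions; in the definition of `ρ` it takes the place
      -- of a positive scalar multiple of a simple root.
      ones : Seq
      ones p with p ℕ.<? N
      ... | yes _ = 1ℤ
      ... | no _  = 0ℤ

      ones-< : ∀ {p} → p < N → ones p ≡ 1ℤ
      ones-< {p} h with p ℕ.<? N
      ... | yes _ = refl
      ... | no ¬h = contradiction h ¬h

      ones-≥ : ∀ p → N ≤ p → ones p ≡ 0ℤ
      ones-≥ p h with p ℕ.<? N
      ... | yes q = contradiction h (ℕ.<⇒≱ q)
      ... | no _  = refl

      ones-nonneg : ∀ p → 0ℤ ≤ℤ ones p
      ones-nonneg p with p ℕ.<? N
      ... | yes _ = ℤ.+≤+ z≤n
      ... | no _  = ℤ.≤-refl

    E-support : ∀ i {a} → (∀ p → N ≤ p → a p ≡ 0ℤ) → Supported (E i a)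
    E-support i {a} h k p N≤p = E-elim (_≡ 0ℤ) i a k p (λ _ → h p N≤p) (λ _ → refl)

    ΣV-nonneg : ∀ {A : Set} (xs : List A) f → (∀ x → Nonneg (f x)) → Nonneg (ΣV xs f)
    ΣV-nonneg xs f h k p = Σ-nonneg xs _ (λ x → h x k p)

    ΣV-support : ∀ {A : Set} (xs : List A) f → (∀ x → Supported (f x)) → Supported (ΣV xs f)
    ΣV-support xs f h k p N≤p = Σ-ε xs (λ x → h x k p N≤p)

    posRoot : W → Fin rank → V
    posRoot w i = if η w (gen i) then 0V else act w (E i ones)

    posRoot-true : ∀ {w i} → η w (gen i) ≡ true → posRoot w i ≈ 0V
    posRoot-true {w} {i} h k p = cong (λ b → (if b then 0V else act w (E i ones)) k p) h

    posRoot-false : ∀ {w i} → η w (gen i) ≡ false → posRoot w i ≈ act w (E i ones)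
    posRoot-false {w} {i} h k p = cong (λ b → (if b then 0V else act w (E i ones)) k p) h

    boolCases : ∀ {P : Set} b → (b ≡ true → P) → (b ≡ false → P) → P
    boolCases true  f g = f refl
    boolCases false f g = g refl

    posRoot-nonneg : ∀ w i → Nonneg (posRoot w i)
    posRoot-nonneg w i k p = boolCases (η w (gen i))
      (λ h → ℤ.≤-reflexive (sym (posRoot-true h k p)))
      (λ h → subst (0ℤ ≤ℤ_) (sym (posRoot-false h k p)) (act-E-nonneg w i ones-nonneg h k p))

    posRoot-support : ∀ w i → Supported (posRoot w i)
    posRoot-support w i k p N≤p = boolCases (η w (gen i))
      (λ h → posRoot-true h k p)
      (λ h → trans (posRoot-false h k p) (act-support w (E-support i ones-≥) k p N≤p))

    rootSum : (W → Fin rank → V) → V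
    rootSum f = ΣV elems (λ w → ΣV (allFin rank) (f w))

    -- A positive root is counted once for each pair (w , i) representing it.
    ρ : V
    ρ = rootSum posRoot

    elems-· : ∀ u (f : W → ℤ) → Σ[ elems ] f ≡ Σ[ elems ] (λ w → f (u · w))
    elems-· u f = trans (Σ-↭ f (unique-↭ elems-unique (Unique.map⁺ cancelˡ elems-unique)
        (λ {x} _ → subst (_∈ map (u ·_) elems) (group 2 (λ u x → u ⊙ (inv u ⊙ x) ≐ x) refl u x) (∈-map⁺ (u ·_) (elems-complete ((u ⁻¹) · x))))
        (λ _ → elems-complete _)))
      (Σ-map (u ·_) elems f)

    module _ (j : Fin rank) where
      gap : W → Fin rank → V
      gap w i = sub (posRoot w i) (act (gen j) (posRoot (gen j · w) i))

      C-ρ : ∀ p → C j ρ p ≡ rootSum gap j p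
      C-ρ p = begin
        C j ρ p                                  ≡⟨ ⊝-solve (ρ j p) (s j ρ j p) (C j ρ p) (s-self j ρ p) ⟩
        ρ j p ⊝ s j ρ j p                        ≡⟨ cong (ρ j p ⊝_) reflected ⟩
        ρ j p ⊝ rootSum (λ w i → act (gen j) (posRoot (gen j · w) i)) j p
                                                 ≡⟨ sym (Σ-⊝ elems (λ w → ΣV (allFin rank) (posRoot w) j p) (λ w → ΣV (allFin rank) (λ i → act (gen j) (posRoot (gen j · w) i)) j p)) ⟩
        Σ[ elems ] (λ w → ΣV (allFin rank) (posRoot w) j p ⊝ ΣV (allFin rank) (λ i → act (gen j) (posRoot (gen j · w) i)) j p)
                                                 ≡⟨ Σ-cong elems (λ w → sym (Σ-⊝ (allFin rank) (λ i → posRoot w i j p) (λ i → act (gen j) (posRoot (gen j · w) i) j p))) ⟩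
        rootSum gap j p                          ∎
        where
          open ≡-Reasoning
          ⊝-solve : ∀ x y c → y ≡ x ⊝ c → c ≡ x ⊝ y
          ⊝-solve x y c refl = lem x c
            where
              lem : ∀ x c → c ≡ x ⊝ (x ⊝ c)
              lem = solve-∀
          lem₄ : ∀ a b c d → (a ⊝ b) ⊕ (c ⊝ d) ≡ (a ⊕ c) ⊝ (b ⊕ d)
          lem₄ = solve-∀
          Σ-⊝ : ∀ {A : Set} (xs : List A) (f g : A → ℤ) → Σ[ xs ] (λ x → f x ⊝ g x) ≡ Σ[ xs ] f ⊝ Σ[ xs ] g
          Σ-⊝ [] f g = refl
          Σ-⊝ (x ∷ xs) f g = trans (cong ((f x ⊝ g x) ⊕_) (Σ-⊝ xs f g)) (lem₄ (f x) (g x) (Σ[ xs ] f) (Σ[ xs ] g))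
          reflected : s j ρ j p ≡ rootSum (λ w i → act (gen j) (posRoot (gen j · w) i)) j p
          reflected = begin
            s j ρ j p            ≡⟨ sym (act-gen j ρ j p) ⟩
            act (gen j) ρ j p    ≡⟨ act-Σ (gen j) elems (λ w → ΣV (allFin rank) (posRoot w)) j p ⟩
            Σ[ elems ] (λ w → act (gen j) (ΣV (allFin rank) (posRoot w)) j p)
                                 ≡⟨ Σ-cong elems (λ w → act-Σ (gen j) (allFin rank) (posRoot w) j p) ⟩
            Σ[ elems ] (λ w → Σ[ allFin rank ] (λ i → act (gen j) (posRoot w i) j p))
                                 ≡⟨ elems-· (gen j) (λ w → ΣV (allFin rank) (λ i → act (gen j) (posRoot w i)) j p) ⟩
            rootSum (λ w i → act (gen j) (posRoot (gen j · w) i)) j p ∎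

      η-gen· : ∀ w i {b} → η (gen j) (gen i ^^ w) ≡ b → η (gen j · w) (gen i) ≡ η w (gen i) xor b
      η-gen· w i h = trans (η-· (gen j) w (gen i)) (cong (η w (gen i) xor_) h)

      gen-gen : ∀ w v → act (gen j) (act (gen j · w) v) ≈ act w v
      gen-gen w v k p = trans (sym (act-· (gen j) (gen j · w) v k p))
        (cong (λ z → act z v k p) (trans (sym (assoc _ _ _)) (trans (cong (_· w) (gen² j)) (idˡ w))))

      -- s_j permutes the positive roots other than the j-th simple one. The gap therefore vanishes
      -- unless the conjugate of `gen i` by w is `gen j`, and then it is the positive one of the two
      -- opposite roots belonging to (w , i).
      gap-nonneg : ∀ w i → Nonneg (gap w i)
      gap-nonneg w i k p = boolCases (η (gen j) (gen i ^^ w))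
          (λ h → boolCases (η w (gen i))
            (λ h′ → subst (0ℤ ≤ℤ_) (sym (begin
              posRoot w i k p ⊝ act (gen j) (posRoot (gen j · w) i) k p
                ≡⟨ cong₂ _⊝_ (posRoot-true h′ k p)
                     (trans (act-cong (gen j) (posRoot-false (trans (η-gen· w i h) (cong (_xor true) h′))) k p) (gen-gen w (E i ones) k p)) ⟩
              0ℤ ⊝ act w (E i ones) k p
                ≡⟨ cong (0ℤ ⊝_) (act-E-flip w i ones k p) ⟩
              0ℤ ⊝ (⊖ act (w · gen i) (E i ones) k p)
                ≡⟨ ⊝-⊖ _ ⟩
              act (w · gen i) (E i ones) k p ∎))
              (act-E-nonneg (w · gen i) i ones-nonneg (trans (η-flip (refl-gen i) w) (cong not h′)) k p))
            (λ h′ → subst (0ℤ ≤ℤ_) (sym (begin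
              posRoot w i k p ⊝ act (gen j) (posRoot (gen j · w) i) k p
                ≡⟨ cong₂ _⊝_ (posRoot-false h′ k p)
                     (trans (act-cong (gen j) (posRoot-true (trans (η-gen· w i h) (cong (_xor true) h′))) k p) (act-0 (gen j) k p)) ⟩
              act w (E i ones) k p ⊝ 0ℤ
                ≡⟨ ⊝-0 _ ⟩
              act w (E i ones) k p ∎))
              (act-E-nonneg w i ones-nonneg h′ k p)))
          (λ h → ℤ.≤-reflexive (sym (boolCases (η w (gen i))
            (λ h′ → cong₂ _⊝_ (posRoot-true h′ k p)
              (trans (act-cong (gen j) (posRoot-true (trans (η-gen· w i h) (cong (_xor false) h′))) k p) (act-0 (gen j) k p)))
            (λ h′ → trans (cong₂ _⊝_ (posRoot-false h′ k p)
              (trans (act-cong (gen j) (posRoot-false (trans (η-gen· w i h) (cong (_xor false) h′))) k p) (gen-gen w (E i ones) k p)))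
              (ℤ.+-inverseʳ (act w (E i ones) k p))))))
        where
          open ≡-Reasoning
          open ℤ-Identities₂ using (⊝-0; ⊝-⊖)

      -- The analogue of ρ pairing positively with each simple coroot: the pair (e , j) contributes
      -- `ones`, and all other gaps are nonnegative.
      C-ρ-≥ : ∀ p → ones p ≤ℤ C j ρ p
      C-ρ-≥ p = subst (ones p ≤ℤ_) (sym (C-ρ p)) (ℤ.≤-trans (ℤ.≤-trans (ℤ.≤-reflexive (sym leading))
          (Σ-term (λ i → gap e i j p) (λ i → gap-nonneg e i j p) (∈-allFin j)))
          (Σ-term (λ w → ΣV (allFin rank) (gap w) j p) (λ w → ΣV-nonneg (allFin rank) (gap w) (gap-nonneg w) j p) (elems-complete e)))
        where
          η-true : η (gen j · e) (gen j) ≡ true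
          η-true = trans (cong (λ z → η z (gen j)) (idʳ (gen j))) (η-gen-self j)
          leading : gap e j j p ≡ ones p
          leading = trans (cong₂ _⊝_ (trans (posRoot-false (η-e (gen j)) j p) (trans (act-e (E j ones) j p) (E-self j ones p)))
              (trans (act-cong (gen j) (posRoot-true η-true) j p) (act-0 (gen j) j p)))
            (ℤ-Identities₂.⊝-0 (ones p))

      ρ-≥ : ∀ p → ones p ≤ℤ ρ j p
      ρ-≥ p = ℤ.≤-trans (ℤ.≤-trans (ℤ.≤-reflexive (sym (trans (posRoot-false (η-e (gen j)) j p) (trans (act-e (E j ones) j p) (E-self j ones p)))))
          (Σ-term (λ i → posRoot e i j p) (λ i → posRoot-nonneg e i j p) (∈-allFin j)))
          (Σ-term (λ w → ΣV (allFin rank) (posRoot w) j p) (λ w → ΣV-nonneg (allFin rank) (posRoot w) (posRoot-nonneg w) j p) (elems-complete e))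

    ρ-nonneg : Nonneg ρ
    ρ-nonneg = ΣV-nonneg elems _ (λ w → ΣV-nonneg (allFin rank) (posRoot w) (posRoot-nonneg w))

    ρ-support : Supported ρ
    ρ-support = ΣV-support elems _ (λ w → ΣV-support (allFin rank) (posRoot w) (posRoot-support w))

    C-ρ-nonneg : ∀ k p → 0ℤ ≤ℤ C k ρ p
    C-ρ-nonneg k p = ℤ.≤-trans (ones-nonneg p) (C-ρ-≥ k p)

    cartan-off-neg : ∀ {i j} → i ≢ j → ∀ {a} → (∀ p → 0ℤ ≤ℤ a p) → ∀ p → cartan i j a p ≤ℤ 0ℤ
    cartan-off-neg {i} {j} ne {a} h p = subst (_≤ℤ 0ℤ) (sym (cartan-off ne a p)) (ℤ.neg-mono-≤ (Path.Q-nonneg (m i j ∸ 2) h p))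

    sumF-nonpos : ∀ {n} (f : Fin n → ℤ) → (∀ i → f i ≤ℤ 0ℤ) → sumF f ≤ℤ 0ℤ
    sumF-nonpos {zero}  f h = ℤ.≤-refl
    sumF-nonpos {suc n} f h = ℤ.+-mono-≤ {_} {0ℤ} {_} {0ℤ} (h zero) (sumF-nonpos (f ∘ suc) (h ∘ suc))

    -- At a zero of v the diagonal term is absent, and the remaining Cartan entries are nonpositive
    -- operators.
    C-nonpos : ∀ {v} k p → Nonneg v → v k p ≡ 0ℤ → C k v p ≤ℤ 0ℤ
    C-nonpos {v} k p h z = subst (_≤ℤ 0ℤ) (sym (C≡ k v p)) (sumF-nonpos _ λ i → cases i (k Fin.≟ i))
      where
        cases : ∀ i → Dec (k ≡ i) → cartan k i (v i) p ≤ℤ 0ℤ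
        cases i (no ne) = cartan-off-neg ne (h i) p
        cases i (yes refl) = ℤ.≤-reflexive (trans (cartan-self k (v k) p) (cong₂ _⊕_ z z))

    -- ρ > 0 and C ρ > 0 make C an M-matrix: at a minimum of u / ρ the vector ρ u - u ρ would violate C u ≥ 0.
    monotone : ∀ L {u} → Supported u → (∀ {k} → k ∉ L → ∀ p → u k p ≡ 0ℤ) → (∀ {k} → k ∈ L → ∀ p → 0ℤ ≤ℤ C k u p) → Nonneg u
    monotone L {u} sup off hC = main indices refl
      where
        indices : List (Fin rank × ℕ)
        indices = cartesianProduct (allFin rank) (upTo N)
        value : V → Fin rank × ℕ → ℤ
        value v (k , p) = v k p
        main : ∀ xs → xs ≡ indices → Nonneg u
        main [] eq k p = cases (ℕ.<-≤-connex p N)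
          where
            cases : p < N ⊎ N ≤ p → 0ℤ ≤ℤ u k p
            cases (inj₁ p<N) = case subst ((k , p) ∈_) (sym eq) (∈-cartesianProduct⁺ (∈-allFin k) (∈-upTo⁺ p<N)) of λ ()
            cases (inj₂ N≤p) = ℤ.≤-reflexive (sym (sup k p N≤p))
        main (x ∷ xs) eq k p = cases (ℤ.≤-total 0ℤ (u j q))
          where
            positive-ρ : ∀ {y} → y ∈ x ∷ xs → 0ℤ <ℤ value ρ y
            positive-ρ {k , p} y∈ = ℤ.<-≤-trans (subst (0ℤ <ℤ_) (sym (ones-< (∈-upTo⁻ (proj₂ (∈-cartesianProduct⁻ (allFin rank) (upTo N) (subst ((k , p) ∈_) eq y∈)))))) (ℤ.+<+ (s≤s z≤n))) (ρ-≥ k p)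
            least = minRatio (value u) (value ρ) x xs positive-ρ
            j = proj₁ (proj₁ least)
            q = proj₂ (proj₁ least)
            ρ>0 : 0ℤ <ℤ ρ j q
            ρ>0 = positive-ρ (proj₁ (proj₂ least))
            q<N : q < N
            q<N = ∈-upTo⁻ (proj₂ (∈-cartesianProduct⁻ (allFin rank) (upTo N) (subst ((j , q) ∈_) eq (proj₁ (proj₂ least)))))
            min : ∀ k p → p < N → u j q ⊛ ρ k p ≤ℤ u k p ⊛ ρ j q
            min k p p<N = proj₂ (proj₂ least) (subst ((k , p) ∈_) (sym eq) (∈-cartesianProduct⁺ (∈-allFin k) (∈-upTo⁺ p<N)))
            y : V
            y = comb (ρ j q) (⊖ u j q) u ρ
            lem : ∀ a b c d → c ⊛ b ⊝ d ⊛ a ≡ b ⊛ c ⊕ (⊖ d) ⊛ a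
            lem = solve-∀
            vanish : ∀ a b → a ⊛ b ⊕ (⊖ b) ⊛ a ≡ 0ℤ
            vanish = solve-∀
            cases : 0ℤ ≤ℤ u j q ⊎ u j q ≤ℤ 0ℤ → 0ℤ ≤ℤ u k p
            cases (inj₁ h) = by (ℕ.<-≤-connex p N)
              where
                by : p < N ⊎ N ≤ p → 0ℤ ≤ℤ u k p
                by (inj₂ N≤p) = ℤ.≤-reflexive (sym (sup k p N≤p))
                by (inj₁ p<N) = ℤ.*-cancelʳ-≤-pos 0ℤ (u k p) (ρ j q) {{positive ρ>0}}
                  (ℤ.≤-trans (×-nonneg h (ρ-nonneg k p)) (min k p p<N))
            cases (inj₂ h) = by (j ∈? L) (ℤ.≤-total 0ℤ (u j q))
              where
                ⊖u≥0 : 0ℤ ≤ℤ ⊖ u j q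
                ⊖u≥0 = ≤-neg h
                y-nonneg : Nonneg y
                y-nonneg k p = at (ℕ.<-≤-connex p N)
                  where
                    at : p < N ⊎ N ≤ p → 0ℤ ≤ℤ y k p
                    at (inj₁ p<N) = subst (0ℤ ≤ℤ_) (lem (ρ k p) (ρ j q) (u k p) (u j q)) (ℤ.i≤j⇒0≤j-i (min k p p<N))
                    at (inj₂ N≤p) = ⊕-nonneg (ℤ.≤-reflexive (sym (trans (cong (ρ j q ⊛_) (sup k p N≤p)) (ℤ.*-zeroʳ (ρ j q)))))
                      (×-nonneg ⊖u≥0 (ρ-nonneg k p))
                Cy≤0 : C j y q ≤ℤ 0ℤ
                Cy≤0 = C-nonpos j q y-nonneg (vanish (ρ j q) (u j q))
                nonneg-if : 0ℤ ≤ℤ u j q → 0ℤ ≤ℤ u k p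
                nonneg-if h′ = cases (inj₁ h′)
                by : Dec (j ∈ L) → 0ℤ ≤ℤ u j q ⊎ u j q ≤ℤ 0ℤ → 0ℤ ≤ℤ u k p
                by _ (inj₁ h′) = nonneg-if h′
                by (no j∉L) _ = nonneg-if (ℤ.≤-reflexive (sym (off j∉L q)))
                by (yes j∈L) _ = nonneg-if (subst (0ℤ ≤ℤ_) (ℤ.neg-involutive (u j q)) (≤-neg ⊖u≤0))
                  where
                    ⊖u≤Cy : ⊖ u j q ≤ℤ C j y q
                    ⊖u≤Cy = begin
                      ⊖ u j q                                        ≡⟨ sym (ℤ.*-identityʳ (⊖ u j q)) ⟩
                      (⊖ u j q) ⊛ 1ℤ                                 ≡⟨ cong ((⊖ u j q) ⊛_) (sym (ones-< q<N)) ⟩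
                      (⊖ u j q) ⊛ ones q                             ≤⟨ ℤ.*-monoˡ-≤-nonNeg (⊖ u j q) {{nonNegative ⊖u≥0}} (C-ρ-≥ j q) ⟩
                      (⊖ u j q) ⊛ C j ρ q                            ≡⟨ sym (ℤ.+-identityˡ _) ⟩
                      0ℤ ⊕ (⊖ u j q) ⊛ C j ρ q                       ≤⟨ ℤ.+-monoˡ-≤ ((⊖ u j q) ⊛ C j ρ q) (×-nonneg (ℤ.<⇒≤ ρ>0) (hC j∈L q)) ⟩
                      ρ j q ⊛ C j u q ⊕ (⊖ u j q) ⊛ C j ρ q          ≡⟨ sym (C-linear j (ρ j q) (⊖ u j q) u ρ q) ⟩
                      C j y q                                        ∎
                      where open ℤ.≤-Reasoning
                    ⊖u≤0 : ⊖ u j q ≤ℤ 0ℤ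
                    ⊖u≤0 = ℤ.≤-trans ⊖u≤Cy Cy≤0

  -- Integer solutions of homogeneous linear systems

  module HomogeneousSystem where
    Row : ℕ → Set
    Row n = Fin n → ℤ

    dot : ∀ {n} → Row n → Row n → ℤ
    dot r x = sumF (λ i → r i ⊛ x i)

    private
      comm₃ : ∀ a b c → a ⊛ (b ⊛ c) ≡ b ⊛ (a ⊛ c) ⊕ 0ℤ ⊛ 0ℤ
      comm₃ = solve-∀
      pivot₁ : ∀ a b → a ⊛ b ⊕ (⊖ a) ⊛ b ≡ 0ℤ
      pivot₁ = solve-∀
      pivot₂ : ∀ q a b c → q ⊛ (⊖ b) ⊕ (a ⊛ c ⊕ 0ℤ ⊛ 0ℤ) ≡ a ⊛ c ⊕ (⊖ q) ⊛ b
      pivot₂ = solve-∀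
      elimLem : ∀ a q r b x → (a ⊛ q ⊝ b ⊛ r) ⊛ x ≡ a ⊛ (q ⊛ x) ⊕ (⊖ b) ⊛ (r ⊛ x)
      elimLem = solve-∀

    scale : ∀ {n} c (f : Fin n → ℤ) → sumF (λ i → c ⊛ f i ⊕ 0ℤ ⊛ 0ℤ) ≡ c ⊛ sumF f ⊕ 0ℤ ⊛ 0ℤ
    scale {n} c f = trans (sumF-linear c 0ℤ f (λ _ → 0ℤ)) (cong (λ z → c ⊛ sumF f ⊕ 0ℤ ⊛ z) (sumF-zero {n} (λ _ → 0ℤ) (λ _ → refl)))

    module Elimination {n} (r : Row (suc (suc n))) where
      -- Elimination without division: rows are cross-multiplied with the pivot `r zero`, and
      -- `extend` multiplies the remaining unknowns by the same pivot so that the first one is an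
      -- integer as well.
      elim : Row (suc (suc n)) → Row (suc n)
      elim q i = r zero ⊛ q (suc i) ⊝ q zero ⊛ r (suc i)

      tail : Row (suc (suc n)) → Row (suc n) → ℤ
      tail q x = sumF (λ i → q (suc i) ⊛ x i)

      extend : Row (suc n) → Row (suc (suc n))
      extend x zero    = ⊖ tail r x
      extend x (suc i) = r zero ⊛ x i

      dot-extend : ∀ q x → dot q (extend x) ≡ r zero ⊛ tail q x ⊕ (⊖ q zero) ⊛ tail r x
      dot-extend q x = trans (cong (q zero ⊛ (⊖ tail r x) ⊕_)
          (trans (sumF-cong (λ i → comm₃ (q (suc i)) (r zero) (x i))) (scale (r zero) (λ i → q (suc i) ⊛ x i))))
        (pivot₂ (q zero) (r zero) (tail r x) (tail q x))

      pivot : ∀ x → dot r (extend x) ≡ 0ℤ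
      pivot x = trans (dot-extend r x) (pivot₁ (r zero) (tail r x))

      eliminated : ∀ q x → dot (elim q) x ≡ 0ℤ → dot q (extend x) ≡ 0ℤ
      eliminated q x h = trans (dot-extend q x) (trans (sym (trans
        (sumF-cong (λ i → elimLem (r zero) (q (suc i)) (r (suc i)) (q zero) (x i)))
        (sumF-linear (r zero) (⊖ q zero) (λ i → q (suc i) ⊛ x i) (λ i → r (suc i) ⊛ x i)))) h)

    -- Without a nonzero entry in the first column the first unit vector is a solution; otherwise a
    -- pivot row uses up one equation and one unknown.
    nontrivial : ∀ n (rows : List (Row (suc n))) → length rows ≤ n →
      ∃ λ x → (∃ λ i → x i ≢ 0ℤ) × (∀ {r} → r ∈ rows → dot r x ≡ 0ℤ)
    nontrivial n rows len with any? (λ r → ¬? (r zero ℤ.≟ 0ℤ)) rows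
    nontrivial n rows len | no none = δ , (zero , λ ()) , killed
      where
        δ : Row (suc n)
        δ zero = 1ℤ
        δ (suc _) = 0ℤ
        r₀≡0 : ∀ {r} → r ∈ rows → r zero ≡ 0ℤ
        r₀≡0 {r} r∈ = cases (r zero ℤ.≟ 0ℤ)
          where
            cases : Dec (r zero ≡ 0ℤ) → r zero ≡ 0ℤ
            cases (yes p) = p
            cases (no p) = contradiction (lose r∈ p) none
        killed : ∀ {r} → r ∈ rows → dot r δ ≡ 0ℤ
        killed {r} r∈ = cong₂ _⊕_ (cong (_⊛ 1ℤ) (r₀≡0 r∈)) (sumF-zero (λ i → r (suc i) ⊛ 0ℤ) (λ i → ℤ.*-zeroʳ (r (suc i))))
    nontrivial zero rows len | yes some with find some
    nontrivial zero (_ ∷ _) () | yes some | _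
    nontrivial (suc n) rows len | yes some with find some
    ... | r , r∈ , r₀≢0 with ∈-∃++ r∈
    ...   | as , bs , refl with nontrivial n (map (Elimination.elim r) (as ++ bs))
                                 (subst (_≤ n) (sym (List.length-map (Elimination.elim r) (as ++ bs))) (ℕ.≤-pred (subst (_≤ suc n) (length-remove as) len)))
    ...     | x , (i , xᵢ≢0) , killed = extend x , (suc i , r₀xᵢ≢0) , killed′
      where
        open Elimination r
        r₀xᵢ≢0 : r zero ⊛ x i ≢ 0ℤ
        r₀xᵢ≢0 h with ℤ.i*j≡0⇒i≡0∨j≡0 (r zero) h
        ... | inj₁ p = r₀≢0 p
        ... | inj₂ p = xᵢ≢0 p
        rest : ∀ {q} → q ∈ as ++ bs → dot q (extend x) ≡ 0ℤ
        rest {q} q∈ = eliminated q x (killed (∈-map⁺ elim q∈))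
        killed′ : ∀ {q} → q ∈ as ++ r ∷ bs → dot q (extend x) ≡ 0ℤ
        killed′ q∈ with ∈-++⁻ as q∈
        ... | inj₁ p = rest (∈-++⁺ˡ p)
        ... | inj₂ (here refl) = pivot x
        ... | inj₂ (there p) = rest (∈-++⁺ʳ as p)

  open HomogeneousSystem

  length-cartesianProductWith : ∀ {A B C : Set} (f : A → B → C) xs ys →
    length (cartesianProductWith f xs ys) ≡ length xs * length ys
  length-cartesianProductWith f [] ys = refl
  length-cartesianProductWith f (x ∷ xs) ys = trans (List.length-++ (map (f x) ys))
    (cong₂ _+_ (List.length-map (f x) ys) (length-cartesianProductWith f xs ys))

  lookup-injective : ∀ {A : Set} {xs : List A} → Unique xs → ∀ {i j} → List.lookup xs i ≡ List.lookup xs j → i ≡ j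
  lookup-injective (p ∷ u) {zero} {zero} h = refl
  lookup-injective (p ∷ u) {zero} {suc j} h = contradiction h (All.lookup p (∈-lookup j))
  lookup-injective (p ∷ u) {suc i} {zero} h = contradiction (sym h) (All.lookup p (∈-lookup i))
  lookup-injective (p ∷ u) {suc i} {suc j} h = cong suc (lookup-injective u h)

  -- Reflection factorisations of products of distinct simple reflections

  module ParabolicSpan (G : FiniteCoxeterSystem)
    (ℓ : Cox.W G → ℕ) (isℓ : Cox.IsCoxeterLength G ℓ) where
    open Cox G
    open SimpleSystems G
    open CoxeterLength G ℓ isℓ
    open Representation G
    open Positivity G ℓ isℓ
    open Cone G ℓ isℓ
    open import Data.List.Membership.DecPropositional (Fin._≟_ {rank}) using (_∈?_)

    C-neg : ∀ i v p → C i (neg v) p ≡ ⊖ C i v p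
    C-neg i v p = trans (C-cong i (λ k q → sym (ℤ-Identities₂.as-neg (v k q))) p)
      (trans (C-linear i (⊖ 1ℤ) 0ℤ v v p) (ℤ-Identities₂.as-neg (C i v p)))

    -- Monotonicity for u and for its negative: the part of the Cartan operator that belongs to L is
    -- injective.
    fixed-zero : ∀ L {u} → Supported u → (∀ {k} → k ∉ L → ∀ p → u k p ≡ 0ℤ) → (∀ {k} → k ∈ L → ∀ p → C k u p ≡ 0ℤ) → u ≈ 0V
    fixed-zero L {u} sup off hC k p = ℤ.≤-antisym
      (subst (_≤ℤ 0ℤ) (ℤ.neg-involutive (u k p)) (ℤ.neg-mono-≤
        (monotone L {neg u} (λ k p h → cong ⊖_ (sup k p h)) (λ h p → cong ⊖_ (off h p))
          (λ {k} h p → ℤ.≤-reflexive (sym (trans (C-neg k u p) (cong ⊖_ (hC h p))))) k p)))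
      (monotone L sup off (λ h p → ℤ.≤-reflexive (sym (hC h p))) k p)

    -- The letters of L act on different coordinates, so a vector fixed by their product is fixed by each of them.
    fixed-letters : ∀ L → Unique L → ∀ v → act (word L) v ≈ v → ∀ {k} → k ∈ L → ∀ p → C k v p ≡ 0ℤ
    fixed-letters (i ∷ L) (i∉ ∷ U) v h = letter
      where
        v′ : V
        v′ = act (word L) v
        s-v′ : s i v′ ≈ v
        s-v′ k p = trans (sym (act-gen i v′ k p)) (trans (sym (act-· (gen i) (word L) v k p)) (h k p))
        v′≈v : v′ ≈ v
        v′≈v k p = cases (k Fin.≟ i)
          where
            cases : Dec (k ≡ i) → v′ k p ≡ v k p
            cases (yes refl) = act-word-other L (λ q → All.lookup i∉ q refl) v p
            cases (no ne) = trans (sym (s-other ne v′ p)) (s-v′ k p)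
        solve : ∀ x c → x ⊝ c ≡ x → c ≡ 0ℤ
        solve x c h = trans (lem x c) (trans (cong (x ⊝_) h) (ℤ.+-inverseʳ x))
          where
            lem : ∀ x c → c ≡ x ⊝ (x ⊝ c)
            lem = solve-∀
        letter : ∀ {k} → k ∈ i ∷ L → ∀ p → C k v p ≡ 0ℤ
        letter (here refl) p = trans (C-cong i (≈-sym v′≈v) p)
          (solve (v′ i p) (C i v′ p) (trans (sym (s-self i v′ p)) (trans (s-v′ i p) (sym (v′≈v i p)))))
        letter (there k∈) p = fixed-letters L U v v′≈v k∈ p

    C-zero⇒s-fixed : ∀ i {v} → (∀ p → C i v p ≡ 0ℤ) → s i v ≈ v
    C-zero⇒s-fixed i {v} h k p = trans (cong (v k p ⊝_) (E-elim (_≡ 0ℤ) i (C i v) k p (λ _ → h p) (λ _ → refl)))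
      (ℤ-Identities₂.⊝-0 (v k p))

    -- Passing from w to w′ = w s_j at a descent changes u - w u by w′ (E j (C j u)), which is
    -- nonnegative because w′ sends the j-th simple root to a positive one.
    below : ∀ f w {u} → (∀ k p → 0ℤ ≤ℤ C k u p) → ℓ w ≤ f → Nonneg (sub u (act w u))

    module _ (w : W) (j : Fin rank) (hj : η w (gen j) ≡ true) {u : V} (dom : ∀ k p → 0ℤ ≤ℤ C k u p) where
      w′ : W
      w′ = w · gen j

      drop : V
      drop = act w′ (E j (C j u))

      drop-nonneg : Nonneg drop
      drop-nonneg = act-E-nonneg w′ j (dom j) (trans (η-flip (refl-gen j) w) (cong not hj))

      drop-split : sub u (act w u) ≈ sub u (act w′ u) ⊞ drop
      drop-split k p = trans (cong (u k p ⊝_) (trans (act-gen-flip w j u k p) (act-sub w′ u (E j (C j u)) k p)))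
        (lem (u k p) (act w′ u k p) (drop k p))
        where
          lem : ∀ x y z → x ⊝ (y ⊝ z) ≡ (x ⊝ y) ⊕ z
          lem = solve-∀

    below f w {u} dom l k p = cases f l (w ≟ e)
      where
        cases : ∀ f → ℓ w ≤ f → Dec (w ≡ e) → 0ℤ ≤ℤ sub u (act w u) k p
        cases _ _ (yes refl) = ℤ.≤-reflexive (sym (trans (cong (u k p ⊝_) (act-e u k p)) (ℤ.+-inverseʳ (u k p))))
        cases f l (no ne) with descent w ne
        cases zero l (no ne) | j , hj = contradiction (ℕ.<-≤-trans (ℓ-descent (refl-gen j) hj) l) λ ()
        cases (suc f) l (no ne) | j , hj = subst (0ℤ ≤ℤ_) (sym (drop-split w j hj dom k p))
          (⊕-nonneg (below f (w · gen j) dom (ℕ.≤-pred (ℕ.≤-trans (ℓ-descent (refl-gen j) hj) l)) k p) (drop-nonneg w j hj dom k p))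

    act-zero : ∀ w {v} → act w v ≈ 0V → v ≈ 0V
    act-zero w {v} h k p = trans (sym (act-inv w v k p)) (trans (act-cong (w ⁻¹) h k p) (act-0 (w ⁻¹) k p))

    -- If w fixes u, both nonnegative summands of `drop-split` vanish. A vanishing `drop` forces C j
    -- u = 0, so the descent j belongs to L, and the shorter element fixes u again.
    stabiliser : ∀ L {u} → (∀ k p → 0ℤ ≤ℤ C k u p) → (∀ {k} → k ∉ L → ∃ λ p → C k u p ≢ 0ℤ) →
      ∀ f w → ℓ w ≤ f → act w u ≈ u → ⟨ map gen L ⟩ w
    stabiliser L {u} dom strict f w l fix = cases f l (w ≟ e)
      where
        cases : ∀ f → ℓ w ≤ f → Dec (w ≡ e) → ⟨ map gen L ⟩ w
        cases _ _ (yes refl) = ⟨⟩-e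
        cases f l (no ne) with descent w ne
        cases zero l (no ne) | j , hj = contradiction (ℕ.<-≤-trans (ℓ-descent (refl-gen j) hj) l) λ ()
        cases (suc f) l (no ne) | j , hj = by (j ∈? L)
          where
            l′ : ℓ (w · gen j) ≤ f
            l′ = ℕ.≤-pred (ℕ.≤-trans (ℓ-descent (refl-gen j) hj) l)
            total : ∀ k p → sub u (act (w · gen j) u) k p ⊕ drop w j hj dom k p ≡ 0ℤ
            total k p = trans (sym (drop-split w j hj dom k p)) (trans (cong (u k p ⊝_) (fix k p)) (ℤ.+-inverseʳ (u k p)))
            by : Dec (j ∈ L) → ⟨ map gen L ⟩ w
            by (yes j∈) = subst ⟨ map gen L ⟩ (·-refl² (refl-gen j) w) (⟨⟩-· (stabiliser L dom strict f (w · gen j) l′ fix′) (⟨⟩-∈ (∈-map⁺ gen j∈)))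
              where
                fix′ : act (w · gen j) u ≈ u
                fix′ k p = sym (ℤ-Identities₂.⊝-cancel (u k p) (act (w · gen j) u k p)
                  (sum-zero (below f (w · gen j) dom l′ k p) (drop-nonneg w j hj dom k p) (total k p)))
            by (no j∉) with strict j∉
            ... | p , C≢0 = contradiction (trans (sym (E-self j (C j u) p)) (act-zero (w · gen j) drop≈0 j p)) C≢0
              where
                drop≈0 : drop w j hj dom ≈ 0V
                drop≈0 k p = sum-zero (drop-nonneg w j hj dom k p) (below f (w · gen j) dom l′ k p)
                  (trans (ℤ.+-comm (drop w j hj dom k p) _) (total k p))

    0<N : 0 < N
    0<N = ℕ.>-nonZero⁻¹ N {{N-nonZero}}

    record LinearForm : Set where
      field
        form : V → ℤ
        form-cong : ∀ {v w} → v ≈ w → form v ≡ form w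
        form-linear : ∀ c d v w → form (comb c d v w) ≡ c ⊛ form v ⊕ d ⊛ form w
    open LinearForm

    combination : ∀ {n} → (Fin n → ℤ) → (Fin n → V) → V
    combination x vs k p = sumF (λ i → x i ⊛ vs i k p)

    form-combination : ∀ f {n} (x : Fin n → ℤ) vs → form f (combination x vs) ≡ sumF (λ i → x i ⊛ form f (vs i))
    form-combination f {zero} x vs = form-linear f 0ℤ 0ℤ 0V 0V
    form-combination f {suc n} x vs = trans
      (form-cong f (λ k p → sym (lem (x zero ⊛ vs zero k p) (combination (x ∘ suc) (vs ∘ suc) k p) (x zero) (vs zero k p) refl)))
      (trans (form-linear f (x zero) 1ℤ (vs zero) (combination (x ∘ suc) (vs ∘ suc)))
        (cong (x zero ⊛ form f (vs zero) ⊕_) (trans (ℤ.*-identityˡ _) (form-combination f (x ∘ suc) (vs ∘ suc)))))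
      where
        lem : ∀ z b a v → z ≡ a ⊛ v → a ⊛ v ⊕ 1ℤ ⊛ b ≡ z ⊕ b
        lem z b a v refl = cong (a ⊛ v ⊕_) (ℤ.*-identityˡ b)

    -- A vector is fixed by w s_i w⁻¹ as soon as these forms vanish on it. On vectors supported
    -- below N the positions p < N suffice, so a reflection costs N integer equations.
    reflectionForm : W × Fin rank → ℕ → LinearForm
    reflectionForm (w , i) p = record
      { form = λ v → C i (act (w ⁻¹) v) p
      ; form-cong = λ h → C-cong i (act-cong (w ⁻¹) h) p
      ; form-linear = λ c d v v′ → trans (C-cong i (act-linear (w ⁻¹) c d v v′) p) (C-linear i c d (act (w ⁻¹) v) (act (w ⁻¹) v′) p)
      }

    reflection-fixes : ∀ {t u} ((w , i , _) : IsReflection t) → (∀ p → C i (act (w ⁻¹) u) p ≡ 0ℤ) → act t u ≈ u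
    reflection-fixes {t} {u} (w , i , refl) h k p = begin
      act ((w · gen i) · (w ⁻¹)) u k p         ≡⟨ act-· (w · gen i) (w ⁻¹) u k p ⟩
      act (w · gen i) (act (w ⁻¹) u) k p       ≡⟨ act-·gen w i (act (w ⁻¹) u) k p ⟩
      act w (s i (act (w ⁻¹) u)) k p           ≡⟨ act-cong w (C-zero⇒s-fixed i h) k p ⟩
      act w (act (w ⁻¹) u) k p                 ≡⟨ sym (act-· w (w ⁻¹) u k p) ⟩
      act (w · (w ⁻¹)) u k p                   ≡⟨ cong (λ z → act z u k p) (invʳ w) ⟩
      act e u k p                              ≡⟨ act-e u k p ⟩
      u k p                                    ∎
      where open ≡-Reasoning

    prod-fixes : ∀ {u} ts → (∀ {t} → t ∈ ts → act t u ≈ u) → act (prodW ts) u ≈ u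
    prod-fixes {u} [] h = act-e u
    prod-fixes {u} (t ∷ ts) h k p = trans (act-· t (prodW ts) u k p)
      (trans (act-cong t (prod-fixes ts (h ∘ there)) k p) (h (here refl) k p))

    opaque
      δ : ℕ → Seq
      δ q p with p ℕ.≟ q
      ... | yes _ = 1ℤ
      ... | no _  = 0ℤ

      δ-self : ∀ q → δ q q ≡ 1ℤ
      δ-self q with q ℕ.≟ q
      ... | yes _ = refl
      ... | no ne = contradiction refl ne

      δ-other : ∀ {q p} → p ≢ q → δ q p ≡ 0ℤ
      δ-other {q} {p} ne with p ℕ.≟ q
      ... | yes h = contradiction h ne
      ... | no _  = refl

    -- Here -b ≥ 0 by monotonicity, which makes C b ≥ 0 off L; the strict positivity off L then comes from ρ.
    module Dominant (L : List (Fin rank)) {c : ℤ} (c>0 : 0ℤ <ℤ c) {b : V} (b-sup : Supported b)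
      (b-off : ∀ {k} → k ∉ L → ∀ p → b k p ≡ 0ℤ) (zero-on-L : ∀ {k} → k ∈ L → ∀ p → C k (comb c 1ℤ ρ b) p ≡ 0ℤ) where

      u : V
      u = comb c 1ℤ ρ b

      c≥0 : 0ℤ ≤ℤ c
      c≥0 = ℤ.<⇒≤ c>0

      C-u : ∀ k p → C k u p ≡ c ⊛ C k ρ p ⊕ C k b p
      C-u k p = trans (C-linear k c 1ℤ ρ b p) (cong (c ⊛ C k ρ p ⊕_) (ℤ.*-identityˡ _))

      neg-b-nonneg : Nonneg (neg b)
      neg-b-nonneg = monotone L (λ k p h → cong ⊖_ (b-sup k p h)) (λ h p → cong ⊖_ (b-off h p))
        (λ {k} h p → subst (0ℤ ≤ℤ_) (sym (trans (C-neg k b p) (solve (c ⊛ C k ρ p) (C k b p) (trans (sym (C-u k p)) (zero-on-L h p)))))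
          (×-nonneg c≥0 (C-ρ-nonneg k p)))
        where
          solve : ∀ x y → x ⊕ y ≡ 0ℤ → ⊖ y ≡ x
          solve x y h = trans (lem x y) (trans (cong (_⊕ x) (cong ⊖_ h)) (ℤ.+-identityˡ x))
            where
              lem : ∀ x y → ⊖ y ≡ ⊖ (x ⊕ y) ⊕ x
              lem = solve-∀

      C-b-nonneg : ∀ {k} → k ∉ L → ∀ p → 0ℤ ≤ℤ C k b p
      C-b-nonneg {k} h p = subst (0ℤ ≤ℤ_) (trans (cong ⊖_ (C-neg k b p)) (ℤ.neg-involutive (C k b p)))
        (ℤ.neg-mono-≤ (C-nonpos k p neg-b-nonneg (cong ⊖_ (b-off h p))))

      lower : ∀ {k} → k ∉ L → ∀ p → c ⊛ C k ρ p ≤ℤ C k u p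
      lower {k} h p = subst₂ _≤ℤ_ (ℤ.+-identityʳ _) (sym (C-u k p)) (ℤ.+-monoʳ-≤ (c ⊛ C k ρ p) (C-b-nonneg h p))

      dominant : ∀ k p → 0ℤ ≤ℤ C k u p
      dominant k p = cases (k ∈? L)
        where
          cases : Dec (k ∈ L) → 0ℤ ≤ℤ C k u p
          cases (yes h) = ℤ.≤-reflexive (sym (zero-on-L h p))
          cases (no h) = ℤ.≤-trans (×-nonneg c≥0 (C-ρ-nonneg k p)) (lower h p)

      strict : ∀ {k} → k ∉ L → ∃ λ p → C k u p ≢ 0ℤ
      strict {k} h = 0 , λ z → ℤ.<-irrefl refl (subst (0ℤ <ℤ_) z (ℤ.<-≤-trans c>0
        (ℤ.≤-trans (subst (_≤ℤ c ⊛ C k ρ 0) (ℤ.*-identityʳ c) (ℤ.*-monoˡ-≤-nonNeg c {{nonNegative c≥0}}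
          (subst (_≤ℤ C k ρ 0) (ones-< 0<N) (C-ρ-≥ k 0)))) (lower h 0))))

      stabiliser-⟨⟩ : ∀ {t} → act t u ≈ u → ⟨ map gen L ⟩ t
      stabiliser-⟨⟩ {t} h = stabiliser L dominant strict (ℓ t) t ℕ.≤-refl h

    module _ (L : List (Fin rank)) (U : Unique L) where
      M : ℕ
      M = length L * N

      column : Fin M → Fin rank
      column i = List.lookup L (proj₁ (remQuot {length L} N i))

      position : Fin M → ℕ
      position i = toℕ (proj₂ (remQuot {length L} N i))

      unit : Fin M → V
      unit i = E (column i) (δ (position i))

      -- The unknowns are the coefficient of `ρ` and N coefficients for each letter of L, which
      -- makes M + 1. Since k reflections impose k N equations, a nontrivial solution exists for k ≤
      -- length L, and for k < length L one more equation may be added.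
      vectors : Fin (suc M) → V
      vectors zero    = ρ
      vectors (suc i) = unit i

      index-injective : ∀ {i j} → column i ≡ column j → position i ≡ position j → i ≡ j
      index-injective {i} {j} h h′ = trans (sym (Fin.combine-remQuot {length L} N i))
        (trans (cong₂ combine (lookup-injective U h) (Fin.toℕ-injective h′)) (Fin.combine-remQuot {length L} N j))

      unit-at : ∀ i j → i ≢ j → unit i (column j) (position j) ≡ 0ℤ
      unit-at i j ne = E-elim (_≡ 0ℤ) (column i) (δ (position i)) (column j) (position j)
        (λ h → δ-other (λ h′ → ne (index-injective (sym h) (sym h′)))) (λ _ → refl)

      unit-self : ∀ i → unit i (column i) (position i) ≡ 1ℤ
      unit-self i = trans (E-self (column i) (δ (position i)) (position i)) (δ-self (position i))

      units-independent : ∀ x → combination x unit ≈ 0V → ∀ i → x i ≡ 0ℤ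
      units-independent x h i = begin
        x i                                           ≡⟨ sym (ℤ.*-identityʳ (x i)) ⟩
        x i ⊛ 1ℤ                                      ≡⟨ cong (x i ⊛_) (sym (unit-self i)) ⟩
        x i ⊛ unit i (column i) (position i)          ≡⟨ sym (sumF-single (λ j → x j ⊛ unit j (column i) (position i)) i
                                                           (λ j ne → trans (cong (x j ⊛_) (unit-at j i ne)) (ℤ.*-zeroʳ (x j)))) ⟩
        combination x unit (column i) (position i)    ≡⟨ h (column i) (position i) ⟩
        0ℤ                                            ∎
        where open ≡-Reasoning

      combination-zero : ∀ (x : Fin M → ℤ) {k p} → (∀ i → unit i k p ≡ 0ℤ) → combination x unit k p ≡ 0ℤ
      combination-zero x {k} {p} h = sumF-zero (λ i → x i ⊛ unit i k p) (λ i → trans (cong (x i ⊛_) (h i)) (ℤ.*-zeroʳ (x i)))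

      units-off : ∀ x {k} → k ∉ L → ∀ p → combination x unit k p ≡ 0ℤ
      units-off x {k} h p = combination-zero x (λ i → E-other (λ { refl → h (∈-lookup (proj₁ (remQuot {length L} N i))) }) (δ (position i)) p)

      units-support : ∀ x → Supported (combination x unit)
      units-support x k p N≤p = combination-zero x (λ i → E-support (column i)
        (λ q N≤q → δ-other λ { refl → ℕ.<⇒≱ (Fin.toℕ<n (proj₂ (remQuot {length L} N i))) N≤q }) k p N≤p)

      witnesses : ∀ {ts} → All IsReflection ts → List (W × Fin rank)
      witnesses [] = []
      witnesses ((w , i , _) ∷ R) = (w , i) ∷ witnesses R

      length-witnesses : ∀ {ts} (R : All IsReflection ts) → length (witnesses R) ≡ length ts
      length-witnesses [] = refl
      length-witnesses (_ ∷ R) = cong suc (length-witnesses R)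

      rowOf : LinearForm → Row (suc M)
      rowOf f i = LinearForm.form f (vectors i)

      rows : ∀ {ts} → All IsReflection ts → List (Row (suc M))
      rows R = map rowOf (cartesianProductWith reflectionForm (witnesses R) (upTo N))

      length-rows : ∀ {ts} (R : All IsReflection ts) → length (rows R) ≡ length ts * N
      length-rows R = trans (List.length-map rowOf (cartesianProductWith reflectionForm (witnesses R) (upTo N)))
        (trans (length-cartesianProductWith reflectionForm (witnesses R) (upTo N)) (cong₂ _*_ (length-witnesses R) (List.length-upTo N)))

      module Solution {ts : List W} (R : All IsReflection ts) (prod≡ : prodW ts ≡ word L) (x : Row (suc M))
        (killed : ∀ {r} → r ∈ rows R → dot r x ≡ 0ℤ) where

        u b : V
        u = combination x vectors
        b = combination (x ∘ suc) unit

        u≈ : u ≈ comb (x zero) 1ℤ ρ b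
        u≈ k p = cong (x zero ⊛ ρ k p ⊕_) (sym (ℤ.*-identityˡ (b k p)))

        u-support : Supported u
        u-support k p N≤p = cong₂ _⊕_ (trans (cong (x zero ⊛_) (ρ-support k p N≤p)) (ℤ.*-zeroʳ (x zero))) (units-support (x ∘ suc) k p N≤p)

        fixes : ∀ {t} → t ∈ ts → act t u ≈ u
        fixes = go R (λ {wi} {p} w∈ p∈ → trans (form-combination (reflectionForm wi p) x vectors)
                  (trans (sumF-cong (λ i → ℤ.*-comm (x i) (rowOf (reflectionForm wi p) i))) (killed (∈-map⁺ rowOf (∈-cartesianProductWith⁺ reflectionForm w∈ p∈)))))
          where
            go : ∀ {ts} (R : All IsReflection ts) →
              (∀ {wi p} → wi ∈ witnesses R → p ∈ upTo N → C (proj₂ wi) (act (proj₁ wi ⁻¹) u) p ≡ 0ℤ) → ∀ {t} → t ∈ ts → act t u ≈ u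
            go (r@(w , i , _) ∷ R) h (here refl) = reflection-fixes r λ p → cases p (ℕ.<-≤-connex p N)
              where
                cases : ∀ p → p < N ⊎ N ≤ p → C i (act (w ⁻¹) u) p ≡ 0ℤ
                cases p (inj₁ p<N) = h (here refl) (∈-upTo⁺ p<N)
                cases p (inj₂ N≤p) = C-support i (act-support (w ⁻¹) u-support) p N≤p
            go (_ ∷ R) h (there t∈) = go R (h ∘ there) t∈

        C-zero : ∀ {k} → k ∈ L → ∀ p → C k u p ≡ 0ℤ
        C-zero = fixed-letters L U u (λ k p → trans (cong (λ z → act z u k p) (sym prod≡)) (prod-fixes ts fixes k p))

        -- Without its `ρ` part the solution would be supported on L and killed by the Cartan
        -- operator on L, hence zero by `fixed-zero`.
        x₀≢0 : (∃ λ i → x i ≢ 0ℤ) → x zero ≢ 0ℤ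
        x₀≢0 (zero , h) h₀ = h h₀
        x₀≢0 (suc i , h) h₀ = h (units-independent (x ∘ suc) (fixed-zero L (units-support (x ∘ suc)) (units-off (x ∘ suc))
          (λ {k} k∈ p → trans (C-cong k b≈u p) (C-zero k∈ p))) i)
          where
            b≈u : b ≈ u
            b≈u k p = sym (trans (cong (λ z → z ⊛ ρ k p ⊕ b k p) h₀) (ℤ.+-identityˡ (b k p)))

        -- According to the sign of the coefficient of `ρ`, either u or its negative is dominant,
        -- and `Dominant` bounds its stabiliser.
        members : x zero ≢ 0ℤ → ∀ {t} → t ∈ ts → ⟨ map gen L ⟩ t
        members ne {t} t∈ = cases (ℤ.<-cmp 0ℤ (x zero))
          where
            open import Relation.Binary.Definitions using (Tri; tri<; tri≈; tri>)
            lem : ∀ a r b → (⊖ a) ⊛ r ⊕ 1ℤ ⊛ (⊖ b) ≡ ⊖ (a ⊛ r ⊕ b)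
            lem = solve-∀
            u′≈ : comb (⊖ x zero) 1ℤ ρ (neg b) ≈ neg u
            u′≈ k p = lem (x zero) (ρ k p) (b k p)
            cases : Tri (0ℤ <ℤ x zero) (0ℤ ≡ x zero) (x zero <ℤ 0ℤ) → ⟨ map gen L ⟩ t
            cases (tri≈ _ h _) = contradiction (sym h) ne
            cases (tri< pos _ _) = Dominant.stabiliser-⟨⟩ L pos (units-support (x ∘ suc)) (units-off (x ∘ suc))
              (λ {k} k∈ p → trans (C-cong k (≈-sym u≈) p) (C-zero k∈ p))
              (λ k p → trans (act-cong t (≈-sym u≈) k p) (trans (fixes t∈ k p) (u≈ k p)))
            cases (tri> _ _ minus) = Dominant.stabiliser-⟨⟩ L (ℤ.neg-mono-< minus)
              (λ k p h → cong ⊖_ (units-support (x ∘ suc) k p h)) (λ h p → cong ⊖_ (units-off (x ∘ suc) h p))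
              (λ {k} k∈ p → trans (C-cong k u′≈ p) (trans (C-neg k u p) (cong ⊖_ (C-zero k∈ p))))
              (λ k p → trans (act-cong t u′≈ k p) (trans (act-neg t u k p) (trans (cong ⊖_ (fixes t∈ k p)) (sym (u′≈ k p)))))

      -- With fewer reflections there is room for the additional equation x zero = 0, the row
      -- `first`; a nontrivial solution then contradicts `x₀≢0`.
      ℓT-word-≥ : ∀ ts → All IsReflection ts → prodW ts ≡ word L → length L ≤ length ts
      ℓT-word-≥ ts R prod≡ = ℕ.≮⇒≥ impossible
        where
          first : Row (suc M)
          first zero = 1ℤ
          first (suc _) = 0ℤ
          impossible : ¬ (length ts < length L)
          impossible lt = case nontrivial M (first ∷ rows R) small of λ
            { (x , nz , killed) → Solution.x₀≢0 R prod≡ x (killed ∘ there) nz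
                (trans (sym (trans (cong₂ _⊕_ (ℤ.*-identityˡ (x zero)) (sumF-zero (λ i → 0ℤ ⊛ x (suc i)) (λ i → ℤ.*-zeroˡ (x (suc i)))))
                  (ℤ.+-identityʳ (x zero)))) (killed (here refl))) }
            where
              small : suc (length (rows R)) ≤ M
              small = begin
                suc (length (rows R))     ≡⟨ cong suc (length-rows R) ⟩
                suc (length ts * N)       ≤⟨ ℕ.+-monoˡ-≤ (length ts * N) 0<N ⟩
                suc (length ts) * N       ≤⟨ ℕ.*-monoˡ-≤ N lt ⟩
                M                         ∎
                where open ℕ.≤-Reasoning

      -- All factors fix one vector which up to sign is dominant and strictly so outside L; its
      -- stabiliser lies in the parabolic subgroup of L.
      factors-⟨⟩ : ∀ ts → All IsReflection ts → prodW ts ≡ word L → length ts ≤ length L → ∀ {t} → t ∈ ts → ⟨ map gen L ⟩ t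
      factors-⟨⟩ ts R prod≡ le = case nontrivial M (rows R) (subst (_≤ M) (sym (length-rows R)) (ℕ.*-monoˡ-≤ N le)) of λ
        { (x , nz , killed) → Solution.members R prod≡ x killed (Solution.x₀≢0 R prod≡ x killed nz) }

  -- Rotations of Coxeter elements

  module Rotation (G : FiniteCoxeterSystem)
    (ℓ : Cox.W G → ℕ) (isℓ : Cox.IsCoxeterLength G ℓ) where
    open Cox G
    open SimpleSystems G
    open CoxeterLength G ℓ isℓ
    open Representation G
    open Positivity G ℓ isℓ
    open Cone G ℓ isℓ
    open ParabolicSpan G ℓ isℓ

    -- Conjugating c = word (L ∷ʳ i) by its last letter turns it into word (i ∷ L); Hit L t says that repeating this
    -- eventually carries t to the last letter of the rotated word.
    data Hit : List (Fin rank) → W → Set where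
      now   : ∀ {L i t} → t ≡ gen i → Hit (L ∷ʳ i) t
      later : ∀ {L i t} → Hit (i ∷ L) (t ^^ gen i) → Hit (L ∷ʳ i) t

    word-++ : ∀ us vs → word (us ++ vs) ≡ word us · word vs
    word-++ [] vs = sym (idˡ _)
    word-++ (u ∷ us) vs = trans (cong (gen u ·_) (word-++ us vs)) (sym (assoc _ _ _))

    word-∷ʳ : ∀ us i → word (us ∷ʳ i) ≡ word us · gen i
    word-∷ʳ us i = trans (word-++ us (i ∷ [])) (cong (word us ·_) (idʳ _))

    -- A form of `deletion` that returns the position and the index of the letter, because rotation
    -- acts on words and not on group elements.
    word-deletion : ∀ ws {t} → η (word ws) t ≡ true →
      ∃ λ as → ∃ λ i → ∃ λ bs → ws ≡ as ++ i ∷ bs × t ≡ gen i ^^ (word bs ⁻¹)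
    word-deletion [] {t} h = contradiction (trans (sym h) (η-e t)) true≢false
    word-deletion (i ∷ ws) {t} h with η (word ws) t in eq
    ... | true = case word-deletion ws eq of λ { (as , j , bs , refl , y) → i ∷ as , j , bs , refl , y }
    ... | false = [] , i , ws , refl , trans (sym (^^-inv t (word ws))) (cong (_^^ (word ws ⁻¹))
          (η-gen-true (trans (sym (trans (η-· (gen i) (word ws) t) (cong (_xor η (gen i) (t ^^ word ws)) eq))) h)))

    -- Rotating the suffix bs to the front conjugates t by `word bs`. This undoes the conjugation in
    -- the hypothesis just when i has become the last letter.
    hit-letter : ∀ as i {bs} → Reverse bs → ∀ {t} → t ≡ gen i ^^ (word bs ⁻¹) → Hit (as ++ i ∷ bs) t
    hit-letter as i [] h = now (trans h (trans (cong (gen i ^^_) inv-e) (^^-e (gen i))))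
    hit-letter as i (bs ∶ r ∶ʳ j) {t} h = subst (λ L → Hit L t) (List.++-assoc as (i ∷ bs) (j ∷ []))
      (later (hit-letter (j ∷ as) i r (begin
        t ^^ gen j                                  ≡⟨ cong (_^^ gen j) (trans h (cong (λ z → gen i ^^ (z ⁻¹)) (word-∷ʳ bs j))) ⟩
        (gen i ^^ ((word bs · gen j) ⁻¹)) ^^ gen j  ≡⟨ group 3 (λ i b j → j ⊙ ((inv (b ⊙ j) ⊙ (i ⊙ inv (inv (b ⊙ j)))) ⊙ inv j) ≐ inv b ⊙ (i ⊙ inv (inv b))) refl (gen i) (word bs) (gen j) ⟩
        gen i ^^ (word bs ⁻¹)                       ∎)))
      where open ≡-Reasoning

    rotate : ∀ as {bs} → Reverse bs → ∀ {t} → Hit (bs ++ as) (t ^^ word bs) → Hit (as ++ bs) t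
    rotate as [] {t} h = subst₂ Hit (sym (List.++-identityʳ as)) (^^-e t) h
    rotate as (bs ∶ r ∶ʳ j) {t} h = subst (λ L → Hit L t) (List.++-assoc as bs (j ∷ []))
      (later (rotate (j ∷ as) r (subst₂ Hit (List.++-assoc bs (j ∷ []) as)
        (trans (cong (t ^^_) (word-∷ʳ bs j)) (^^-· t (word bs) (gen j))) h)))

    -- A full turn restores the word and conjugates t by the Coxeter element of L.
    rotate-pow : ∀ L n {t} → Hit L (t ^^ pow (word L) n) → Hit L t
    rotate-pow L zero {t} h = subst (Hit L) (^^-e t) h
    rotate-pow L (suc n) {t} h = rotate-pow L n (rotate [] (reverseView L)
      (subst₂ Hit (sym (List.++-identityʳ L)) (^^-· t (word L) (pow (word L) n)) h))

    finite-order : ∀ c → ∃ λ n → pow c (suc n) ≡ e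
    finite-order c = case Fin.pigeonhole (ℕ.n<1+n (length elems)) (λ k → index (elems-complete (pow c (toℕ k)))) of λ
      { (i , j , i<j , eq) → toℕ j ∸ suc (toℕ i) , cancelˡ (begin
          pow c (toℕ i) · pow c (suc (toℕ j ∸ suc (toℕ i)))  ≡⟨ sym (pow-+ c (toℕ i) _) ⟩
          pow c (toℕ i + suc (toℕ j ∸ suc (toℕ i)))          ≡⟨ cong (pow c) (trans (ℕ.+-suc (toℕ i) _) (ℕ.m+[n∸m]≡n i<j)) ⟩
          pow c (toℕ j)                                      ≡⟨ sym (same i j eq) ⟩
          pow c (toℕ i)                                      ≡⟨ sym (idʳ _) ⟩
          pow c (toℕ i) · e                                  ∎) }
      where
        open ≡-Reasoning
        at : ∀ w → w ≡ List.lookup elems (index (elems-complete w))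
        at w = Any.lookup-index (elems-complete w)
        same : ∀ i j → index (elems-complete (pow c (toℕ i))) ≡ index (elems-complete (pow c (toℕ j))) → pow c (toℕ i) ≡ pow c (toℕ j)
        same i j eq = trans (at _) (trans (cong (List.lookup elems) eq) (sym (at _)))

    act-⟨⟩-other : ∀ L {w k} → ⟨ map gen L ⟩ w → k ∉ L → ∀ v p → act w v k p ≡ v k p
    act-⟨⟩-other L (us , us∈ , refl) k∉ v p with letters L us∈
    ... | ws , refl , ws∈ = trans (cong (λ z → act z v _ p) (prodW-gen ws))
          (act-word-other ws (λ q → k∉ (All.lookup ws∈ q)) v p)

    gen-∈ : ∀ {L i} → ⟨ map gen L ⟩ (gen i) → i ∈ L
    gen-∈ {L} {i} (us , us∈ , q) = case ∈-map⁻ gen (All.lookup us∈ (canonical (simple-gen L) (refl-gen i) (λ _ _ → η-gen-true) us us∈ q)) of λ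
      { (j , j∈ , eq) → subst (_∈ L) (sym (gen-injective eq)) j∈ }

    module Orbit (L : List (Fin rank)) (U : Unique L) (x : W) (x∈ : ⟨ map gen L ⟩ x) (i : Fin rank) (i∈ : i ∈ L) where
      c : W
      c = word L

      v₀ : V
      v₀ = act x (E i ones)

      orbitSum : ℕ → V
      orbitSum zero = 0V
      orbitSum (suc n) = orbitSum n ⊞ act (pow c n) v₀

      -- Applying c shifts the summation by one place, so over a full period the sum is fixed by c.
      act-orbitSum : ∀ n → act c (orbitSum n) ⊞ v₀ ≈ orbitSum (suc n)
      act-orbitSum zero k p = cong₂ _⊕_ (act-0 c k p) (sym (act-e v₀ k p))
      act-orbitSum (suc n) k p = begin
        act c (orbitSum n ⊞ X) k p ⊕ v₀ k p              ≡⟨ cong (_⊕ v₀ k p) (act-⊞ c (orbitSum n) X k p) ⟩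
        (act c (orbitSum n) k p ⊕ act c X k p) ⊕ v₀ k p  ≡⟨ swapʳ (act c (orbitSum n) k p) (act c X k p) (v₀ k p) ⟩
        (act c (orbitSum n) k p ⊕ v₀ k p) ⊕ act c X k p  ≡⟨ cong₂ _⊕_ (act-orbitSum n k p) (sym (act-· c (pow c n) v₀ k p)) ⟩
        orbitSum (suc (suc n)) k p                       ∎
        where
          open ≡-Reasoning
          X = act (pow c n) v₀
          swapʳ : ∀ a b c → (a ⊕ b) ⊕ c ≡ (a ⊕ c) ⊕ b
          swapʳ a b c = trans (ℤ.+-assoc a b c) (trans (cong (a ⊕_) (ℤ.+-comm b c)) (sym (ℤ.+-assoc a c b)))

      c∈ : ⟨ map gen L ⟩ c
      c∈ = map gen L , All.tabulate id , prodW-gen L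

      pow∈ : ∀ n → ⟨ map gen L ⟩ (pow c n)
      pow∈ zero = ⟨⟩-e
      pow∈ (suc n) = ⟨⟩-· c∈ (pow∈ n)

      off : ∀ n {k} → k ∉ L → ∀ p → orbitSum n k p ≡ 0ℤ
      off zero _ _ = refl
      off (suc n) {k} k∉ p = cong₂ _⊕_ (off n k∉ p) (trans (act-⟨⟩-other L (pow∈ n) k∉ v₀ p)
        (trans (act-⟨⟩-other L x∈ k∉ (E i ones) p) (E-other (λ { refl → k∉ i∈ }) ones p)))

      support : ∀ n → Supported (orbitSum n)
      support zero _ _ _ = refl
      support (suc n) k p h = cong₂ _⊕_ (support n k p h) (act-support (pow c n) (act-support x (E-support i ones-≥)) k p h)

      not-all-orbitPositive : ∀ n → pow c (suc n) ≡ e → ¬ (∀ l → l ≤ n → η (pow c l · x) (gen i) ≡ false)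
      not-all-orbitPositive n period pos = contradiction (trans (sym (ones-< 0<N)) (trans (sym (E-self i ones 0)) (E≈0 i 0))) λ ()
        where
          nonneg-term : ∀ l → l ≤ n → Nonneg (act (pow c l) v₀)
          nonneg-term l h k p = subst (0ℤ ≤ℤ_) (act-· (pow c l) x (E i ones) k p) (act-E-nonneg (pow c l · x) i ones-nonneg (pos l h) k p)
          nonneg-sum : ∀ l → l ≤ suc n → Nonneg (orbitSum l)
          nonneg-sum zero _ k p = ℤ.≤-refl
          nonneg-sum (suc l) (s≤s h) k p = ⊕-nonneg (nonneg-sum l (ℕ.≤-trans h (ℕ.n≤1+n n)) k p) (nonneg-term l h k p)
          fixed : act c (orbitSum (suc n)) ≈ orbitSum (suc n)
          fixed k p = ℤ-cancelʳ (v₀ k p) (trans (act-orbitSum (suc n) k p)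
            (cong (orbitSum (suc n) k p ⊕_) (trans (cong (λ z → act z v₀ k p) period) (act-e v₀ k p))))
            where
              ℤ-cancelʳ : ∀ z {x y} → x ⊕ z ≡ y ⊕ z → x ≡ y
              ℤ-cancelʳ z {x} {y} h = trans (lem x) (trans (cong (_⊕ (⊖ z)) h) (sym (lem y)))
                where
                  lem : ∀ x → x ≡ (x ⊕ z) ⊕ (⊖ z)
                  lem x = trans (sym (ℤ.+-identityʳ x)) (trans (cong (x ⊕_) (sym (ℤ.+-inverseʳ z))) (sym (ℤ.+-assoc x z (⊖ z))))
          sum≈0 : orbitSum (suc n) ≈ 0V
          sum≈0 = fixed-zero L (support (suc n)) (off (suc n)) (fixed-letters L U (orbitSum (suc n)) fixed)
          last≈0 : act (pow c n) v₀ ≈ 0V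
          last≈0 k p = sum-zero (nonneg-term n ℕ.≤-refl k p) (nonneg-sum n (ℕ.n≤1+n n) k p)
            (trans (ℤ.+-comm (act (pow c n) v₀ k p) _) (sum≈0 k p))
          E≈0 : E i ones ≈ 0V
          E≈0 = act-zero x (act-zero (pow c n) last≈0)

    -- If some conjugate of t by a power of c is an inversion of c, it is a letter conjugated by a
    -- suffix, and `hit-letter` applies. Otherwise the cocycle keeps `η` at t false for the powers
    -- of c, so the root of t stays positive along the whole orbit.
    hit : ∀ {L t} → Unique L → IsReflection t → ⟨ map gen L ⟩ t → Hit L t
    hit {L} {t} U R t∈@(us , us∈ , q) = reach (letters L us∈)
      where
        c : W
        c = word L
        search : ∀ x i → ⟨ map gen L ⟩ x → i ∈ L → t ≡ gen i ^^ x → η x (gen i) ≡ false → Hit L t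
        search x i x∈ i∈ t≡ hx with finite-order c
        ... | n , period with ℕ.anyUpTo? (λ l → η c (t ^^ pow c l) Bool.≟ true) n
        ...   | yes (l , _ , h) = rotate-pow L l (case word-deletion L h of λ
                  { (as , j , bs , refl , y) → hit-letter as j (reverseView bs) y })
        ...   | no none = contradiction orbitPositive (Orbit.not-all-orbitPositive L U x x∈ i i∈ n period)
          where
            never : ∀ l → l < n → η c (t ^^ pow c l) ≡ false
            never l h with η c (t ^^ pow c l) in eq
            ... | false = refl
            ... | true  = contradiction (l , h , eq) none
            pow-false : ∀ l → l ≤ n → η (pow c l) t ≡ false
            pow-false zero _ = η-e t
            pow-false (suc l) h = trans (η-· c (pow c l) t) (cong₂ _xor_ (pow-false l (ℕ.≤-trans (ℕ.n≤1+n l) h)) (never l h))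
            orbitPositive : ∀ l → l ≤ n → η (pow c l · x) (gen i) ≡ false
            orbitPositive l h = trans (η-· (pow c l) x (gen i)) (cong₂ _xor_ hx (trans (cong (η (pow c l)) (sym t≡)) (pow-false l h)))
        reach : (∃ λ ws → us ≡ map gen ws × All (_∈ L) ws) → Hit L t
        reach (ws , refl , ws∈) with word-deletion ws (trans (cong (λ z → η z t) (trans (sym (prodW-gen ws)) q)) (η-self R))
        ... | as , i , bs , refl , y with All.++⁻ʳ as ws∈
        ...   | i∈ ∷ bs∈ = choose (η x (gen i)) refl
          where
            x : W
            x = word bs ⁻¹
            x∈ : ⟨ map gen L ⟩ x
            x∈ = ⟨⟩-inv (proj₁ (simple-gen L)) (map gen bs , All.map⁺ (All.map (∈-map⁺ gen) bs∈) , prodW-gen bs)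
            choose : ∀ b → η x (gen i) ≡ b → Hit L t
            choose false h = search x i x∈ i∈ y h
            -- x sends the i-th simple root to a negative root; x s_i gives the same reflection with
            -- the opposite root.
            choose true  h = search (x · gen i) i (⟨⟩-· x∈ (⟨⟩-∈ (∈-map⁺ gen i∈))) i∈
              (trans y (trans (cong (_^^ x) (sym (refl-^^-self (refl-gen i)))) (sym (^^-· (gen i) x (gen i)))))
              (trans (η-flip (refl-gen i) x) (cong not h))

  singleton-⊆ : ∀ {A : Set} {x : A} {xs} → x ∈ xs → (x ∷ []) ⊆ xs
  singleton-⊆ (here refl) = keep refl (minimum _)
  singleton-⊆ (there p) = skip _ (singleton-⊆ p)

  pair-⊆ : ∀ {A : Set} {x y : A} {as bs} → x ∈ as → (x ∷ y ∷ []) ⊆ (as ++ y ∷ bs)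
  pair-⊆ {as = a ∷ as} (here refl) = keep refl (singleton-⊆ (∈-++⁺ʳ as (here refl)))
  pair-⊆ (there p) = skip _ (pair-⊆ p)

  remove-⊆ : ∀ {A : Set} (as : List A) {x bs} → (as ++ bs) ⊆ (as ++ x ∷ bs)
  remove-⊆ [] = skip _ ⊆-refl
  remove-⊆ (a ∷ as) = keep refl (remove-⊆ as)

  ⊆⇒All-∈ : ∀ {A : Set} {xs ys : List A} → xs ⊆ ys → All (_∈ ys) xs
  ⊆⇒All-∈ τ = All.tabulate (⊆-lookup τ)

  unique-⊆ : ∀ {A : Set} {xs ys : List A} → xs ⊆ ys → Unique ys → Unique xs
  unique-⊆ done [] = []
  unique-⊆ (skip _ τ) (_ ∷ u) = unique-⊆ τ u
  unique-⊆ (keep refl τ) (p ∷ u) = All.tabulate (λ q → All.lookup p (⊆-lookup τ q)) ∷ unique-⊆ τ u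

  unique-resp-↭ : ∀ {A : Set} {xs ys : List A} → xs ↭ ys → Unique xs → Unique ys
  unique-resp-↭ _↭_.refl u = u
  unique-resp-↭ (_↭_.prep x p) (q ∷ u) = All-resp-↭ p q ∷ unique-resp-↭ p u
  unique-resp-↭ (_↭_.swap x y p) ((x≢y ∷ qx) ∷ qy ∷ u) = ((x≢y ∘ sym) ∷ All-resp-↭ p qy) ∷ (All-resp-↭ p qx ∷ unique-resp-↭ p u)
  unique-resp-↭ (_↭_.trans p q) u = unique-resp-↭ q (unique-resp-↭ p u)

  -- Noncrossing partitions

  module Noncrossing (G : FiniteCoxeterSystem)
    (ℓ ℓT : Cox.W G → ℕ) (isℓ : Cox.IsCoxeterLength G ℓ) (isℓT : Cox.IsAbsoluteLength G ℓT) where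
    open Cox G
    open SimpleSystems G
    open CoxeterLength G ℓ isℓ
    open AbsoluteOrder G ℓ ℓT isℓT
    open Representation G using (gen-injective)
    open ParabolicSpan G ℓ isℓ using (ℓT-word-≥; factors-⟨⟩)
    open Rotation G ℓ isℓ
    open Orders ℓ ℓT
    open import Data.List.Membership.DecPropositional _≟_ using (_∈?_)

    reducedFactors : ∀ w → ∃ λ ts → All IsReflection ts × prodW ts ≡ w × length ts ≡ ℓT w
    reducedFactors w = proj₁ (isℓT w)

    module _ {rs : List W} (R : All IsReflection rs) (len : ℓT (prodW rs) ≡ length rs) where

      -- Every skipped letter leaves one conjugated reflection in the quotient, and kept letters
      -- cancel.
      sublist-gap : ∀ {us vs} → us ⊆ vs → All IsReflection vs → ℓT ((prodW us ⁻¹) · prodW vs) + length us ≤ length vs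
      sublist-gap done [] = ℕ.≤-reflexive (cong (_+ 0) (trans (cong ℓT (invˡ e)) ℓT-e))
      sublist-gap {us} {v ∷ vs} (skip v τ) (r ∷ R) = begin
        ℓT ((prodW us ⁻¹) · (v · prodW vs)) + length us
          ≡⟨ cong (λ z → ℓT z + length us) (group 3 (λ u v p → inv u ⊙ (v ⊙ p) ≐ (inv u ⊙ (v ⊙ inv (inv u))) ⊙ (inv u ⊙ p)) refl (prodW us) v (prodW vs)) ⟩
        ℓT ((v ^^ (prodW us ⁻¹)) · ((prodW us ⁻¹) · prodW vs)) + length us
          ≤⟨ ℕ.+-monoˡ-≤ (length us) (ℓT-· _ _) ⟩
        (ℓT (v ^^ (prodW us ⁻¹)) + ℓT ((prodW us ⁻¹) · prodW vs)) + length us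
          ≡⟨ cong (λ z → (z + ℓT ((prodW us ⁻¹) · prodW vs)) + length us) (ℓT-refl (refl-^^ _ r)) ⟩
        suc (ℓT ((prodW us ⁻¹) · prodW vs) + length us)
          ≤⟨ s≤s (sublist-gap τ R) ⟩
        suc (length vs) ∎
        where open ℕ.≤-Reasoning
      sublist-gap {u ∷ us} {u ∷ vs} (keep refl τ) (r ∷ R) = begin
        ℓT (((u · prodW us) ⁻¹) · (u · prodW vs)) + suc (length us)
          ≡⟨ cong (λ z → ℓT z + suc (length us)) (group 3 (λ u p q → inv (u ⊙ p) ⊙ (u ⊙ q) ≐ inv p ⊙ q) refl u (prodW us) (prodW vs)) ⟩
        ℓT ((prodW us ⁻¹) · prodW vs) + suc (length us)
          ≡⟨ ℕ.+-suc _ (length us) ⟩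
        suc (ℓT ((prodW us ⁻¹) · prodW vs) + length us)
          ≤⟨ s≤s (sublist-gap τ R) ⟩
        suc (length vs) ∎
        where open ℕ.≤-Reasoning

      sublist-≤ : ∀ {us} → us ⊆ rs → prodW us ≤A prodW rs
      sublist-≤ {us} τ = ≤A-intro (begin
        ℓT (prodW us) + ℓT ((prodW us ⁻¹) · prodW rs)   ≤⟨ ℕ.+-monoˡ-≤ _ (ℓT-min us (All.map (All.lookup R) (⊆⇒All-∈ τ))) ⟩
        length us + ℓT ((prodW us ⁻¹) · prodW rs)       ≡⟨ ℕ.+-comm (length us) _ ⟩
        ℓT ((prodW us ⁻¹) · prodW rs) + length us       ≤⟨ sublist-gap τ R ⟩
        length rs                                       ≡⟨ sym len ⟩
        ℓT (prodW rs)                                   ∎)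
        where open ℕ.≤-Reasoning

      sublist-rank : ∀ {us} → us ⊆ rs → ℓT (prodW us) ≡ length us
      sublist-rank {us} τ = ℕ.≤-antisym (ℓT-min us (All.map (All.lookup R) (⊆⇒All-∈ τ)))
        (ℕ.+-cancelˡ-≤ (ℓT ((prodW us ⁻¹) · prodW rs)) _ _ (begin
          ℓT ((prodW us ⁻¹) · prodW rs) + length us       ≤⟨ sublist-gap τ R ⟩
          length rs                                       ≡⟨ sym len ⟩
          ℓT (prodW rs)                                   ≡⟨ sublist-≤ τ ⟩
          ℓT (prodW us) + ℓT ((prodW us ⁻¹) · prodW rs)   ≡⟨ ℕ.+-comm (ℓT (prodW us)) _ ⟩
          ℓT ((prodW us ⁻¹) · prodW rs) + ℓT (prodW us)   ∎))
        where open ℕ.≤-Reasoning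

    -- rs is the canonical generating set of the reflection subgroup generated by the reflections below w = prodW rs.
    record Good (rs : List W) : Set where
      field
        simple : Simple rs
        unique : Unique rs
        rank≡  : ℓT (prodW rs) ≡ length rs
        closed : ∀ {t} → IsReflection t → t ≤A prodW rs → ⟨ rs ⟩ t

      refls : All IsReflection rs
      refls = proj₁ simple

    open Good public

    ℓT-word : ∀ {L} → Unique L → ℓT (word L) ≡ length L
    ℓT-word {L} U = ℕ.≤-antisym
      (subst₂ _≤_ (cong ℓT (prodW-gen L)) (List.length-map gen L) (ℓT-min (map gen L) (proj₁ (simple-gen L))))
      (case reducedFactors (word L) of λ { (ts , R , eq , len) → subst (length L ≤_) len (ℓT-word-≥ L U ts R eq) })

    -- t extends to a factorisation of `word L` into as many reflections as L has letters, and
    -- `factors-⟨⟩` covers its first factor.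
    below-word : ∀ {L} → Unique L → ∀ {t} → IsReflection t → t ≤A word L → ⟨ map gen L ⟩ t
    below-word {L} U {t} R p with reducedFactors ((t ⁻¹) · word L)
    ... | ts , Rs , eq , len = factors-⟨⟩ L U (t ∷ ts) (R ∷ Rs)
        (trans (cong (t ·_) eq) (group 2 (λ t c → t ⊙ (inv t ⊙ c) ≐ c) refl t (word L)))
        (ℕ.≤-reflexive (begin
          suc (length ts)                    ≡⟨ cong suc len ⟩
          suc (ℓT ((t ⁻¹) · word L))         ≡⟨ cong (_+ ℓT ((t ⁻¹) · word L)) (sym (ℓT-refl R)) ⟩
          ℓT t + ℓT ((t ⁻¹) · word L)        ≡⟨ sym p ⟩
          ℓT (word L)                        ≡⟨ ℓT-word U ⟩
          length L                           ∎))
        (here refl)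
      where open ≡-Reasoning

    good-standard : ∀ {L} → Unique L → Good (map gen L)
    good-standard {L} U = record
      { simple = simple-gen L
      ; unique = Unique.map⁺ gen-injective U
      ; rank≡ = trans (cong ℓT (prodW-gen L)) (trans (ℓT-word U) (sym (List.length-map gen L)))
      ; closed = λ R p → below-word U R (subst (_ ≤A_) (prodW-gen L) p)
      }

    ^^-^^-gen : ∀ i t → (t ^^ gen i) ^^ gen i ≡ t
    ^^-^^-gen i t = trans (sym (^^-· t (gen i) (gen i))) (trans (cong (t ^^_) (gen² i)) (^^-e t))

    ^^-injective : ∀ {x u v} → u ^^ x ≡ v ^^ x → u ≡ v
    ^^-injective {x} {u} {v} h = trans (sym (^^-inv u x)) (trans (cong (_^^ (x ⁻¹)) h) (^^-inv v x))

    gen-∉ : ∀ {rs i} → Simple rs → gen i ∉ rs → ¬ ⟨ rs ⟩ (gen i)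
    gen-∉ {rs} {i} S ∉ (us , us∈ , eq) = ∉ (All.lookup us∈ (canonical S (refl-gen i) (λ _ _ → η-gen-true) us us∈ eq))

    -- A simple reflection is indecomposable in every subgroup containing it, so s lies outside the
    -- subgroup of rs. Neither this subgroup nor its conjugate then contains an inversion of s, and
    -- in the cocycle formula for s r s only the middle factor contributes.
    good-conj : ∀ {rs i} → gen i ∉ rs → Good rs → Good (map (_^^ gen i) rs)
    good-conj {rs} {i} s∉rs g = record
      { simple = All.map⁺ (All.map (refl-^^ s) (refls g)) , indecomposable
      ; unique = Unique.map⁺ ^^-injective (unique g)
      ; rank≡ = trans (cong ℓT (prodW-map-^^ s rs)) (trans (ℓT-^^ (prodW rs) s) (trans (rank≡ g) (sym (List.length-map (_^^ s) rs))))
      ; closed = λ {t} R p → subst ⟨ map (_^^ s) rs ⟩ (^^-^^-gen i t) (⟨⟩-map-^^ s (closed g (refl-^^ s R)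
          (subst ((t ^^ s) ≤A_) (trans (cong (_^^ s) (prodW-map-^^ s rs)) (^^-^^-gen i (prodW rs))) (≤A-^^ s p))))
      }
      where
        s : W
        s = gen i
        back : ∀ {t} → ⟨ map (_^^ s) rs ⟩ t → ⟨ rs ⟩ (t ^^ s)
        back p = ⟨⟩-mono (λ q → case ∈-map⁻ (_^^ s) q of λ
          { (_ , q′ , refl) → case ∈-map⁻ (_^^ s) q′ of λ { (r , r∈ , refl) → subst (_∈ rs) (sym (^^-^^-gen i r)) r∈ } })
          (⟨⟩-map-^^ s p)
        s∉ : ¬ ⟨ rs ⟩ s
        s∉ = gen-∉ (simple g) s∉rs
        not-s : ∀ {t} → ⟨ rs ⟩ t → η s t ≡ false
        not-s {t} t∈ with η s t in eq
        ... | false = refl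
        ... | true  = contradiction (subst ⟨ rs ⟩ (η-gen-true eq) t∈) s∉
        not-s′ : ∀ {t} → ⟨ map (_^^ s) rs ⟩ t → η s t ≡ false
        not-s′ {t} t∈ with η s t in eq
        ... | false = refl
        ... | true  = contradiction (subst ⟨ rs ⟩ (trans (cong (_^^ s) (η-gen-true eq)) (refl-^^-self (refl-gen i))) (back t∈)) s∉
        indecomposable : ∀ {r t} → r ∈ map (_^^ s) rs → IsReflection t → ⟨ map (_^^ s) rs ⟩ t → η r t ≡ true → t ≡ r
        indecomposable {_} {t} r′∈ R t∈ h with ∈-map⁻ (_^^ s) r′∈
        ... | r , r∈ , refl = trans (sym (^^-^^-gen i t)) (cong (_^^ s) (proj₂ (simple g) r∈ (refl-^^ s R) (back t∈) (begin
          η r (t ^^ s)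
            ≡⟨ sym (Bool.xor-identityʳ _) ⟩
          η r (t ^^ s) xor false
            ≡⟨ cong (η r (t ^^ s) xor_) (sym (not-s (⟨⟩-^^ (refls g) (back t∈) (⟨⟩-∈ r∈)))) ⟩
          (false xor η r (t ^^ s)) xor η s ((t ^^ s) ^^ r)
            ≡⟨ cong (λ z → (z xor η r (t ^^ s)) xor η s ((t ^^ s) ^^ r)) (sym (not-s′ t∈)) ⟩
          (η s t xor η r (t ^^ s)) xor η s ((t ^^ s) ^^ r)
            ≡⟨ sym (cong₂ _xor_ (η-· r s t) (cong (η s) (^^-· t r s))) ⟩
          η (r · s) t xor η s (t ^^ (r · s))
            ≡⟨ sym (η-· s (r · s) t) ⟩
          η (s · (r · s)) t
            ≡⟨ cong (λ z → η (s · (r · z)) t) (sym (gen⁻¹ i)) ⟩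
          η (r ^^ s) t
            ≡⟨ h ⟩
          true ∎)))
          where open ≡-Reasoning

    module _ {i L} (U : Unique (i ∷ L)) {as bs : List W} (g : Good (as ++ gen i ∷ bs)) (below : prodW (as ++ gen i ∷ bs) ≤A word (i ∷ L)) where
      private
        s : W
        s = gen i

      -- t s ≤ s c′ gives s t s ≤ c′, so s t s lies in the parabolic subgroup without s and t would have s as an
      -- inversion unless t commutes with s.
      commutes : ∀ {t} → t ∈ as → s ^^ t ≡ s
      commutes {t} t∈ = cases (η t s) refl
        where
          open ≡-Reasoning
          c = word (i ∷ L)
          t′ : W
          t′ = t ^^ s
          tr : IsReflection t
          tr = All.lookup (refls g) (∈-++⁺ˡ t∈)
          t′r : IsReflection t′
          t′r = refl-^^ s tr
          ts : W
          ts = t · (s · e)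
          ts≤c : ts ≤A c
          ts≤c = ≤A-trans (sublist-≤ (refls g) (rank≡ g) (pair-⊆ t∈)) below
          ℓT-ts : ℓT ts ≡ 2
          ℓT-ts = sublist-rank (refls g) (rank≡ g) (pair-⊆ t∈)
          gap : (ts ⁻¹) · c ≡ (t′ ⁻¹) · word L
          gap = begin
            (ts ⁻¹) · (s · word L)                        ≡⟨ group 3 (λ t s c → inv (t ⊙ (s ⊙ one)) ⊙ (s ⊙ c) ≐ (inv s ⊙ (inv t ⊙ s)) ⊙ c) refl t s (word L) ⟩
            ((s ⁻¹) · ((t ⁻¹) · s)) · word L              ≡⟨ cong₂ (λ a b → (a · ((t ⁻¹) · b)) · word L) (gen⁻¹ i) (sym (gen⁻¹ i)) ⟩
            (s · ((t ⁻¹) · (s ⁻¹))) · word L              ≡⟨ group 3 (λ t s c → (s ⊙ (inv t ⊙ inv s)) ⊙ c ≐ inv (s ⊙ (t ⊙ inv s)) ⊙ c) refl t s (word L) ⟩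
            (t′ ⁻¹) · word L                              ∎
          t′≤ : t′ ≤A word L
          t′≤ = ℕ.suc-injective (begin
            suc (ℓT (word L))                 ≡⟨ cong suc (ℓT-word (unique-tail U)) ⟩
            suc (length L)                    ≡⟨ sym (ℓT-word U) ⟩
            ℓT c                              ≡⟨ ts≤c ⟩
            ℓT ts + ℓT ((ts ⁻¹) · c)          ≡⟨ cong₂ _+_ ℓT-ts (cong ℓT gap) ⟩
            2 + ℓT ((t′ ⁻¹) · word L)         ≡⟨ cong (λ z → suc (z + ℓT ((t′ ⁻¹) · word L))) (sym (ℓT-refl t′r)) ⟩
            suc (ℓT t′ + ℓT ((t′ ⁻¹) · word L)) ∎)
            where
              unique-tail : Unique (i ∷ L) → Unique L
              unique-tail (_ ∷ u) = u
          i∉L : i ∉ L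
          i∉L = unique-remove-∉ [] U
          t′-s : η t′ s ≡ false
          t′-s with η t′ s in eq
          ... | false = refl
          ... | true  = contradiction (gen-∈ (deletion-⟨⟩ (simple-gen (i ∷ L)) (λ p → case ∈-map⁻ gen p of λ { (j , j∈ , refl) → ∈-map⁺ gen (there j∈) })
                  (below-word (case U of λ { (_ ∷ u) → u }) t′r t′≤) (refl-gen i) (⟨⟩-∈ (here refl)) eq)) i∉L
          expand : η t s ≡ true xor η s (s ^^ t′)
          expand = begin
            η t s                                        ≡⟨ cong (λ z → η z s) (trans (sym (^^-^^-gen i t)) (cong (λ z → s · (t′ · z)) (gen⁻¹ i))) ⟩
            η (s · (t′ · s)) s                           ≡⟨ η-· s (t′ · s) s ⟩
            η (t′ · s) s xor η s (s ^^ (t′ · s))         ≡⟨ cong₂ _xor_ (η-· t′ s s) (cong (η s) (^^-· s t′ s)) ⟩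
            (η s s xor η t′ (s ^^ s)) xor η s ((s ^^ s) ^^ t′)
                                                         ≡⟨ cong₂ (λ a b → (a xor η t′ b) xor η s (b ^^ t′)) (η-gen-self i) (refl-^^-self (refl-gen i)) ⟩
            (true xor η t′ s) xor η s (s ^^ t′)          ≡⟨ cong (λ z → (true xor z) xor η s (s ^^ t′)) t′-s ⟩
            true xor η s (s ^^ t′)                       ∎
          cases : ∀ b → η t s ≡ b → s ^^ t ≡ s
          cases true h = trans (cong (s ^^_) (sym (proj₂ (simple g) (∈-++⁺ˡ t∈) (refl-gen i) (⟨⟩-∈ (∈-++⁺ʳ as (here refl))) h))) (refl-^^-self (refl-gen i))
          cases false h = ^^-injective {s} (begin
            (s ^^ t) ^^ s                     ≡⟨ sym (^^-· s s t) ⟩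
            s ^^ (s · t)                      ≡⟨ cong (s ^^_) (group 2 (λ s t → s ⊙ t ≐ (s ⊙ (t ⊙ inv s)) ⊙ s) refl s t) ⟩
            s ^^ (t′ · s)                     ≡⟨ ^^-· s t′ s ⟩
            (s ^^ s) ^^ t′                    ≡⟨ cong (_^^ t′) (refl-^^-self (refl-gen i)) ⟩
            s ^^ t′                           ≡⟨ η-gen-true (flip-not (trans (sym expand) h)) ⟩
            s                                 ≡⟨ sym (refl-^^-self (refl-gen i)) ⟩
            s ^^ s                            ∎)
            where
              flip-not : ∀ {b} → true xor b ≡ false → b ≡ true
              flip-not {true} _ = refl

      commutes-prod : ∀ us → All (_∈ as) us → s ^^ prodW us ≡ s
      commutes-prod [] [] = ^^-e s
      commutes-prod (u ∷ us) (p ∷ ps) = trans (^^-· s u (prodW us)) (trans (cong (_^^ u) (commutes-prod us ps)) (commutes p))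

      rotated : List W
      rotated = (as ++ bs) ∷ʳ s

      rotated-⊆ : ∀ {r} → r ∈ rotated → r ∈ as ++ s ∷ bs
      rotated-⊆ p with ∈-++⁻ (as ++ bs) p
      ... | inj₁ q = remove-mono as q
      ... | inj₂ (here refl) = ∈-++⁺ʳ as (here refl)

      ⊆-rotated : ∀ {r} → r ∈ as ++ s ∷ bs → r ∈ rotated
      ⊆-rotated p with ∈-++⁻ as p
      ... | inj₁ q = ∈-++⁺ˡ (∈-++⁺ˡ q)
      ... | inj₂ (here refl) = ∈-++⁺ʳ (as ++ bs) (here refl)
      ... | inj₂ (there q) = ∈-++⁺ˡ (∈-++⁺ʳ as q)

      prod-rotated : prodW rotated ≡ prodW (as ++ s ∷ bs) ^^ s
      prod-rotated = begin
        prodW ((as ++ bs) ∷ʳ s)             ≡⟨ prodW-∷ʳ (as ++ bs) s ⟩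
        prodW (as ++ bs) · s                ≡⟨ cong (_· s) (prodW-++ as bs) ⟩
        (A · B) · s                         ≡⟨ cong (λ z → (A · z) · s) (sym (trans (cong (_· B) (gen² i)) (idˡ B))) ⟩
        (A · ((s · s) · B)) · s             ≡⟨ group 3 (λ a s b → (a ⊙ ((s ⊙ s) ⊙ b)) ⊙ s ≐ (a ⊙ (s ⊙ inv a)) ⊙ ((a ⊙ (s ⊙ b)) ⊙ s)) refl A s B ⟩
        (s ^^ A) · ((A · (s · B)) · s)      ≡⟨ cong₂ (λ x y → x · ((A · (s · B)) · y)) (commutes-prod as (All.tabulate id)) (sym (gen⁻¹ i)) ⟩
        (A · (s · B)) ^^ s                  ≡⟨ cong (_^^ s) (sym (prodW-++ as (s ∷ bs))) ⟩
        prodW (as ++ s ∷ bs) ^^ s           ∎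
        where
          open ≡-Reasoning
          A = prodW as
          B = prodW bs

      -- The subgroup contains s, so conjugation by s preserves it and its canonical generators.
      -- Since s commutes with the letters before it, conjugating the product merely moves s to the
      -- end.
      good-rotated : Good rotated
      good-rotated = record
        { simple = simple-⊆ rotated-⊆ (simple g)
        ; unique = Unique.++⁺ (unique-remove as (unique g)) ([] ∷ []) (λ { (p , here refl) → unique-remove-∉ as (unique g) p })
        ; rank≡ = begin
            ℓT (prodW rotated)                  ≡⟨ cong ℓT prod-rotated ⟩
            ℓT (prodW (as ++ s ∷ bs) ^^ s)      ≡⟨ ℓT-^^ _ s ⟩
            ℓT (prodW (as ++ s ∷ bs))           ≡⟨ rank≡ g ⟩
            length (as ++ s ∷ bs)               ≡⟨ length-remove as ⟩
            suc (length (as ++ bs))             ≡⟨ ℕ.+-comm 1 _ ⟩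
            length (as ++ bs) + 1               ≡⟨ sym (List.length-++ (as ++ bs)) ⟩
            length rotated                      ∎
        ; closed = λ {t} R p → subst ⟨ rotated ⟩ (^^-^^-gen i t) (⟨⟩-^^ (proj₁ (simple-⊆ rotated-⊆ (simple g)))
            (⟨⟩-mono ⊆-rotated (closed g (refl-^^ s R) (subst ((t ^^ s) ≤A_) (trans (cong (_^^ s) prod-rotated) (^^-^^-gen i _)) (≤A-^^ s p))))
            (⟨⟩-∈ (⊆-rotated (∈-++⁺ʳ as (here refl)))))
        }
        where open ≡-Reasoning

    GoodFor : W → Set
    GoodFor w = ∃ λ rs → Good rs × prodW rs ≡ w

    transfer : ∀ {i L w} → Unique (i ∷ L) → w ≤A word (i ∷ L) → GoodFor w → GoodFor (w ^^ gen i)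
    transfer {i} U w≤ (rs , g , refl) with gen i ∈? rs
    ... | no ∉ = map (_^^ gen i) rs , good-conj ∉ g , prodW-map-^^ (gen i) rs
    ... | yes p with ∈-∃++ p
    ...   | as , bs , refl = rotated U g w≤ , good-rotated U g w≤ , prod-rotated U g w≤

    unique-rotate : ∀ {L} {i : Fin rank} → Unique (L ∷ʳ i) → Unique (i ∷ L)
    unique-rotate {L} {i} U = All.tabulate (λ { p refl → unique-remove-∉ L U (∈-++⁺ˡ p) })
      ∷ subst Unique (List.++-identityʳ L) (unique-remove L U)

    -- The bound n on the number of letters drops only at `now`, where the last letter is t and
    -- cancelling it leaves a shorter word. In between, the recursion follows the derivation of
    -- `Hit`, and `transfer` carries the result back through each rotation.
    good : ∀ n {L w} → length L ≤ n → Unique L → w ≤A word L → GoodFor w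
    good-hit : ∀ n {L t w} → length L ≤ n → Unique L → Hit L t → w ≤A word L → w ≤A (word L · (t ⁻¹)) → GoodFor w

    good n {L} {w} len U w≤ with w ≟ word L
    ... | yes refl = map gen L , good-standard U , prodW-gen L
    ... | no w≢ with reducedFactors ((w ⁻¹) · word L)
    ...   | [] , _ , eq , _ = contradiction (trans (sym (idʳ w)) (trans (cong (w ·_) eq) (group 2 (λ w c → w ⊙ (inv w ⊙ c) ≐ c) refl w (word L)))) w≢
    ...   | t ∷ ts , R ∷ Rs , eq , tlen = good-hit n len U (hit U R (below-word U R (≤A-trans t≤ (complement w≤)))) w≤
            (subst (w ≤A_) (group 3 (λ w c t → w ⊙ ((inv w ⊙ c) ⊙ inv t) ≐ c ⊙ inv t) refl w (word L) t) (extendˡ w≤ (left-complement t≤)))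
      where
        t≤ : t ≤A ((w ⁻¹) · word L)
        t≤ = ≤A-intro (begin
          ℓT t + ℓT ((t ⁻¹) · ((w ⁻¹) · word L))    ≡⟨ cong₂ _+_ (ℓT-refl R) (cong (λ z → ℓT ((t ⁻¹) · z)) (sym eq)) ⟩
          suc (ℓT ((t ⁻¹) · (t · prodW ts)))        ≡⟨ cong (suc ∘ ℓT) (group 2 (λ t p → inv t ⊙ (t ⊙ p) ≐ p) refl t (prodW ts)) ⟩
          suc (ℓT (prodW ts))                       ≤⟨ s≤s (ℓT-min ts Rs) ⟩
          suc (length ts)                           ≡⟨ tlen ⟩
          ℓT ((w ⁻¹) · word L)                      ∎)
          where open ℕ.≤-Reasoning

    good-hit zero len U (now {L} {i} _) w≤ w≤′ = contradiction (subst (_≤ 0) (trans (List.length-++ L) (ℕ.+-comm (length L) 1)) len) λ ()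
    good-hit (suc n) {w = w} len U (now {L} {i} refl) w≤ w≤′ = good n
      (ℕ.≤-pred (subst (_≤ suc n) (trans (List.length-++ L) (ℕ.+-comm (length L) 1)) len))
      (case unique-rotate U of λ { (_ ∷ u) → u })
      (subst (w ≤A_) (trans (cong (_· (gen i ⁻¹)) (word-∷ʳ L i)) (group 2 (λ c s → (c ⊙ s) ⊙ inv s ≐ c) refl (word L) (gen i))) w≤′)
    good-hit n {t = t} {w} len U (later {L} {i} h) w≤ w≤′ = subst GoodFor (^^-^^-gen i w)
      (transfer (unique-rotate U) below (good-hit n
        (subst (_≤ n) (trans (List.length-++ L) (ℕ.+-comm (length L) 1)) len) (unique-rotate U) h below
        (subst ((w ^^ s) ≤A_) conj-removed (≤A-^^ s w≤′))))
      where
        s : W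
        s = gen i
        conj-word : word (L ∷ʳ i) ^^ s ≡ word (i ∷ L)
        conj-word = trans (cong (_^^ s) (word-∷ʳ L i)) (group 2 (λ c s → s ⊙ ((c ⊙ s) ⊙ inv s) ≐ s ⊙ c) refl (word L) s)
        below : (w ^^ s) ≤A word (i ∷ L)
        below = subst ((w ^^ s) ≤A_) conj-word (≤A-^^ s w≤)
        conj-removed : (word (L ∷ʳ i) · (t ⁻¹)) ^^ s ≡ word (i ∷ L) · ((t ^^ s) ⁻¹)
        conj-removed = trans (group 3 (λ c t s → s ⊙ ((c ⊙ inv t) ⊙ inv s) ≐ (s ⊙ (c ⊙ inv s)) ⊙ inv (s ⊙ (t ⊙ inv s))) refl (word (L ∷ʳ i)) t s)
          (cong (_· ((t ^^ s) ⁻¹)) conj-word)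

    module _ {c : W} (isC : IsStandardCoxeter c) where

      good-below : ∀ {w} → w ≤A c → GoodFor w
      good-below w≤ = case isC of λ { (ws , perm , refl) →
        good (length ws) ℕ.≤-refl (unique-resp-↭ (↭-sym perm) (Unique.allFin⁺ rank)) w≤ }

      -- The difficulty is `closed`. `good-below` provides some good list ss with the same product.
      -- Members of us are indecomposable in the subgroup of rs, which contains that of ss, so
      -- `canonical` puts them into ss; equal rank makes the two lists permutations of each other.
      good-sublist : ∀ {rs us} → Good rs → prodW rs ≤A c → us ⊆ rs → Good us
      good-sublist {rs} {us} g rs≤ τ with good-below (≤A-trans (sublist-≤ (refls g) (rank≡ g) τ) rs≤)
      ... | ss , h , eq = record
        { simple = simple-us
        ; unique = unique-us
        ; rank≡ = rank-us
        ; closed = λ R p → ⟨⟩-mono (∈-resp-↭ (↭-sym us↭ss)) (closed h R (subst (_ ≤A_) (sym eq) p))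
        }
        where
          simple-us : Simple us
          simple-us = simple-⊆ (⊆-lookup τ) (simple g)
          unique-us : Unique us
          unique-us = unique-⊆ τ (unique g)
          rank-us : ℓT (prodW us) ≡ length us
          rank-us = sublist-rank (refls g) (rank≡ g) τ
          ss⊆⟨rs⟩ : ∀ {s} → s ∈ ss → ⟨ rs ⟩ s
          ss⊆⟨rs⟩ s∈ = closed g (All.lookup (refls h) s∈) (≤A-trans (subst (_ ≤A_) eq
            (subst (_≤A prodW ss) (idʳ _) (sublist-≤ (refls h) (rank≡ h) (singleton-⊆ s∈)))) (sublist-≤ (refls g) (rank≡ g) τ))
          us⊆ss : ∀ {r} → r ∈ us → r ∈ ss
          us⊆ss {r} r∈ with closed h (All.lookup (refls g) (⊆-lookup τ r∈)) (subst₂ _≤A_ (idʳ r) (sym eq)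
                              (sublist-≤ (proj₁ simple-us) rank-us (singleton-⊆ r∈)))
          ... | vs , vs∈ , q = All.lookup vs∈ (canonical (simple h) (All.lookup (refls g) (⊆-lookup τ r∈))
                  (λ R t∈ e → proj₂ (simple g) (⊆-lookup τ r∈) R (⟨⟩-least ss⊆⟨rs⟩ t∈) e) vs vs∈ q)
          us↭ss : us ↭ ss
          us↭ss = unique-⊆-↭ unique-us (unique h) us⊆ss
            (ℕ.≤-reflexive (trans (sym (rank≡ h)) (trans (cong ℓT eq) rank-us)))

  -- Sublists and deletions of one entry

  data Removal {A : Set} (P : List A → Set) : List A → Set where
    removal : ∀ as r bs → P (as ++ bs) → Removal P (as ++ r ∷ bs)

  removal? : ∀ {A : Set} {P : List A → Set} → (∀ us → Dec (P us)) → ∀ rs → Dec (Removal P rs)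
  removal? {A} {P} P? [] = no λ p → empty p refl
    where
      empty : ∀ {us} → Removal P us → us ≢ []
      empty (removal [] _ _ _) ()
      empty (removal (_ ∷ _) _ _ _) ()
  removal? {A} {P} P? (u ∷ us) with P? us | removal? (λ vs → P? (u ∷ vs)) us
  ... | yes p | _ = yes (removal [] u us p)
  ... | no _ | yes (removal as r bs p) = yes (removal (u ∷ as) r bs p)
  ... | no ¬p | no ¬q = no λ p → neither p refl
    where
      neither : ∀ {vs} → Removal P vs → vs ≢ u ∷ us
      neither (removal [] _ _ p) refl = ¬p p
      neither (removal (_ ∷ as) r bs p) refl = ¬q (removal as r bs p)

  ⊆-split : ∀ {A : Set} {us : List A} as {r bs} → us ⊆ (as ++ r ∷ bs) →
    us ⊆ (as ++ bs) ⊎ ∃₂ λ as′ bs′ → us ≡ as′ ++ r ∷ bs′ × as′ ⊆ as × bs′ ⊆ bs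
  ⊆-split [] (skip _ τ) = inj₁ τ
  ⊆-split [] (keep refl τ) = inj₂ ([] , _ , refl , done , τ)
  ⊆-split (a ∷ as) (skip _ τ) with ⊆-split as τ
  ... | inj₁ σ = inj₁ (skip a σ)
  ... | inj₂ (as′ , bs′ , eq , σ , σ′) = inj₂ (as′ , bs′ , eq , skip a σ , σ′)
  ⊆-split (a ∷ as) (keep refl τ) with ⊆-split as τ
  ... | inj₁ σ = inj₁ (keep refl σ)
  ... | inj₂ (as′ , bs′ , eq , σ , σ′) = inj₂ (a ∷ as′ , bs′ , cong (a ∷_) eq , keep refl σ , σ′)

  ⊆-cases : ∀ {A : Set} {us rs : List A} → us ⊆ rs → us ≡ rs ⊎ ∃ λ as → ∃₂ λ r bs → rs ≡ as ++ r ∷ bs × us ⊆ (as ++ bs)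
  ⊆-cases done = inj₁ refl
  ⊆-cases (skip r τ) = inj₂ ([] , r , _ , refl , τ)
  ⊆-cases (keep {x = u} refl τ) with ⊆-cases τ
  ... | inj₁ refl = inj₁ refl
  ... | inj₂ (as , r , bs , refl , σ) = inj₂ (u ∷ as , r , bs , refl , keep refl σ)

  sublists : {A : Set} → List A → List (List A)
  sublists [] = [] ∷ []
  sublists (r ∷ rs) = map (r ∷_) (sublists rs) ++ sublists rs

  sublists-⊆ : ∀ {A : Set} (rs : List A) {us} → us ∈ sublists rs → us ⊆ rs
  sublists-⊆ [] (here refl) = done
  sublists-⊆ (r ∷ rs) p with ∈-++⁻ (map (r ∷_) (sublists rs)) p
  ... | inj₁ q = case ∈-map⁻ (r ∷_) q of λ { (_ , q′ , refl) → keep refl (sublists-⊆ rs q′) }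
  ... | inj₂ q = skip r (sublists-⊆ rs q)

  ∈-sublists : ∀ {A : Set} {rs us : List A} → us ⊆ rs → us ∈ sublists rs
  ∈-sublists done = here refl
  ∈-sublists {rs = r ∷ rs} (skip _ τ) = ∈-++⁺ʳ (map (r ∷_) (sublists rs)) (∈-sublists τ)
  ∈-sublists (keep refl τ) = ∈-++⁺ˡ (∈-map⁺ _ (∈-sublists τ))

  -- The order ≪

  module DescentOrder (G : FiniteCoxeterSystem)
    (ℓ ℓT : Cox.W G → ℕ) (isℓ : Cox.IsCoxeterLength G ℓ) (isℓT : Cox.IsAbsoluteLength G ℓT)
    {c : Cox.W G} (isC : Cox.IsStandardCoxeter G c) where
    open Cox G
    open SimpleSystems G
    open CoxeterLength G ℓ isℓ
    open AbsoluteOrder G ℓ ℓT isℓT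
    open Noncrossing G ℓ ℓT isℓ isℓT
    open Orders ℓ ℓT

    Below : List W → W → Set
    Below rs w = ∃ λ us → us ⊆ rs × prodW us ≡ w

    simple-tail : ∀ {r rs} → Simple (r ∷ rs) → Simple rs
    simple-tail = simple-⊆ there

    subproducts : List W → List W
    subproducts rs = map prodW (sublists rs)

    subproducts-⊆ : ∀ rs {w} → w ∈ subproducts rs → Below rs w
    subproducts-⊆ rs p = case ∈-map⁻ prodW p of λ { (us , q , refl) → us , sublists-⊆ rs q , refl }

    ∈-subproducts : ∀ {rs w} → Below rs w → w ∈ subproducts rs
    ∈-subproducts (us , τ , refl) = ∈-map⁺ prodW (∈-sublists τ)

    subproducts-∷ : ∀ r rs → subproducts (r ∷ rs) ≡ map (r ·_) (subproducts rs) ++ subproducts rs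
    subproducts-∷ r rs = trans (List.map-++ prodW (map (r ∷_) (sublists rs)) (sublists rs))
      (cong (_++ subproducts rs) (trans (sym (List.map-∘ (sublists rs))) (List.map-∘ (sublists rs))))

    ⊆-⟨⟩ : ∀ {us rs} → us ⊆ rs → ⟨ rs ⟩ (prodW us)
    ⊆-⟨⟩ {us} τ = us , ⊆⇒All-∈ τ , refl

    subproducts-unique : ∀ rs → Simple rs → Unique rs → Unique (subproducts rs)
    subproducts-unique [] _ _ = [] ∷ []
    subproducts-unique (r ∷ rs) S U@(_ ∷ u) = subst Unique (sym (subproducts-∷ r rs))
        (Unique.++⁺ (Unique.map⁺ cancelˡ ih) ih disjoint)
      where
        ih = subproducts-unique rs (simple-tail S) u
        disjoint : ∀ {w} → ¬ (w ∈ map (r ·_) (subproducts rs) × w ∈ subproducts rs)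
        disjoint (p , q) = case ∈-map⁻ (r ·_) p of λ
          { (v , v∈ , refl) → case subproducts-⊆ rs v∈ , subproducts-⊆ rs q of λ
            { ((us , τ , refl) , (vs , σ , eq)) → independent [] S U
                (subst ⟨ rs ⟩ (trans (cong (_· (prodW us ⁻¹)) eq) (group 2 (λ r u → (r ⊙ u) ⊙ inv u ≐ r) refl r (prodW us)))
                  (⟨⟩-· (⊆-⟨⟩ σ) (⟨⟩-inv (proj₁ (simple-tail S)) (⊆-⟨⟩ τ)))) } }

    lower-⟨⟩ : ∀ {rs w} → Good rs → w ≤A prodW rs → ⟨ rs ⟩ w
    lower-⟨⟩ {rs} {w} g w≤ with reducedFactors w
    ... | ts , R , refl , len = ⟨⟩-prod (All.tabulate λ {t} t∈ → closed g (All.lookup R t∈)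
          (≤A-trans (subst (_≤A prodW ts) (idʳ t) (sublist-≤ R (sym len) (singleton-⊆ t∈))) w≤))

    -- A subword through r would allow r to be isolated as a product of elements of ⟨ as ++ bs ⟩,
    -- contrary to `independent`.
    ⊆-remove : ∀ as {r bs us} → Simple (as ++ r ∷ bs) → Unique (as ++ r ∷ bs) → us ⊆ (as ++ r ∷ bs) →
      ⟨ as ++ bs ⟩ (prodW us) → us ⊆ (as ++ bs)
    ⊆-remove as {r} {bs} S U τ p with ⊆-split as τ
    ... | inj₁ σ = σ
    ... | inj₂ (as′ , bs′ , refl , σ , σ′) = contradiction
          (subst ⟨ as ++ bs ⟩ (begin
            (A ⁻¹) · (prodW (as′ ++ r ∷ bs′) · (B ⁻¹))   ≡⟨ cong (λ z → (A ⁻¹) · (z · (B ⁻¹))) (prodW-++ as′ (r ∷ bs′)) ⟩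
            (A ⁻¹) · ((A · (r · B)) · (B ⁻¹))            ≡⟨ group 3 (λ a r b → inv a ⊙ ((a ⊙ (r ⊙ b)) ⊙ inv b) ≐ r) refl A r B ⟩
            r                                            ∎)
            (⟨⟩-· (⟨⟩-inv R (⟨⟩-mono ∈-++⁺ˡ (⊆-⟨⟩ σ))) (⟨⟩-· p (⟨⟩-inv R (⟨⟩-mono (∈-++⁺ʳ as) (⊆-⟨⟩ σ′))))))
          (independent as S U)
      where
        open ≡-Reasoning
        A = prodW as′
        B = prodW bs′
        R : All IsReflection (as ++ bs)
        R = proj₁ (simple-⊆ (remove-mono as) S)

    removed-reflection : W → List W → W
    removed-reflection r bs = r ^^ (prodW bs ⁻¹)

    removed-⟨⟩ : ∀ {rs r bs} → All IsReflection rs → r ∈ rs → (∀ {b} → b ∈ bs → b ∈ rs) → ⟨ rs ⟩ (removed-reflection r bs)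
    removed-⟨⟩ R r∈ f = ⟨⟩-^^ R (⟨⟩-∈ r∈) (⟨⟩-inv R (⟨⟩-mono f (_ , All.tabulate id , refl)))

    -- Otherwise the reflection would be an inversion of the shortened product, hence lie in ⟨ as ++
    -- bs ⟩, and r would lie there with it.
    removed-η : ∀ as {r bs} → Simple (as ++ r ∷ bs) → Unique (as ++ r ∷ bs) →
      η (prodW (as ++ r ∷ bs)) (removed-reflection r bs) ≡ true
    removed-η as {r} {bs} S U = cases (η (prodW (as ++ r ∷ bs)) q) refl
      where
        q : W
        q = removed-reflection r bs
        r∈ : r ∈ as ++ r ∷ bs
        r∈ = ∈-++⁺ʳ as (here refl)
        Rr : IsReflection r
        Rr = All.lookup (proj₁ S) r∈
        Rq : IsReflection q
        Rq = refl-^^ _ Rr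
        cases : ∀ b → η (prodW (as ++ r ∷ bs)) q ≡ b → η (prodW (as ++ r ∷ bs)) q ≡ true
        cases true h = h
        cases false h = contradiction
          (subst ⟨ as ++ bs ⟩ (^^-inv′ r (prodW bs)) (⟨⟩-^^ (proj₁ (simple-⊆ (remove-mono as) S))
            (deletion-⟨⟩ S (remove-mono as) (as ++ bs , All.tabulate id , refl) Rq (removed-⟨⟩ (proj₁ S) r∈ (∈-++⁺ʳ as ∘ there))
              (trans (cong (λ z → η z q) (sym (removed as r bs Rr))) (trans (η-flip Rq _) (cong not h))))
            (⟨⟩-mono (∈-++⁺ʳ as) (bs , All.tabulate id , refl))))
          (independent as S U)

    ≪⇒≤A : ∀ {α β} → α ≪ β → α ≤A β
    ≪⇒≤A ε = ≤A-refl
    ≪⇒≤A (((α≤ , _) , _) ◅ p) = ≤A-trans α≤ (≪⇒≤A p)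

    record StepData (α β : W) : Set where
      field
        t : W
        β≡ : β ≡ α · t
        t≡ : t ≡ (α ⁻¹) · β
        reflection : IsReflection t
        inversion : η α t ≡ true

    stepData : ∀ {α β} → Step α β → StepData α β
    stepData {α} {β} ((α≤β , rk) , ℓ<) = record
      { t = t ; β≡ = β≡ ; t≡ = refl ; reflection = R
      ; inversion = ℓ-descent⁻¹ R (subst (λ z → ℓ z < ℓ α) β≡ ℓ<) }
      where
        t : W
        t = (α ⁻¹) · β
        β≡ : β ≡ α · t
        β≡ = group 2 (λ a b → b ≐ a ⊙ (inv a ⊙ b)) refl α β
        R : IsReflection t
        R = ℓT-1 (ℕ.+-cancelˡ-≡ (ℓT α) _ _ (trans (sym α≤β) (trans (sym rk) (ℕ.+-comm 1 (ℓT α)))))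

    -- Expresses through inversions that no letter of the canonical word of γ can be deleted while
    -- staying above α; `full-or-remove` makes the connection. This form passes to larger α and fits
    -- the cocycle.
    Full : W → W → Set
    Full α γ = ∀ {t} → IsReflection t → t ≤A ((α ⁻¹) · γ) → η γ t ≡ false

    full-up : ∀ {α β γ} → α ≤A β → β ≤A γ → Full α γ → Full β γ
    full-up p q F R t≤ = F R (≤A-trans t≤ (≤A-gapʳ p q))

    module _ {α γ t : W} (F : Full α γ) (R : IsReflection t) (t≤ : t ≤A ((α ⁻¹) · γ)) where
      private
        δ = (α ⁻¹) · γ
        t′ = t ^^ (δ ⁻¹)

      conj-≤ : t′ ≤A δ
      conj-≤ = subst (t′ ≤A_) (group 1 (λ d → inv d ⊙ (d ⊙ inv (inv d)) ≐ d) refl δ) (≤A-^^ (δ ⁻¹) t≤)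

      -- The cocycle for γ = α · δ at t′ has both sides as its two terms, and t′ is no inversion of
      -- γ.
      conj-η : η δ t′ ≡ η α t
      conj-η = xor-false (begin
        η δ t′ xor η α t             ≡⟨ cong (λ z → η δ t′ xor η α z) (sym (^^-inv′ t δ)) ⟩
        η δ t′ xor η α (t′ ^^ δ)     ≡⟨ sym (η-· α δ t′) ⟩
        η (α · δ) t′                 ≡⟨ cong (λ z → η z t′) (group 2 (λ a g → a ⊙ (inv a ⊙ g) ≐ g) refl α γ) ⟩
        η γ t′                       ≡⟨ F (refl-^^ (δ ⁻¹) R) conj-≤ ⟩
        false                        ∎)
        where open ≡-Reasoning

      conj-gap : ((α · t) ⁻¹) · γ ≡ δ · t′
      conj-gap = begin
        ((α · t) ⁻¹) · γ      ≡⟨ group 3 (λ a t g → inv (a ⊙ t) ⊙ g ≐ inv t ⊙ (inv a ⊙ g)) refl α t γ ⟩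
        (t ⁻¹) · δ            ≡⟨ cong (_· δ) (refl-inv R) ⟩
        t · δ                 ≡⟨ group 2 (λ t d → t ⊙ d ≐ d ⊙ (inv d ⊙ (t ⊙ inv (inv d)))) refl t δ ⟩
        δ · t′                ∎
        where open ≡-Reasoning

    -- A step α to α · t uses an inversion t of α. By `conj-η` its conjugate is an inversion of α⁻¹
    -- γ, so multiplying by it deletes one letter of the canonical word ρs.
    full-steps : ∀ {α β γ ρs} → Full α γ → α ≪ β → β ≤A γ → γ ≤A c → Good ρs → prodW ρs ≡ (α ⁻¹) · γ → Below ρs ((β ⁻¹) · γ)
    full-steps {ρs = ρs} F ε β≤ γ≤ g eq = ρs , ⊆-refl , eq
    full-steps {α} {β} {γ} {ρs} F (_◅_ {j = α₁} st rest) β≤ γ≤ g eq =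
      onward (deletion (simple g) ρs (All.tabulate id) R′ (closed g R′ t′≤ρ) ηρ)
      where
        open StepData (stepData st)
        α≤α₁ : α ≤A α₁
        α≤α₁ = proj₁ (proj₁ st)
        α₁≤γ : α₁ ≤A γ
        α₁≤γ = ≤A-trans (≪⇒≤A rest) β≤
        t≤ : t ≤A ((α ⁻¹) · γ)
        t≤ = subst (_≤A ((α ⁻¹) · γ)) (sym t≡) (≤A-gapˡ α≤α₁ α₁≤γ)
        t′ : W
        t′ = t ^^ (((α ⁻¹) · γ) ⁻¹)
        R′ : IsReflection t′
        R′ = refl-^^ _ reflection
        t′≤ρ : t′ ≤A prodW ρs
        t′≤ρ = subst (t′ ≤A_) (sym eq) (conj-≤ {α} {γ} F reflection t≤)
        ηρ : η (prodW ρs) t′ ≡ true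
        ηρ = trans (cong (λ z → η z t′) eq) (trans (conj-η {α} {γ} F reflection t≤) inversion)
        ρ≤c : prodW ρs ≤A c
        ρ≤c = subst (_≤A c) (sym eq) (≤A-trans (complement (≤A-trans α≤α₁ α₁≤γ)) γ≤)
        onward : Deletion ρs t′ → Below ρs ((β ⁻¹) · γ)
        onward (as , r , bs , refl , y) = case full-steps (full-up α≤α₁ α₁≤γ F) rest β≤ γ≤ (good-sublist isC g ρ≤c (remove-⊆ as)) (begin
              prodW (as ++ bs)                                ≡⟨ sym (removed as r bs (All.lookup (refls g) (∈-++⁺ʳ as (here refl)))) ⟩
              prodW (as ++ r ∷ bs) · (r ^^ (prodW bs ⁻¹))     ≡⟨ cong₂ _·_ eq (sym y) ⟩
              ((α ⁻¹) · γ) · t′                               ≡⟨ sym (conj-gap {α} {γ} F reflection t≤) ⟩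
              ((α · t) ⁻¹) · γ                                ≡⟨ cong (λ z → (z ⁻¹) · γ) (sym β≡) ⟩
              (α₁ ⁻¹) · γ                                     ∎) of λ
          { (us , τ , q) → us , ⊆-trans τ (remove-⊆ as) , q }
          where open ≡-Reasoning

    -- Deleting a letter of ρs multiplies by an inversion of its product (`removed-η`), which
    -- `conj-η` turns into an inversion of α, that is, into an upward step.
    full-reach : ∀ n {α β γ ρs us} → length ρs ≤ n → Full α γ → α ≤A γ → γ ≤A c → Good ρs → prodW ρs ≡ (α ⁻¹) · γ →
      us ⊆ ρs → prodW us ≡ (β ⁻¹) · γ → α ≪ β
    full-reach n {α} {β} {γ} {ρs} len F α≤ γ≤ g eq τ q with ⊆-cases τ
    ... | inj₁ refl = subst (α ≪_) α≡β ε
      where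
        α≡β : α ≡ β
        α≡β = begin
          α                                ≡⟨ group 2 (λ a g → a ≐ g ⊙ inv (inv a ⊙ g)) refl α γ ⟩
          γ · (((α ⁻¹) · γ) ⁻¹)            ≡⟨ cong (λ z → γ · (z ⁻¹)) (trans (sym eq) q) ⟩
          γ · (((β ⁻¹) · γ) ⁻¹)            ≡⟨ group 2 (λ a g → g ⊙ inv (inv a ⊙ g) ≐ a) refl β γ ⟩
          β                                ∎
          where open ≡-Reasoning
    full-reach zero {ρs = ρs} len F α≤ γ≤ g eq τ q | inj₂ (as , r , bs , refl , σ) =
      contradiction (subst (_≤ 0) (length-remove as) len) λ ()
    full-reach (suc n) {α} {β} {γ} {ρs} len F α≤ γ≤ g eq τ q | inj₂ (as , r , bs , refl , σ) =
      step ◅ full-reach n (ℕ.≤-pred (subst (_≤ suc n) (length-remove as) len)) (full-up (extendˡ α≤ t≤) αt≤γ F) αt≤γ γ≤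
        (good-sublist isC g ρ≤c (remove-⊆ as)) prod≡ σ q
      where
        open ≡-Reasoning
        δ = (α ⁻¹) · γ
        t′ : W
        t′ = removed-reflection r bs
        Rr : IsReflection r
        Rr = All.lookup (refls g) (∈-++⁺ʳ as (here refl))
        R′ : IsReflection t′
        R′ = refl-^^ _ Rr
        t : W
        t = t′ ^^ δ
        R : IsReflection t
        R = refl-^^ δ R′
        ρ≤c : prodW (as ++ r ∷ bs) ≤A c
        ρ≤c = subst (_≤A c) (sym eq) (≤A-trans (complement α≤) γ≤)
        short : prodW (as ++ bs) ≡ δ · t′
        short = trans (sym (removed as r bs Rr)) (cong (_· t′) eq)
        short≤ : prodW (as ++ bs) ≤A δ
        short≤ = subst (prodW (as ++ bs) ≤A_) eq (sublist-≤ (refls g) (rank≡ g) (remove-⊆ as))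
        t≤ : t ≤A δ
        t≤ = subst (_≤A δ) (begin
            δ · (prodW (as ++ bs) ⁻¹)      ≡⟨ cong (λ z → δ · (z ⁻¹)) short ⟩
            δ · ((δ · t′) ⁻¹)              ≡⟨ cong (δ ·_) (inv-· δ t′) ⟩
            δ · ((t′ ⁻¹) · (δ ⁻¹))         ≡⟨ cong (λ z → δ · (z · (δ ⁻¹))) (refl-inv R′) ⟩
            t                              ∎) (left-complement short≤)
        t^δ : t ^^ (δ ⁻¹) ≡ t′
        t^δ = ^^-inv t′ δ
        αt≤γ : (α · t) ≤A γ
        αt≤γ = extendʳ α≤ t≤
        inversion : η α t ≡ true
        inversion = trans (sym (conj-η {α} {γ} F R t≤)) (trans (cong (η δ) t^δ)
          (trans (cong (λ z → η z t′) (sym eq)) (removed-η as (simple g) (unique g))))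
        step : Step α (α · t)
        step = (extendˡ α≤ t≤ , trans (ℕ.+-comm 1 (ℓT α)) (sym (trans (extend-length α≤ t≤) (cong (ℓT α +_) (ℓT-refl R))))) , ℓ-descent R inversion
        prod≡ : prodW (as ++ bs) ≡ ((α · t) ⁻¹) · γ
        prod≡ = trans short (trans (cong (δ ·_) (sym t^δ)) (sym (conj-gap {α} {γ} F R t≤)))

    -- An inversion of γ below α⁻¹ γ deletes a letter of rs, and the shorter product is still above
    -- α because the reflection can be split off on the right.
    full-or-remove : ∀ {rs α} → Good rs → α ≤A prodW rs → Removal (λ us → α ≤A prodW us) rs ⊎ Full α (prodW rs)
    full-or-remove {rs} {α} g α≤ with removal? (λ us → α ≤A? prodW us) rs
    ... | yes p = inj₁ p
    ... | no ¬p = inj₂ full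
      where
        full : Full α (prodW rs)
        full {t} R t≤ with η (prodW rs) t in eq
        ... | false = refl
        ... | true with deletion (simple g) rs (All.tabulate id) R (closed g R (≤A-trans t≤ (complement α≤))) eq
        ...   | as , r , bs , refl , y = contradiction (removal as r bs (subst (α ≤A_) (begin
                α · (((α ⁻¹) · γ) · (t ⁻¹))         ≡⟨ group 3 (λ a g t → a ⊙ ((inv a ⊙ g) ⊙ inv t) ≐ g ⊙ inv t) refl α γ t ⟩
                γ · (t ⁻¹)                          ≡⟨ cong (γ ·_) (trans (refl-inv R) y) ⟩
                γ · (r ^^ (prodW bs ⁻¹))            ≡⟨ removed as r bs (All.lookup (refls g) (∈-++⁺ʳ as (here refl))) ⟩
                prodW (as ++ bs)                    ∎) (extendˡ α≤ (left-complement t≤)))) ¬p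
          where
            open ≡-Reasoning
            γ = prodW (as ++ r ∷ bs)

    -- Every step multiplies by an inversion of the current element, and `deletion-⟨⟩` keeps
    -- inversions in the parabolic subgroup.
    steps-⟨⟩ : ∀ {rs ss α β} → Good rs → (∀ {s} → s ∈ ss → s ∈ rs) → α ≪ β → β ≤A prodW rs → ⟨ ss ⟩ α → ⟨ ss ⟩ β
    steps-⟨⟩ g f ε β≤ p = p
    steps-⟨⟩ {rs} {ss} {α} g f (_◅_ {j = α₁} st rest) β≤ p = steps-⟨⟩ g f rest β≤
        (subst ⟨ ss ⟩ (sym β≡) (⟨⟩-· p (deletion-⟨⟩ (simple g) f p reflection (closed g reflection t≤) inversion)))
      where
        open StepData (stepData st)
        α₁≤ : α₁ ≤A prodW rs
        α₁≤ = ≤A-trans (≪⇒≤A rest) β≤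
        t≤ : t ≤A prodW rs
        t≤ = subst (_≤A prodW rs) (sym t≡) (≤A-trans (complement (proj₁ (proj₁ st))) α₁≤)

    -- A minimal subproduct above β is reached from β by descents, so it stays in the parabolic subgroup of β.
    parabolic-below : ∀ {as r bs β} → Good (as ++ r ∷ bs) → prodW (as ++ r ∷ bs) ≤A c → β ≤A prodW (as ++ r ∷ bs) →
      ⟨ as ++ bs ⟩ β → β ≤A prodW (as ++ bs)
    parabolic-below {as} {r} {bs} {β} g γ≤ β≤ β∈ = go (length (as ++ r ∷ bs)) ℕ.≤-refl ⊆-refl β≤
      where
        go : ∀ n {us} → length us ≤ n → us ⊆ (as ++ r ∷ bs) → β ≤A prodW us → β ≤A prodW (as ++ bs)
        go n {us} len τ β≤us with full-or-remove (good-sublist isC g γ≤ τ) β≤us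
        go zero len τ β≤us | inj₁ (removal as′ r′ bs′ p) = contradiction (subst (_≤ 0) (length-remove as′) len) λ ()
        go (suc n) len τ β≤us | inj₁ (removal as′ r′ bs′ p) =
          go n (ℕ.≤-pred (subst (_≤ suc n) (length-remove as′) len)) (⊆-trans (remove-⊆ as′) τ) p
        go n {us} len τ β≤us | inj₂ F with good-below isC (≤A-trans (complement β≤us) (≤A-trans (sublist-≤ (refls g) (rank≡ g) τ) γ≤))
        -- The empty sublist of ρs corresponds to the top of the interval, so `full-reach` yields β
        -- ≪ `prodW us`.
        ... | ρs , h , eq = ≤A-trans β≤us (sublist-≤ (refls h′) (rank≡ h′) (⊆-remove as (simple g) (unique g) τ
                (steps-⟨⟩ g (remove-mono as) (full-reach (length ρs) ℕ.≤-refl F β≤us us≤c h eq (minimum ρs) (sym (invˡ (prodW us))))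
                  (sublist-≤ (refls g) (rank≡ g) τ) β∈)))
          where
            us≤c : prodW us ≤A c
            us≤c = ≤A-trans (sublist-≤ (refls g) (rank≡ g) τ) γ≤
            h′ : Good (as ++ bs)
            h′ = good-sublist isC g γ≤ (remove-⊆ as)

    steps-below : ∀ {as r bs α β} → Good (as ++ r ∷ bs) → prodW (as ++ r ∷ bs) ≤A c → α ≤A prodW (as ++ bs) →
      α ≪ β → β ≤A prodW (as ++ r ∷ bs) → β ≤A prodW (as ++ bs)
    steps-below {as} g γ≤ α≤ steps β≤ = parabolic-below {as} g γ≤ β≤
      (steps-⟨⟩ g (remove-mono as) steps β≤ (lower-⟨⟩ (good-sublist isC g γ≤ (remove-⊆ as)) α≤))

    below-remove : ∀ {as r bs α} → Good (as ++ r ∷ bs) → prodW (as ++ r ∷ bs) ≤A c → α ≤A prodW (as ++ bs) →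
      Below (as ++ r ∷ bs) α → Below (as ++ bs) α
    below-remove {as} g γ≤ α≤ (us , τ , refl) = us , ⊆-remove as (simple g) (unique g) τ
      (lower-⟨⟩ (good-sublist isC g γ≤ (remove-⊆ as)) α≤) , refl

    -- If a letter were missing from the subword for α, its removed reflection would be an inversion
    -- of γ below α⁻¹ γ.
    full-below : ∀ {rs α} → Good rs → prodW rs ≤A c → Full α (prodW rs) → Below rs α → α ≡ prodW rs
    full-below {rs} g γ≤ F (us , τ , refl) with ⊆-cases τ
    ... | inj₁ refl = refl
    ... | inj₂ (as , r , bs , refl , σ) = contradiction (trans (sym (removed-η as (simple g) (unique g))) (F R q≤)) true≢false
      where
        Rr : IsReflection r
        Rr = All.lookup (refls g) (∈-++⁺ʳ as (here refl))
        R : IsReflection (removed-reflection r bs)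
        R = refl-^^ _ Rr
        h : Good (as ++ bs)
        h = good-sublist isC g γ≤ (remove-⊆ as)
        q≡ : (prodW (as ++ bs) ⁻¹) · prodW (as ++ r ∷ bs) ≡ removed-reflection r bs
        q≡ = trans (cong (λ z → (z ⁻¹) · prodW (as ++ r ∷ bs)) (sym (removed as r bs Rr)))
          (trans (group 2 (λ g q → inv (g ⊙ q) ⊙ g ≐ inv q) refl (prodW (as ++ r ∷ bs)) (removed-reflection r bs)) (refl-inv R))
        q≤ : removed-reflection r bs ≤A ((prodW us ⁻¹) · prodW (as ++ r ∷ bs))
        q≤ = subst (_≤A ((prodW us ⁻¹) · prodW (as ++ r ∷ bs))) q≡
          (≤A-gapʳ (sublist-≤ (refls h) (rank≡ h) σ) (sublist-≤ (refls g) (rank≡ g) (remove-⊆ as)))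

open Coxeter
import Algebra.Properties.Ring as RingProperties
open import Data.List.Membership.Propositional.Properties using (∈-filter⁺; ∈-filter⁻)
open import Data.Nat using () renaming (_+_ to _+ℕ_)

-- Generating series

module RingSums (R : CommutativeRing 0ℓ 0ℓ) where
  open CommutativeRing R
  open FiniteSum +-commutativeMonoid public
  open RingProperties ring using (-‿distribˡ-*; -‿involutive)

  infixr 8 _^_
  _^_ : Carrier → ℕ → Carrier
  a ^ k = powOp _*_ 1# a k

  infixr 20 [_]?_
  [_]?_ : {P : Set} → Dec P → Carrier → Carrier
  [ d ]? a = if ⌊ d ⌋ then a else 0#

  ^-cong : ∀ {a b} k → a ≈ b → a ^ k ≈ b ^ k
  ^-cong zero h = refl
  ^-cong (suc k) h = *-cong h (^-cong k h)

  ^-+ : ∀ a j k → a ^ (j +ℕ k) ≈ a ^ j * a ^ k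
  ^-+ a zero k = sym (*-identityˡ _)
  ^-+ a (suc j) k = trans (*-congˡ (^-+ a j k)) (sym (*-assoc a _ _))

  *-medial : ∀ a b c d → (a * b) * (c * d) ≈ (a * c) * (b * d)
  *-medial = FiniteSum.medial *-commutativeMonoid {A = ℕ}

  ^-* : ∀ a b k → (a * b) ^ k ≈ a ^ k * b ^ k
  ^-* a b zero = sym (*-identityˡ _)
  ^-* a b (suc k) = trans (*-congˡ (^-* a b k)) (*-medial a b _ _)

  1^ : ∀ k → 1# ^ k ≈ 1#
  1^ zero = refl
  1^ (suc k) = trans (*-identityˡ _) (1^ k)

  ^-neg : ∀ z k → z ^ k ≈ (- z) ^ k * (- 1#) ^ k
  ^-neg z k = trans (^-cong k z≈) (^-* (- z) (- 1#) k)
    where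
      z≈ : z ≈ - z * - 1#
      z≈ = sym (trans (sym (-‿distribˡ-* z (- 1#))) (trans (-‿cong (trans (*-comm z (- 1#)) (trans (sym (-‿distribˡ-* 1# z)) (-‿cong (*-identityˡ z))))) (-‿involutive z)))

  Σ-*ˡ : ∀ {A : Set} (xs : List A) a (f : A → Carrier) → Σ[ xs ] (λ x → a * f x) ≈ a * Σ[ xs ] f
  Σ-*ˡ [] a f = sym (zeroʳ a)
  Σ-*ˡ (x ∷ xs) a f = trans (+-congˡ (Σ-*ˡ xs a f)) (sym (distribˡ a (f x) _))

  Σ-*ʳ : ∀ {A : Set} (xs : List A) a (f : A → Carrier) → Σ[ xs ] (λ x → f x * a) ≈ Σ[ xs ] f * a
  Σ-*ʳ xs a f = trans (Σ-cong xs (λ x → *-comm (f x) a)) (trans (Σ-*ˡ xs a f) (*-comm a _))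

  Σ-cong-∈ : ∀ {A : Set} (xs : List A) {f g : A → Carrier} → (∀ {x} → x ∈ xs → f x ≈ g x) → Σ[ xs ] f ≈ Σ[ xs ] g
  Σ-cong-∈ [] h = refl
  Σ-cong-∈ (x ∷ xs) h = +-cong (h (here ≡.refl)) (Σ-cong-∈ xs (h ∘ there))

  []?-cong : ∀ {P Q : Set} (d : Dec P) (d′ : Dec Q) {a b} → (P → Q) → (Q → P) → (P → a ≈ b) → [ d ]? a ≈ [ d′ ]? b
  []?-cong (yes p) (yes q) f g h = h p
  []?-cong (no _) (no _) f g h = refl
  []?-cong (yes p) (no ¬q) f g h = contradiction (f p) ¬q
  []?-cong (no ¬p) (yes q) f g h = contradiction (g q) ¬p

  []?-yes : ∀ {P : Set} (d : Dec P) {a} → P → [ d ]? a ≈ a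
  []?-yes (yes _) _ = refl
  []?-yes (no ¬p) p = contradiction p ¬p

  []?-no : ∀ {P : Set} (d : Dec P) {a} → ¬ P → [ d ]? a ≈ 0#
  []?-no (yes p) ¬p = contradiction p ¬p
  []?-no (no _) _ = refl

  []?-*ˡ : ∀ {P : Set} (d : Dec P) a b → [ d ]? (a * b) ≈ a * [ d ]? b
  []?-*ˡ (yes _) a b = refl
  []?-*ˡ (no _) a b = sym (zeroʳ a)

  []?-*ʳ : ∀ {P : Set} (d : Dec P) a b → [ d ]? (a * b) ≈ [ d ]? a * b
  []?-*ʳ (yes _) a b = refl
  []?-*ʳ (no _) a b = sym (zeroˡ b)

  []?-× : ∀ {P Q : Set} (d : Dec P) (d′ : Dec Q) {a} → [ d ×-dec d′ ]? a ≈ [ d ]? ([ d′ ]? a)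
  []?-× (yes _) (yes _) = refl
  []?-× (yes _) (no _) = refl
  []?-× (no _) _ = refl

  []?-Σ : ∀ {P A : Set} (d : Dec P) (xs : List A) f → [ d ]? (Σ[ xs ] f) ≈ Σ[ xs ] (λ x → [ d ]? f x)
  []?-Σ (yes _) xs f = refl
  []?-Σ (no _) xs f = sym (Σ-ε xs (λ _ → refl))

  module _ {A : Set} {xs : List A} (U : Unique xs) (full : ∀ x → x ∈ xs) where

    Σ-indicator : ∀ {ys} → Unique ys → (d : ∀ x → Dec (x ∈ ys)) (f : A → Carrier) → Σ[ xs ] (λ x → [ d x ]? f x) ≈ Σ[ ys ] f
    Σ-indicator {ys} V d f = begin
      Σ[ xs ] g                ≈⟨ Σ-↭ g perm ⟩
      Σ[ ys ++ others ] g      ≈⟨ Σ-++ ys others g ⟩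
      Σ[ ys ] g + Σ[ others ] g ≈⟨ +-cong (Σ-cong-∈ ys (λ {x} x∈ → []?-yes (d x) x∈))
                                    (trans (Σ-cong-∈ others {g = λ _ → 0#} (λ {x} x∈ → []?-no (d x) (proj₂ (∈-filter⁻ (¬? ∘ d) {xs = xs} x∈)))) (Σ-ε others (λ _ → refl))) ⟩
      Σ[ ys ] f + 0#           ≈⟨ +-identityʳ _ ⟩
      Σ[ ys ] f                ∎
      where
        open SetoidReasoning setoid
        open import Data.List using (filter)
        open import Relation.Nullary using (¬?)
        open import Data.List.Membership.Propositional.Properties using (∈-filter⁺; ∈-filter⁻)
        g : A → Carrier
        g x = [ d x ]? f x
        others : List A
        others = filter (¬? ∘ d) xs
        perm : xs ↭ ys ++ others
        perm = unique-↭ U (Unique.++⁺ V (Unique.filter⁺ (¬? ∘ d) U) (λ (p , q) → proj₂ (∈-filter⁻ (¬? ∘ d) {xs = xs} q) p))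
          (λ {x} _ → cases x (d x)) (λ _ → full _)
          where
            cases : ∀ x → Dec (x ∈ ys) → x ∈ ys ++ others
            cases x (yes p) = ∈-++⁺ˡ p
            cases x (no ¬p) = ∈-++⁺ʳ ys (∈-filter⁺ (¬? ∘ d) (full x) ¬p)

    Σ-single : (_≟_ : ∀ (x y : A) → Dec (x ≡ y)) → ∀ y (f : A → Carrier) → Σ[ xs ] (λ x → [ y ≟ x ]? f x) ≈ f y
    Σ-single _≟_ y f = trans (Σ-cong xs (λ x → []?-cong (y ≟ x) (single? x) (here ∘ ≡.sym) (λ { (here p) → ≡.sym p }) (λ _ → refl)))
      (trans (Σ-indicator ([] ∷ []) single? f) (+-identityʳ (f y)))
      where
        single? : ∀ x → Dec (x ∈ y ∷ [])
        single? x with y ≟ x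
        ... | yes p = yes (here (≡.sym p))
        ... | no ¬p = no λ { (here p) → ¬p (≡.sym p) }

    Σ-isolate : ∀ y {f g : A → Carrier} → (∀ {x} → x ≢ y → f x ≈ g x) → Σ[ xs ] f ≈ Σ[ xs ] g → f y ≈ g y
    Σ-isolate y {f} {g} h eq = case ∈-∃++ (full y) of λ { (as , bs , ≡.refl) → +-cancelʳ (begin
        f y + Σ[ as ++ bs ] f     ≈⟨ Σ-↭ f (↭-sym (shift y as bs)) ⟩
        Σ[ as ++ y ∷ bs ] f       ≈⟨ eq ⟩
        Σ[ as ++ y ∷ bs ] g       ≈⟨ Σ-↭ g (shift y as bs) ⟩
        g y + Σ[ as ++ bs ] g     ≈⟨ +-congˡ (Σ-cong-∈ (as ++ bs) (λ {x} x∈ → h (λ { ≡.refl → unique-remove-∉ as U x∈ }))) ⟨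
        g y + Σ[ as ++ bs ] f     ∎) }
      where
        open SetoidReasoning setoid
        +-cancelʳ : ∀ {a b c} → a + c ≈ b + c → a ≈ b
        +-cancelʳ {a} {b} {c} p = RingProperties.+-cancelʳ ring c a b p

  binomial : ∀ {A : Set} (rs : List A) y z → Σ[ sublists rs ] (λ us → y ^ length us * z ^ (length rs ∸ length us)) ≈ (y + z) ^ length rs
  binomial [] y z = trans (+-identityʳ _) (*-identityˡ _)
  binomial (r ∷ rs) y z = begin
    Σ[ map (r ∷_) (sublists rs) ++ sublists rs ] term          ≈⟨ Σ-++ (map (r ∷_) (sublists rs)) (sublists rs) term ⟩
    Σ[ map (r ∷_) (sublists rs) ] term + Σ[ sublists rs ] term ≈⟨ +-cong left right ⟩
    y * Σ[ sublists rs ] term′ + z * Σ[ sublists rs ] term′    ≈⟨ distribʳ _ y z ⟨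
    (y + z) * Σ[ sublists rs ] term′                           ≈⟨ *-congˡ (binomial rs y z) ⟩
    (y + z) * (y + z) ^ length rs                              ∎
    where
      open SetoidReasoning setoid
      term = λ us → y ^ length us * z ^ (suc (length rs) ∸ length us)
      term′ = λ us → y ^ length us * z ^ (length rs ∸ length us)
      left : Σ[ map (r ∷_) (sublists rs) ] term ≈ y * Σ[ sublists rs ] term′
      left = trans (reflexive (Σ-map (r ∷_) (sublists rs) term)) (trans (Σ-cong (sublists rs) (λ us → *-assoc y _ _)) (Σ-*ˡ (sublists rs) y term′))
      right : Σ[ sublists rs ] term ≈ z * Σ[ sublists rs ] term′
      right = trans (Σ-cong-∈ (sublists rs) (λ {us} us∈ → begin
          y ^ length us * z ^ (suc (length rs) ∸ length us)     ≡⟨ ≡.cong (λ k → y ^ length us * z ^ k) (ℕ.+-∸-assoc 1 (length-mono-≤ (sublists-⊆ rs us∈))) ⟩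
          y ^ length us * (z * z ^ (length rs ∸ length us))     ≈⟨ *-assoc _ z _ ⟨
          (y ^ length us * z) * z ^ (length rs ∸ length us)     ≈⟨ *-congʳ (*-comm _ z) ⟩
          (z * y ^ length us) * z ^ (length rs ∸ length us)     ≈⟨ *-assoc z _ _ ⟩
          z * term′ us                                          ∎))
        (Σ-*ˡ (sublists rs) z term′)

-- Alternating sums over ≪ and the comparison of both series

module Identity (G : FiniteCoxeterSystem)
  (ℓ ℓT : Cox.W G → ℕ) (isℓ : Cox.IsCoxeterLength G ℓ) (isℓT : Cox.IsAbsoluteLength G ℓT)
  {c : Cox.W G} (isC : Cox.IsStandardCoxeter G c) (≪? : ∀ v w → Dec (Cox.Orders._≪_ G ℓ ℓT v w))
  (R : CommutativeRing 0ℓ 0ℓ) where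
  open Cox G
  open Orders ℓ ℓT
  open SimpleSystems G
  open AbsoluteOrder G ℓ ℓT isℓT
  open Noncrossing G ℓ ℓT isℓ isℓT
  open DescentOrder G ℓ ℓT isℓ isℓT isC
  open CommutativeRing R
  open RingSums R
  open SetoidReasoning setoid
  open import Data.List.Membership.DecPropositional _≟_ using (_∈?_)

  Σ-subproducts : ∀ {rs} → Good rs → ∀ y z →
    Σ[ elems ] (λ α → [ α ∈? subproducts rs ]? (y ^ ℓT α * z ^ (length rs ∸ ℓT α))) ≈ (y + z) ^ length rs
  Σ-subproducts {rs} g y z = begin
    Σ[ elems ] (λ α → [ α ∈? subproducts rs ]? term α)
      ≈⟨ Σ-indicator elems-unique elems-complete (subproducts-unique rs (simple g) (unique g)) (_∈? subproducts rs) term ⟩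
    Σ[ map prodW (sublists rs) ] term
      ≡⟨ Σ-map prodW (sublists rs) term ⟩
    Σ[ sublists rs ] (term ∘ prodW)
      ≈⟨ Σ-cong-∈ (sublists rs) (λ us∈ → reflexive (≡.cong (λ k → y ^ k * z ^ (length rs ∸ k)) (sublist-rank (refls g) (rank≡ g) (sublists-⊆ rs us∈)))) ⟩
    Σ[ sublists rs ] (λ us → y ^ length us * z ^ (length rs ∸ length us))
      ≈⟨ binomial rs y z ⟩
    (y + z) ^ length rs ∎
    where
      term : W → Carrier
      term α = y ^ ℓT α * z ^ (length rs ∸ ℓT α)

  between? : ∀ α γ β → Dec (α ≪ β × β ≤A γ)
  between? α γ β = ≪? α β ×-dec (β ≤A? γ)

  sign : ℕ → Carrier
  sign k = (- 1#) ^ k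

  alternating : W → W → Carrier
  alternating α γ = Σ[ elems ] (λ β → [ between? α γ β ]? sign (ℓT β ∸ ℓT α))

  Σ-elems-bijection : ∀ (φ ψ : W → W) → (∀ w → φ (ψ w) ≡ w) → (∀ {u v} → φ u ≡ φ v → u ≡ v) → ∀ f → Σ[ elems ] f ≈ Σ[ elems ] (f ∘ φ)
  Σ-elems-bijection φ ψ φψ inj f = trans (Σ-↭ f (unique-↭ elems-unique (Unique.map⁺ inj elems-unique)
      (λ {w} _ → ≡.subst (_∈ map φ elems) (φψ w) (∈-map⁺ φ (elems-complete (ψ w)))) (λ _ → elems-complete _)))
    (reflexive (Σ-map φ elems f))

  -- After the substitution β = γ δ⁻¹ the sum runs over the subproducts δ of α⁻¹ γ, with sign
  -- exponent equal to the corank of δ there, so the binomial theorem applies with y = 1 and z = -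
  -- 1.
  alternating-full : ∀ {rs α} → Good rs → prodW rs ≤A c → α ≤A prodW rs → Full α (prodW rs) →
    alternating α (prodW rs) ≈ [ α ∈? subproducts rs ]? 1#
  alternating-full {rs} {α} g γ≤ α≤ F = case good-below isC (≤A-trans (complement α≤) γ≤) of λ { (ρs , h , eq) → main ρs h eq }
    where
      γ : W
      γ = prodW rs
      main : ∀ ρs → Good ρs → prodW ρs ≡ (α ⁻¹) · γ → alternating α γ ≈ [ α ∈? subproducts rs ]? 1#
      main ρs h eq = begin
        Σ[ elems ] (λ β → [ between? α γ β ]? sign (ℓT β ∸ ℓT α))
          ≈⟨ Σ-elems-bijection φ φ⁻¹ φφ⁻¹ φ-injective (λ β → [ between? α γ β ]? sign (ℓT β ∸ ℓT α)) ⟩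
        Σ[ elems ] (λ δ → [ between? α γ (φ δ) ]? sign (ℓT (φ δ) ∸ ℓT α))
          ≈⟨ Σ-cong elems (λ δ → []?-cong (between? α γ (φ δ)) (δ ∈? subproducts ρs) to from (term δ)) ⟩
        Σ[ elems ] (λ δ → [ δ ∈? subproducts ρs ]? (1# ^ ℓT δ * (- 1#) ^ (length ρs ∸ ℓT δ)))
          ≈⟨ Σ-subproducts h 1# (- 1#) ⟩
        (1# + - 1#) ^ length ρs
          ≈⟨ ^-cong (length ρs) (-‿inverseʳ 1#) ⟩
        -- The zeroth power of 0 is 1. The exponent vanishes exactly when α = γ, and by `full-below`
        -- this is the only way for α to be a subproduct here.
        0# ^ length ρs
          ≈⟨ zeroPower (length ρs) ≡.refl ⟩
        [ α ∈? subproducts rs ]? 1# ∎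
        where
          φ φ⁻¹ : W → W
          φ δ = γ · (δ ⁻¹)
          φ⁻¹ β = (β ⁻¹) · γ
          φφ⁻¹ : ∀ β → φ (φ⁻¹ β) ≡ β
          φφ⁻¹ = λ β → group 2 (λ b g → g ⊙ inv (inv b ⊙ g) ≐ b) ≡.refl β γ
          φ⁻¹φ : ∀ δ → (φ δ ⁻¹) · γ ≡ δ
          φ⁻¹φ = λ δ → group 2 (λ d g → inv (g ⊙ inv d) ⊙ g ≐ d) ≡.refl δ γ
          φ-injective : ∀ {u v} → φ u ≡ φ v → u ≡ v
          φ-injective {u} {v} p = ≡.trans (≡.sym (φ⁻¹φ u)) (≡.trans (≡.cong (λ z → (z ⁻¹) · γ) p) (φ⁻¹φ v))
          to : ∀ {δ} → α ≪ φ δ × φ δ ≤A γ → δ ∈ subproducts ρs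
          to {δ} (steps , β≤) = ∈-subproducts (≡.subst (Below ρs) (φ⁻¹φ δ) (full-steps F steps β≤ γ≤ h eq))
          from : ∀ {δ} → δ ∈ subproducts ρs → α ≪ φ δ × φ δ ≤A γ
          from {δ} δ∈ = case subproducts-⊆ ρs δ∈ of λ { (us , τ , q) →
            full-reach (length ρs) ℕ.≤-refl F α≤ γ≤ h eq τ (≡.trans q (≡.sym (φ⁻¹φ δ))) ,
            left-complement (≤A-trans (≡.subst₂ _≤A_ q eq (sublist-≤ (refls h) (rank≡ h) τ)) (complement α≤)) }
          term : ∀ δ → α ≪ φ δ × φ δ ≤A γ → sign (ℓT (φ δ) ∸ ℓT α) ≈ 1# ^ ℓT δ * (- 1#) ^ (length ρs ∸ ℓT δ)
          term δ (steps , β≤) = trans (reflexive (≡.cong sign exponent)) (sym (trans (*-congʳ (1^ (ℓT δ))) (*-identityˡ _)))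
            where
              a = ℓT α
              b = ℓT (φ δ)
              d = ℓT δ
              n = length ρs
              sum : a +ℕ n ≡ b +ℕ d
              sum = ≡.trans (≡.cong (a +ℕ_) (≡.trans (≡.sym (rank≡ h)) (≡.cong ℓT eq)))
                (≡.trans (≡.sym α≤) (≡.trans β≤ (≡.cong (λ z → b +ℕ ℓT z) (φ⁻¹φ δ))))
              exponent : b ∸ a ≡ n ∸ d
              exponent = ≡.trans (≡.sym (ℕ.[m+n]∸[m+o]≡n∸o d b a)) (≡.trans (≡.cong₂ _∸_ (≡.trans (ℕ.+-comm d b) (≡.sym sum)) (ℕ.+-comm d a)) (ℕ.[m+n]∸[m+o]≡n∸o a n d))
          zeroPower : ∀ k → length ρs ≡ k → 0# ^ k ≈ [ α ∈? subproducts rs ]? 1#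
          zeroPower zero len = sym ([]?-yes (α ∈? subproducts rs) (∈-subproducts (rs , ⊆-refl , ≡.sym α≡γ)))
            where
              α≡γ : α ≡ γ
              α≡γ = ≤A-≡ α≤ (ℕ.≤-reflexive (≡.trans α≤ (≡.trans (≡.cong (ℓT α +ℕ_) (≡.trans (≡.cong ℓT (≡.sym eq)) (≡.trans (rank≡ h) len))) (ℕ.+-identityʳ _))))
          zeroPower (suc k) len = trans (zeroˡ _) (sym ([]?-no (α ∈? subproducts rs) λ α∈ →
            case ≡.trans (≡.sym len) (≡.trans (≡.sym (rank≡ h)) (≡.trans (≡.cong ℓT (≡.trans eq
              (≡.trans (≡.cong (λ z → (z ⁻¹) · γ) (full-below g γ≤ F (subproducts-⊆ rs α∈))) (invˡ γ)))) ℓT-e)) of λ ()))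

  alternating-sum : ∀ n {rs α} → length rs ≤ n → Good rs → prodW rs ≤A c → α ≤A prodW rs →
    alternating α (prodW rs) ≈ [ α ∈? subproducts rs ]? 1#
  alternating-sum n {rs} {α} len g γ≤ α≤ with full-or-remove g α≤
  ... | inj₂ F = alternating-full g γ≤ α≤ F
  alternating-sum zero len g γ≤ α≤ | inj₁ (removal as r bs α≤′) = contradiction (≡.subst (_≤ 0) (length-remove as) len) λ ()
  alternating-sum (suc n) {α = α} len g γ≤ α≤ | inj₁ (removal as r bs α≤′) = begin
    alternating α (prodW (as ++ r ∷ bs))
      ≈⟨ Σ-cong elems (λ β → []?-cong (between? α (prodW (as ++ r ∷ bs)) β) (between? α (prodW (as ++ bs)) β)
           (λ (steps , β≤) → steps , steps-below {as} g γ≤ α≤′ steps β≤)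
           (λ (steps , β≤) → steps , ≤A-trans β≤ smaller)
           (λ _ → refl)) ⟩
    alternating α (prodW (as ++ bs))
      ≈⟨ alternating-sum n (ℕ.≤-pred (≡.subst (_≤ suc n) (length-remove as) len)) (good-sublist isC g γ≤ (remove-⊆ as)) (≤A-trans smaller γ≤) α≤′ ⟩
    [ α ∈? subproducts (as ++ bs) ]? 1#
      ≈⟨ []?-cong (α ∈? subproducts (as ++ bs)) (α ∈? subproducts (as ++ r ∷ bs))
           (λ p → case subproducts-⊆ (as ++ bs) p of λ { (us , τ , q) → ∈-subproducts (us , ⊆-trans τ (remove-⊆ as) , q) })
           (λ p → ∈-subproducts (below-remove {as} g γ≤ α≤′ (subproducts-⊆ (as ++ r ∷ bs) p)))
           (λ _ → refl) ⟩
    [ α ∈? subproducts (as ++ r ∷ bs) ]? 1# ∎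
    where
      smaller : prodW (as ++ bs) ≤A prodW (as ++ r ∷ bs)
      smaller = sublist-≤ (refls g) (rank≡ g) (remove-⊆ as)

  -- A unitriangular transform, which takes the coefficients of both series to y ^ ℓT γ (for w = - z).
  Kernel : Carrier → (W → Carrier) → W → Carrier
  Kernel w F γ = Σ[ elems ] (λ β → [ β ≤A? γ ]? (F β * w ^ (ℓT γ ∸ ℓT β)))

  -- Induction on the rank: the terms strictly below γ already agree and cancel, and the diagonal
  -- coefficient is w to the power 0.
  kernel-injective : ∀ w (F F′ : W → Carrier) → (∀ γ → γ ≤A c → Kernel w F γ ≈ Kernel w F′ γ) → ∀ n γ → ℓT γ ≤ n → γ ≤A c → F γ ≈ F′ γ
  kernel-injective w F F′ eq n γ len γ≤ = begin
    F γ                                         ≈⟨ *-identityʳ _ ⟨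
    F γ * 1#                                    ≡⟨ ≡.cong (λ k → F γ * w ^ k) (ℕ.n∸n≡0 (ℓT γ)) ⟨
    F γ * w ^ (ℓT γ ∸ ℓT γ)                     ≈⟨ []?-yes (γ ≤A? γ) ≤A-refl ⟨
    [ γ ≤A? γ ]? (F γ * w ^ (ℓT γ ∸ ℓT γ))      ≈⟨ Σ-isolate elems-unique elems-complete γ others (eq γ γ≤) ⟩
    [ γ ≤A? γ ]? (F′ γ * w ^ (ℓT γ ∸ ℓT γ))     ≈⟨ []?-yes (γ ≤A? γ) ≤A-refl ⟩
    F′ γ * w ^ (ℓT γ ∸ ℓT γ)                    ≡⟨ ≡.cong (λ k → F′ γ * w ^ k) (ℕ.n∸n≡0 (ℓT γ)) ⟩
    F′ γ * 1#                                   ≈⟨ *-identityʳ _ ⟩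
    F′ γ                                        ∎
    where
      smaller : ∀ n → ℓT γ ≤ n → ∀ {β} → β ≢ γ → β ≤A γ → F β ≈ F′ β
      smaller zero l ne β≤ = contradiction (≤A-≡ β≤ (ℕ.≤-trans l z≤n)) ne
      smaller (suc n) l {β} ne β≤ = kernel-injective w F F′ eq n β
        (ℕ.≤-pred (ℕ.≤-trans (ℕ.≰⇒> (λ le → ne (≤A-≡ β≤ le))) l)) (≤A-trans β≤ γ≤)
      others : ∀ {β} → β ≢ γ → [ β ≤A? γ ]? (F β * w ^ (ℓT γ ∸ ℓT β)) ≈ [ β ≤A? γ ]? (F′ β * w ^ (ℓT γ ∸ ℓT β))
      others {β} ne = []?-cong (β ≤A? γ) (β ≤A? γ) id id (λ β≤ → *-congʳ (smaller n len ne β≤))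

  ∸-chain : ∀ {α β γ} → α ≤A β → β ≤A γ → ℓT γ ∸ ℓT α ≡ (ℓT β ∸ ℓT α) +ℕ (ℓT γ ∸ ℓT β)
  ∸-chain {α} {β} {γ} p q = ≡.trans (≡.cong (_∸ ℓT α) (≡.sym (ℕ.m∸n+n≡m (≤A⇒≤ q))))
    (≡.trans (ℕ.+-∸-assoc (ℓT γ ∸ ℓT β) (≤A⇒≤ p)) (ℕ.+-comm (ℓT γ ∸ ℓT β) _))

  module _ (y z : Carrier) where

    descentPoly : W → Carrier
    descentPoly β = Σ[ elems ] (λ α → [ ≪? α β ]? ((y + z) ^ ℓT α * z ^ (ℓT β ∸ ℓT α)))

    -- This is where the shift to y + z comes from: the alternating sums leave only the subproducts
    -- of γ, and the binomial theorem for y + z and - z then returns a power of y.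
    kernel-descent : ∀ γ → γ ≤A c → Kernel (- z) descentPoly γ ≈ y ^ ℓT γ
    kernel-descent γ₀ γ₀≤ = case good-below isC γ₀≤ of λ { (rs , g , ≡.refl) → main rs g γ₀≤ }
      where
        main : ∀ rs → Good rs → prodW rs ≤A c → Kernel (- z) descentPoly (prodW rs) ≈ y ^ ℓT (prodW rs)
        main rs g γ≤ = begin
          Σ[ elems ] (λ β → [ β ≤A? γ ]? (descentPoly β * w (ℓT γ ∸ ℓT β)))
            ≈⟨ Σ-cong elems (λ β → trans ([]?-cong (β ≤A? γ) (β ≤A? γ) id id (λ _ → sym (Σ-*ʳ elems (w (ℓT γ ∸ ℓT β)) _)))
                 ([]?-Σ (β ≤A? γ) elems _)) ⟩
          Σ[ elems ] (λ β → Σ[ elems ] (λ α → [ β ≤A? γ ]? ([ ≪? α β ]? (Y α * z ^ (ℓT β ∸ ℓT α)) * w (ℓT γ ∸ ℓT β))))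
            ≈⟨ Σ-swap elems elems _ ⟩
          Σ[ elems ] (λ α → Σ[ elems ] (λ β → [ β ≤A? γ ]? ([ ≪? α β ]? (Y α * z ^ (ℓT β ∸ ℓT α)) * w (ℓT γ ∸ ℓT β))))
            ≈⟨ Σ-cong elems (λ α → trans (Σ-cong elems (λ β → pointwise α β)) (Σ-*ˡ elems (Y α * w (ℓT γ ∸ ℓT α)) _)) ⟩
          Σ[ elems ] (λ α → (Y α * w (ℓT γ ∸ ℓT α)) * alternating α γ)
            ≈⟨ Σ-cong elems collapse ⟩
          Σ[ elems ] (λ α → [ α ∈? subproducts rs ]? (Y α * (- z) ^ (length rs ∸ ℓT α)))
            ≈⟨ Σ-subproducts g (y + z) (- z) ⟩
          ((y + z) + - z) ^ length rs
            ≈⟨ ^-cong (length rs) (trans (+-assoc y z (- z)) (trans (+-congˡ (-‿inverseʳ z)) (+-identityʳ y))) ⟩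
          y ^ length rs
            ≡⟨ ≡.cong (y ^_) (≡.sym (rank≡ g)) ⟩
          y ^ ℓT γ ∎
          where
            γ : W
            γ = prodW rs
            w : ℕ → Carrier
            w k = (- z) ^ k
            Y : W → Carrier
            Y α = (y + z) ^ ℓT α
            pointwise : ∀ α β → [ β ≤A? γ ]? ([ ≪? α β ]? (Y α * z ^ (ℓT β ∸ ℓT α)) * w (ℓT γ ∸ ℓT β))
              ≈ (Y α * w (ℓT γ ∸ ℓT α)) * [ between? α γ β ]? sign (ℓT β ∸ ℓT α)
            pointwise α β = trans (combine (≪? α β) (β ≤A? γ)) ([]?-*ˡ (between? α γ β) _ _)
              where
                merge : α ≪ β → β ≤A γ → (Y α * z ^ (ℓT β ∸ ℓT α)) * w (ℓT γ ∸ ℓT β) ≈ (Y α * w (ℓT γ ∸ ℓT α)) * sign (ℓT β ∸ ℓT α)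
                merge steps β≤ = begin
                  (Y α * z ^ i) * w j               ≈⟨ *-assoc (Y α) _ _ ⟩
                  -- Splitting the sign off z ^ i leaves powers of - z whose total exponent depends
                  -- only on α and γ; the sum over β is then purely one of signs.
                  Y α * (z ^ i * w j)               ≈⟨ *-congˡ (*-congʳ (^-neg z i)) ⟩
                  Y α * ((w i * sign i) * w j)      ≈⟨ *-congˡ (trans (*-assoc (w i) _ _) (trans (*-congˡ (*-comm (sign i) (w j))) (sym (*-assoc (w i) _ _)))) ⟩
                  Y α * ((w i * w j) * sign i)      ≈⟨ *-congˡ (*-congʳ (^-+ (- z) i j)) ⟨
                  Y α * (w (i +ℕ j) * sign i)       ≡⟨ ≡.cong (λ k → Y α * (w k * sign i)) (∸-chain (≪⇒≤A steps) β≤) ⟨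
                  Y α * (w (ℓT γ ∸ ℓT α) * sign i)  ≈⟨ *-assoc (Y α) _ _ ⟨
                  (Y α * w (ℓT γ ∸ ℓT α)) * sign i  ∎
                  where
                    i = ℓT β ∸ ℓT α
                    j = ℓT γ ∸ ℓT β
                combine : (d : Dec (α ≪ β)) (d′ : Dec (β ≤A γ)) → [ d′ ]? ([ d ]? (Y α * z ^ (ℓT β ∸ ℓT α)) * w (ℓT γ ∸ ℓT β))
                  ≈ [ d ×-dec d′ ]? ((Y α * w (ℓT γ ∸ ℓT α)) * sign (ℓT β ∸ ℓT α))
                combine (yes p) (yes q) = merge p q
                combine (yes _) (no _) = refl
                combine (no _) (yes _) = zeroˡ _
                combine (no _) (no _) = refl
            collapse : ∀ α → (Y α * w (ℓT γ ∸ ℓT α)) * alternating α γ ≈ [ α ∈? subproducts rs ]? (Y α * (- z) ^ (length rs ∸ ℓT α))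
            collapse α = cases (α ≤A? γ)
              where
                cases : Dec (α ≤A γ) → (Y α * w (ℓT γ ∸ ℓT α)) * alternating α γ ≈ [ α ∈? subproducts rs ]? (Y α * (- z) ^ (length rs ∸ ℓT α))
                cases (yes α≤) = begin
                  (Y α * w (ℓT γ ∸ ℓT α)) * alternating α γ                        ≈⟨ *-congˡ (alternating-sum (length rs) ℕ.≤-refl g γ≤ α≤) ⟩
                  (Y α * w (ℓT γ ∸ ℓT α)) * [ α ∈? subproducts rs ]? 1#            ≈⟨ []?-*ˡ (α ∈? subproducts rs) _ _ ⟨
                  [ α ∈? subproducts rs ]? ((Y α * w (ℓT γ ∸ ℓT α)) * 1#)          ≈⟨ []?-cong (α ∈? subproducts rs) (α ∈? subproducts rs) id id
                      (λ _ → trans (*-identityʳ _) (reflexive (≡.cong (λ k → Y α * w (k ∸ ℓT α)) (rank≡ g)))) ⟩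
                  [ α ∈? subproducts rs ]? (Y α * (- z) ^ (length rs ∸ ℓT α))      ∎
                cases (no α≰) = trans (*-congˡ (Σ-ε elems (λ β → []?-no (between? α γ β) (λ (steps , β≤) → α≰ (≤A-trans (≪⇒≤A steps) β≤)))))
                  (trans (zeroʳ _) (sym ([]?-no (α ∈? subproducts rs) (λ p → case subproducts-⊆ rs p of λ
                    { (us , τ , ≡.refl) → α≰ (sublist-≤ (refls g) (rank≡ g) τ) }))))

    module _ (μ : W → W → Carrier) (isμ : Series.IsMobius R c μ) where

      mobiusPoly : W → Carrier
      mobiusPoly β = Σ[ elems ] (λ α → [ α ≤A? β ]? (μ α β * (y ^ ℓT α * (- z) ^ (ℓT β ∸ ℓT α))))

      -- The two powers of - z combine to one that is independent of β, so the inner sum is the sum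
      -- of μ over an interval, as in the definition of μ.
      kernel-mobius : ∀ γ → γ ≤A c → Kernel (- z) mobiusPoly γ ≈ y ^ ℓT γ
      kernel-mobius γ γ≤ = begin
        Σ[ elems ] (λ β → [ β ≤A? γ ]? (mobiusPoly β * w (ℓT γ ∸ ℓT β)))
          ≈⟨ Σ-cong elems (λ β → trans ([]?-cong (β ≤A? γ) (β ≤A? γ) id id (λ _ → sym (Σ-*ʳ elems (w (ℓT γ ∸ ℓT β)) _)))
               ([]?-Σ (β ≤A? γ) elems _)) ⟩
        Σ[ elems ] (λ β → Σ[ elems ] (λ α → [ β ≤A? γ ]? ([ α ≤A? β ]? (μ α β * (y ^ ℓT α * w (ℓT β ∸ ℓT α))) * w (ℓT γ ∸ ℓT β))))
          ≈⟨ Σ-swap elems elems _ ⟩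
        Σ[ elems ] (λ α → Σ[ elems ] (λ β → [ β ≤A? γ ]? ([ α ≤A? β ]? (μ α β * (y ^ ℓT α * w (ℓT β ∸ ℓT α))) * w (ℓT γ ∸ ℓT β))))
          ≈⟨ Σ-cong elems (λ α → trans (Σ-cong elems (λ β → pointwise α β)) (Σ-*ʳ elems (y ^ ℓT α * w (ℓT γ ∸ ℓT α)) _)) ⟩
        Σ[ elems ] (λ α → Σ[ elems ] (λ β → [ interval? α β ]? μ α β) * (y ^ ℓT α * w (ℓT γ ∸ ℓT α)))
          ≈⟨ Σ-cong elems collapse ⟩
        Σ[ elems ] (λ α → [ γ ≟ α ]? (y ^ ℓT α * w (ℓT γ ∸ ℓT α)))
          ≈⟨ Σ-single elems-unique elems-complete _≟_ γ _ ⟩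
        y ^ ℓT γ * w (ℓT γ ∸ ℓT γ)
          ≡⟨ ≡.cong (λ k → y ^ ℓT γ * w k) (ℕ.n∸n≡0 (ℓT γ)) ⟩
        y ^ ℓT γ * 1#
          ≈⟨ *-identityʳ _ ⟩
        y ^ ℓT γ ∎
        where
          w : ℕ → Carrier
          w k = (- z) ^ k
          interval? : ∀ α β → Dec (β ≤A c × α ≤A β × β ≤A γ)
          interval? α β = (β ≤A? c) ×-dec ((α ≤A? β) ×-dec (β ≤A? γ))
          pointwise : ∀ α β → [ β ≤A? γ ]? ([ α ≤A? β ]? (μ α β * (y ^ ℓT α * w (ℓT β ∸ ℓT α))) * w (ℓT γ ∸ ℓT β))
            ≈ [ interval? α β ]? μ α β * (y ^ ℓT α * w (ℓT γ ∸ ℓT α))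
          pointwise α β = trans (combine (α ≤A? β) (β ≤A? γ)) (trans ([]?-cong ((α ≤A? β) ×-dec (β ≤A? γ)) (interval? α β)
              (λ (p , q) → ≤A-trans q γ≤ , p , q) proj₂ (λ _ → refl)) ([]?-*ʳ (interval? α β) _ _))
            where
              merge : α ≤A β → β ≤A γ → (μ α β * (y ^ ℓT α * w (ℓT β ∸ ℓT α))) * w (ℓT γ ∸ ℓT β) ≈ μ α β * (y ^ ℓT α * w (ℓT γ ∸ ℓT α))
              merge p q = begin
                (μ α β * (y ^ ℓT α * w i)) * w j   ≈⟨ *-assoc (μ α β) _ _ ⟩
                μ α β * ((y ^ ℓT α * w i) * w j)   ≈⟨ *-congˡ (*-assoc (y ^ ℓT α) _ _) ⟩
                μ α β * (y ^ ℓT α * (w i * w j))   ≈⟨ *-congˡ (*-congˡ (^-+ (- z) i j)) ⟨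
                μ α β * (y ^ ℓT α * w (i +ℕ j))    ≡⟨ ≡.cong (λ k → μ α β * (y ^ ℓT α * w k)) (∸-chain p q) ⟨
                μ α β * (y ^ ℓT α * w (ℓT γ ∸ ℓT α)) ∎
                where
                  i = ℓT β ∸ ℓT α
                  j = ℓT γ ∸ ℓT β
              combine : (d : Dec (α ≤A β)) (d′ : Dec (β ≤A γ)) → [ d′ ]? ([ d ]? (μ α β * (y ^ ℓT α * w (ℓT β ∸ ℓT α))) * w (ℓT γ ∸ ℓT β))
                ≈ [ d ×-dec d′ ]? (μ α β * (y ^ ℓT α * w (ℓT γ ∸ ℓT α)))
              combine (yes p) (yes q) = merge p q
              combine (yes _) (no _) = refl
              combine (no _) (yes _) = zeroˡ _
              combine (no _) (no _) = refl
          collapse : ∀ α → Σ[ elems ] (λ β → [ interval? α β ]? μ α β) * (y ^ ℓT α * w (ℓT γ ∸ ℓT α)) ≈ [ γ ≟ α ]? (y ^ ℓT α * w (ℓT γ ∸ ℓT α))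
          collapse α = cases (α ≤A? γ)
            where
              cases : Dec (α ≤A γ) → Σ[ elems ] (λ β → [ interval? α β ]? μ α β) * (y ^ ℓT α * w (ℓT γ ∸ ℓT α)) ≈ [ γ ≟ α ]? (y ^ ℓT α * w (ℓT γ ∸ ℓT α))
              cases (yes α≤) = trans (*-congʳ (isμ α γ (≤A-trans α≤ γ≤) γ≤ α≤))
                (trans (sym ([]?-*ʳ (α ≟ γ) 1# _)) ([]?-cong (α ≟ γ) (γ ≟ α) ≡.sym ≡.sym (λ _ → *-identityˡ _)))
              cases (no α≰) = trans (*-congʳ (Σ-ε elems (λ β → []?-no (interval? α β) (λ (_ , p , q) → α≰ (≤A-trans p q)))))
                (trans (zeroˡ _) (sym ([]?-no (γ ≟ α) (λ { ≡.refl → α≰ ≤A-refl }))))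

      mobius≈descent : ∀ β → β ≤A c → mobiusPoly β ≈ descentPoly β
      mobius≈descent β = kernel-injective (- z) mobiusPoly descentPoly
        (λ γ γ≤ → trans (kernel-mobius γ γ≤) (sym (kernel-descent γ γ≤))) (ℓT β) β ℕ.≤-refl

      module _ (X : W → Carrier) where

        -- Since α ∼ β ≤ c implies α ≤ c, for fixed β the inner sum over α is governed by `d` alone
        -- and the weight `X β` factors out.
        group-by-top : ∀ (_∼_ : W → W → Set) (d : ∀ α β → Dec (α ∼ β)) → (∀ {α β} → α ∼ β → α ≤A β) →
          (F H : W → W → Carrier) → (∀ α β → F α β ≈ X β * H α β) →
          Σ[ elems ] (λ α → Σ[ elems ] (λ β → [ (α ≤A? c) ×-dec ((β ≤A? c) ×-dec d α β) ]? F α β))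
            ≈ Σ[ elems ] (λ β → [ β ≤A? c ]? (X β * Σ[ elems ] (λ α → [ d α β ]? H α β)))
        group-by-top _∼_ d ∼⇒≤ F H F≈ = trans (Σ-swap elems elems _) (Σ-cong elems (λ β → begin
          Σ[ elems ] (λ α → [ (α ≤A? c) ×-dec ((β ≤A? c) ×-dec d α β) ]? F α β)
            ≈⟨ Σ-cong elems (λ α → trans ([]?-cong ((α ≤A? c) ×-dec ((β ≤A? c) ×-dec d α β)) ((β ≤A? c) ×-dec d α β)
                 proj₂ (λ (p , q) → ≤A-trans (∼⇒≤ q) p , p , q) (λ _ → F≈ α β))
                 (trans ([]?-× (β ≤A? c) (d α β)) ([]?-cong (β ≤A? c) (β ≤A? c) id id (λ _ → []?-*ˡ (d α β) (X β) (H α β))))) ⟩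
          Σ[ elems ] (λ α → [ β ≤A? c ]? (X β * [ d α β ]? H α β))
            ≈⟨ []?-Σ (β ≤A? c) elems _ ⟨
          [ β ≤A? c ]? (Σ[ elems ] (λ α → X β * [ d α β ]? H α β))
            ≈⟨ []?-cong (β ≤A? c) (β ≤A? c) id id (λ _ → Σ-*ˡ elems (X β) _) ⟩
          [ β ≤A? c ]? (X β * Σ[ elems ] (λ α → [ d α β ]? H α β)) ∎))

        series≈ : Σ[ elems ] (λ α → Σ[ elems ] (λ β → [ (α ≤A? c) ×-dec ((β ≤A? c) ×-dec (α ≤A? β)) ]?
                      (μ α β * X β * y ^ ℓT α * (- z) ^ (ℓT β ∸ ℓT α))))
          ≈ Σ[ elems ] (λ α → Σ[ elems ] (λ β → [ (α ≤A? c) ×-dec ((β ≤A? c) ×-dec ≪? α β) ]?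
                      (X β * (y + z) ^ ℓT α * z ^ (ℓT β ∸ ℓT α))))
        series≈ = begin
          _ ≈⟨ group-by-top _≤A_ _≤A?_ id _ (λ α β → μ α β * (y ^ ℓT α * (- z) ^ (ℓT β ∸ ℓT α)))
                 (λ α β → trans (*-assoc (μ α β * X β) _ _) (trans (*-congʳ (*-comm (μ α β) (X β))) (*-assoc (X β) _ _))) ⟩
          Σ[ elems ] (λ β → [ β ≤A? c ]? (X β * mobiusPoly β))
            ≈⟨ Σ-cong elems (λ β → []?-cong (β ≤A? c) (β ≤A? c) id id (λ β≤ → *-congˡ (mobius≈descent β β≤))) ⟩
          Σ[ elems ] (λ β → [ β ≤A? c ]? (X β * descentPoly β))
            ≈⟨ group-by-top _≪_ ≪? ≪⇒≤A _ (λ α β → (y + z) ^ ℓT α * z ^ (ℓT β ∸ ℓT α)) (λ α β → *-assoc (X β) _ _) ⟨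
          _ ∎

theorem9p2 : (G : FiniteCoxeterSystem) →
    let open Cox G in
    (ℓ ℓT : W → ℕ) → IsCoxeterLength ℓ → IsAbsoluteLength ℓT →
    (supp? : ∀ i w → Dec (InSupp i w)) →
    let open Orders ℓ ℓT in
    (≪? : ∀ v w → Dec (v ≪ w)) →
    (c : W) → IsStandardCoxeter c →
    (R : CommutativeRing 0ℓ 0ℓ) →
    let open Series R in
    let open CommutativeRing R in
    (μ : W → W → Carrier) → IsMobius c μ →
    (x : Fin rank → Carrier) (y z : Carrier) →
    Mser supp? μ c x y z ≈ Iser supp? ≪? c x (y + z) z
theorem9p2 G ℓ ℓT isℓ isℓT supp? ≪? c isC R μ isμ x y z =
  Identity.series≈ G ℓ ℓT isℓ isℓT isC ≪? R y z μ isμ (Cox.Orders.Series.xmon G ℓ ℓT R supp? x)
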